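{- Let $n\ge1$. There exists a constant $C$ such that every $\alpha\in S^n$ is $(C,1/2,1/2)$-uniformly Dirichlet in $S^n$; that is, for every $\alpha\in S^n$ and every real $N>1$ there exists $(\mathbf{p},q)\in\mathbb{Z}^{n+1}\times\mathbb{N}$ with $\frac{\mathbf{p}}{q}\in S^n$, $q\le N$ and $$\left\|\alpha-\frac{\mathbf{p}}{q}\right\|<\frac{C}{q^{1/2}N^{1/2}}.$$
   Context: $S^n\subset\mathbb{R}^{n+1}$ is the Euclidean unit sphere and $\|\cdot\|$ is the supremum norm on $\mathbb{R}^{n+1}$. For $X\subset\mathbb{R}^{n+1}$ and real $C,a,b$, a point $\alpha\in X$ is called $(C,a,b)$-uniformly Dirichlet in $X$ if for every $N>1$ there exists a rational point $\frac{\mathbf{p}}{q}\in X$ with $q\le N$ and $\|\alpha-\frac{\mathbf{p}}{q}\|<\frac{C}{q^aN^b}$. -}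

module Defs where

open import Data.Integer.Base as ℤ using (ℤ; +[1+_]; -[1+_])
import Data.Integer.Properties as ℤₚ
open import Data.Nat.Base as ℕ using (ℕ; zero; suc)
import Data.Nat.Properties as ℕₚ
open import Data.Product.Base using (Σ-syntax; ∃-syntax; _×_; _,_; proj₁; proj₂)
open import Data.Rational.Base as ℚ using (ℚ; 0ℚ; 1ℚ; ½)
import Data.Rational.Properties as ℚₚ
open import Data.Rational.Solver using (module +-*-Solver)
open import Data.Rational.Unnormalised.Base as ℚᵘ using (mkℚᵘ)
import Data.Rational.Unnormalised.Properties as ℚᵘₚ
open import Data.Sum.Base using (inj₁; inj₂)
open import Data.Vec.Functional using (Vector; foldr)
open import Relation.Binary.PropositionalEquality
open import Level using (0ℓ)
open import Relation.Unary using (Pred; _∈_)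
open import Relation.Nullary using (yes; no; contradiction)

module RationalLemmas where
  open import Data.Rational.Base
  open ℚₚ.≤-Reasoning
  open +-*-Solver

  fromℕ : ℕ → ℚ
  fromℕ j = ℤ.+ j / 1

  step : ℕ → ℚ
  step m = ℤ.+ 1 / suc m

  -- The largest of 0, h, 2h, …, jh whose square is at most r (for 0 ≤ r).
  gridRoot : (r h : ℚ) (j : ℕ) → ℚ
  gridRoot r h zero    = 0ℚ
  gridRoot r h (suc j) with (fromℕ (suc j) * h) * (fromℕ (suc j) * h) ℚₚ.≤? r
  ... | yes _ = fromℕ (suc j) * h
  ... | no _  = gridRoot r h j

  -- Approximates the square root of max(p, 0) from below, with error less
  -- than step m.  The last argument makes the grid reach past the root.
  rootApprox : ℕ → ℚ → ℚ
  rootApprox m p = gridRoot (p ⊔ 0ℚ) (step m) (suc m ℕ.* suc ℤ.∣ ↥ (p ⊔ 0ℚ) ∣)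

  -- Total on ℚ; the value at 0 is irrelevant.
  recip : ℚ → ℚ
  recip p with p ℚₚ.≟ 0ℚ
  ... | yes _   = 0ℚ
  ... | no p≢0 = (1/ p) {{≢-nonZero p≢0}}

  recip-* : ∀ {p} → 0ℚ < p → p * recip p ≡ 1ℚ
  recip-* {p} p>0 with p ℚₚ.≟ 0ℚ
  ... | yes refl = contradiction p>0 (ℚₚ.<-irrefl refl)
  ... | no p≢0   = ℚₚ.*-inverseʳ p {{≢-nonZero p≢0}}

  *-pos : ∀ {p q} → 0ℚ < p → 0ℚ < q → 0ℚ < p * q
  *-pos {p} {q} p>0 q>0 =
    ℚₚ.positive⁻¹ (p * q) {{ℚₚ.pos*pos⇒pos p {{positive p>0}} q {{positive q>0}}}}

  *-mono-≤ : ∀ {p q r s} → 0ℚ ≤ p → 0ℚ ≤ s → p ≤ q → r ≤ s → p * r ≤ q * s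
  *-mono-≤ {p} {q} {r} {s} p≥0 s≥0 p≤q r≤s = begin
    p * r ≤⟨ ℚₚ.*-monoˡ-≤-nonNeg p {{nonNegative p≥0}} r≤s ⟩
    p * s ≤⟨ ℚₚ.*-monoʳ-≤-nonNeg s {{nonNegative s≥0}} p≤q ⟩
    q * s ∎

  *-mono-< : ∀ {p q r s} → 0ℚ ≤ p → 0ℚ ≤ r → p < q → r < s → p * r < q * s
  *-mono-< {p} {q} {r} {s} p≥0 r≥0 p<q r<s = begin-strict
    p * r ≤⟨ ℚₚ.*-monoʳ-≤-nonNeg r {{nonNegative r≥0}} (ℚₚ.<⇒≤ p<q) ⟩
    q * r <⟨ ℚₚ.*-monoʳ-<-pos q {{positive (ℚₚ.≤-<-trans p≥0 p<q)}} r<s ⟩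
    q * s ∎

  recip-pos : ∀ {p} → 0ℚ < p → 0ℚ < recip p
  recip-pos {p} p>0 = ℚₚ.≰⇒> λ r≤0 → ℚₚ.<-irrefl refl (begin-strict
    p * recip p ≤⟨ ℚₚ.*-monoˡ-≤-nonNeg p {{nonNegative (ℚₚ.<⇒≤ p>0)}} r≤0 ⟩
    p * 0ℚ      ≡⟨ ℚₚ.*-zeroʳ p ⟩
    0ℚ          <⟨ ℚₚ.positive⁻¹ 1ℚ ⟩
    1ℚ          ≡⟨ recip-* p>0 ⟨
    p * recip p ∎)

  square-cancel-< : ∀ {p q} → 0ℚ ≤ q → p * p < q * q → p < q
  square-cancel-< {p} {q} q≥0 p²<q² = ℚₚ.≰⇒> λ q≤p →
    ℚₚ.<-irrefl refl (ℚₚ.<-≤-trans p²<q² (*-mono-≤ q≥0 (ℚₚ.≤-trans q≥0 q≤p) q≤p q≤p))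

  half-pos : ∀ {ε} → 0ℚ < ε → 0ℚ < ½ * ε
  half-pos = *-pos (ℚₚ.positive⁻¹ ½)

  halves : ∀ ε → ½ * ε + ½ * ε ≡ ε
  halves ε = trans (sym (ℚₚ.*-distribʳ-+ ε ½ ½)) (ℚₚ.*-identityˡ ε)

  p≤∣p∣ : ∀ p → p ≤ ∣ p ∣
  p≤∣p∣ p with ℚₚ.≤-total 0ℚ p
  ... | inj₁ 0≤p = ℚₚ.≤-reflexive (sym (ℚₚ.0≤p⇒∣p∣≡p 0≤p))
  ... | inj₂ p≤0 = ℚₚ.≤-trans p≤0 (ℚₚ.0≤∣p∣ p)

  dist-sym : ∀ a b → ∣ a - b ∣ ≡ ∣ b - a ∣
  dist-sym a b = trans (cong ∣_∣ (solve 2 (λ a b → a :- b := :- (b :- a)) refl a b)) (ℚₚ.∣-p∣≡∣p∣ (b - a))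

  dist⇒< : ∀ a b {ε} → ∣ a - b ∣ < ε → a < b + ε
  dist⇒< a b {ε} d = begin-strict
    a           ≡⟨ solve 2 (λ a b → a := b :+ (a :- b)) refl a b ⟩
    b + (a - b) ≤⟨ ℚₚ.+-monoʳ-≤ b (p≤∣p∣ (a - b)) ⟩
    b + ∣ a - b ∣ <⟨ ℚₚ.+-monoʳ-< b d ⟩
    b + ε ∎

  dist⇒<′ : ∀ a b {ε} → ∣ a - b ∣ < ε → b < a + ε
  dist⇒<′ a b d = dist⇒< b a (subst (_< _) (dist-sym a b) d)

  <⇒sub< : ∀ {a b ε} → a < b + ε → a - b < ε
  <⇒sub< {a} {b} {ε} a< = begin-strict
    a - b       <⟨ ℚₚ.+-monoˡ-< (- b) a< ⟩
    b + ε - b   ≡⟨ solve 2 (λ b ε → b :+ ε :- b := ε) refl b ε ⟩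
    ε ∎

  <⇒dist : ∀ {a b ε} → a < b + ε → b < a + ε → ∣ a - b ∣ < ε
  <⇒dist {a} {b} {ε} a< b< with ℚₚ.∣p∣≡p∨∣p∣≡-p (a - b)
  ... | inj₁ e = subst (_< ε) (sym e) (<⇒sub< a<)
  ... | inj₂ e = subst (_< ε) (sym (trans e (solve 2 (λ a b → :- (a :- b) := b :- a) refl a b))) (<⇒sub< b<)

  dist-refl : ∀ {p ε} → 0ℚ < ε → ∣ p - p ∣ < ε
  dist-refl {p} {ε} ε>0 = subst (λ d → ∣ d ∣ < ε) (sym (ℚₚ.+-inverseʳ p)) ε>0

  dist-neg : ∀ {a b ε} → ∣ a - b ∣ < ε → ∣ - a - (- b) ∣ < ε
  dist-neg {a} {b} {ε} = subst (_< ε) (trans (sym (ℚₚ.∣-p∣≡∣p∣ (a - b)))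
    (cong ∣_∣ (solve 2 (λ a b → :- (a :- b) := :- a :- (:- b)) refl a b)))

  dist-abs : ∀ {a b ε} → ∣ a - b ∣ < ε → ∣ ∣ a ∣ - ∣ b ∣ ∣ < ε
  dist-abs {a} {b} {ε} d = <⇒dist (one a b d) (one b a (subst (_< ε) (dist-sym a b) d))
    where
    one : ∀ a b → ∣ a - b ∣ < ε → ∣ a ∣ < ∣ b ∣ + ε
    one a b d = begin-strict
      ∣ a ∣             ≡⟨ cong ∣_∣ (solve 2 (λ a b → a := b :+ (a :- b)) refl a b) ⟩
      ∣ b + (a - b) ∣   ≤⟨ ℚₚ.∣p+q∣≤∣p∣+∣q∣ b (a - b) ⟩
      ∣ b ∣ + ∣ a - b ∣ <⟨ ℚₚ.+-monoʳ-< ∣ b ∣ d ⟩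
      ∣ b ∣ + ε         ∎

  dist-max : ∀ {a b c d ε} → ∣ a - c ∣ < ε → ∣ b - d ∣ < ε → ∣ (a ⊔ b) - (c ⊔ d) ∣ < ε
  dist-max {a} {b} {c} {d} {ε} p q =
    <⇒dist (one a b c d (dist⇒< a c p) (dist⇒< b d q)) (one c d a b (dist⇒<′ a c p) (dist⇒<′ b d q))
    where
    one : ∀ a b c d → a < c + ε → b < d + ε → a ⊔ b < (c ⊔ d) + ε
    one a b c d a< b< with ℚₚ.⊔-sel a b
    ... | inj₁ e = subst (_< _) (sym e) (ℚₚ.<-≤-trans a< (ℚₚ.+-monoˡ-≤ ε (ℚₚ.p≤p⊔q c d)))
    ... | inj₂ e = subst (_< _) (sym e) (ℚₚ.<-≤-trans b< (ℚₚ.+-monoˡ-≤ ε (ℚₚ.p≤q⊔p c d)))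

  dist-add : ∀ {a b c d ε} → ∣ a - c ∣ < ½ * ε → ∣ b - d ∣ < ½ * ε → ∣ (a + b) - (c + d) ∣ < ε
  dist-add {a} {b} {c} {d} {ε} p q = begin-strict
    ∣ (a + b) - (c + d) ∣     ≡⟨ cong ∣_∣ (solve 4 (λ a b c d → (a :+ b) :- (c :+ d) := (a :- c) :+ (b :- d)) refl a b c d) ⟩
    ∣ (a - c) + (b - d) ∣     ≤⟨ ℚₚ.∣p+q∣≤∣p∣+∣q∣ (a - c) (b - d) ⟩
    ∣ a - c ∣ + ∣ b - d ∣     <⟨ ℚₚ.+-mono-< p q ⟩
    ½ * ε + ½ * ε             ≡⟨ halves ε ⟩
    ε ∎

  dist-mul : ∀ {a b c d B δ} → ∣ a ∣ < B → ∣ d ∣ < B → ∣ a - c ∣ < δ → ∣ b - d ∣ < δ →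
             ∣ a * b - c * d ∣ < B * δ + δ * B
  dist-mul {a} {b} {c} {d} {B} {δ} a<B d<B p q = begin-strict
    ∣ a * b - c * d ∣                       ≡⟨ cong ∣_∣ (solve 4 (λ a b c d → a :* b :- c :* d := a :* (b :- d) :+ (a :- c) :* d) refl a b c d) ⟩
    ∣ a * (b - d) + (a - c) * d ∣           ≤⟨ ℚₚ.∣p+q∣≤∣p∣+∣q∣ (a * (b - d)) ((a - c) * d) ⟩
    ∣ a * (b - d) ∣ + ∣ (a - c) * d ∣       ≡⟨ cong₂ _+_ (ℚₚ.∣p*q∣≡∣p∣*∣q∣ a (b - d)) (ℚₚ.∣p*q∣≡∣p∣*∣q∣ (a - c) d) ⟩
    ∣ a ∣ * ∣ b - d ∣ + ∣ a - c ∣ * ∣ d ∣   <⟨ ℚₚ.+-mono-<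
      (*-mono-< (ℚₚ.0≤∣p∣ a) (ℚₚ.0≤∣p∣ (b - d)) a<B q)
      (*-mono-< (ℚₚ.0≤∣p∣ (a - c)) (ℚₚ.0≤∣p∣ d) p d<B) ⟩
    B * δ + δ * B ∎

  dist-recip : ∀ {a b ε δ} → 0ℚ < δ → δ < a → δ < b → 0ℚ < ε → ∣ a - b ∣ < ε * (δ * δ) →
               ∣ recip a - recip b ∣ < ε
  dist-recip {a} {b} {ε} {δ} δ>0 δ<a δ<b ε>0 d =
    ℚₚ.*-cancelʳ-<-nonNeg (a * b) {{nonNegative (ℚₚ.<⇒≤ ab>0)}} (begin-strict
      ∣ recip a - recip b ∣ * (a * b)     ≡⟨ cong (∣ recip a - recip b ∣ *_) (ℚₚ.0≤p⇒∣p∣≡p (ℚₚ.<⇒≤ ab>0)) ⟨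
      ∣ recip a - recip b ∣ * ∣ a * b ∣   ≡⟨ ℚₚ.∣p*q∣≡∣p∣*∣q∣ (recip a - recip b) (a * b) ⟨
      ∣ (recip a - recip b) * (a * b) ∣   ≡⟨ cong ∣_∣ (trans
          (solve 4 (λ a b r s → (r :- s) :* (a :* b) := (a :* r) :* b :- (b :* s) :* a) refl a b (recip a) (recip b))
          (trans (cong₂ (λ u v → u * b - v * a) (recip-* a>0) (recip-* b>0))
                 (cong₂ _-_ (ℚₚ.*-identityˡ b) (ℚₚ.*-identityˡ a)))) ⟩
      ∣ b - a ∣                           ≡⟨ dist-sym b a ⟩
      ∣ a - b ∣                           <⟨ d ⟩
      ε * (δ * δ)                         <⟨ ℚₚ.*-monoʳ-<-pos ε {{positive ε>0}} (*-mono-< δ≥0 δ≥0 δ<a δ<b) ⟩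
      ε * (a * b)                         ∎)
    where
    δ≥0 = ℚₚ.<⇒≤ δ>0
    a>0 = ℚₚ.<-trans δ>0 δ<a
    b>0 = ℚₚ.<-trans δ>0 δ<b
    ab>0 = *-pos a>0 b>0

  toℚᵘ-fromℕ : ∀ j → toℚᵘ (fromℕ j) ℚᵘ.≃ mkℚᵘ (ℤ.+ j) 0
  toℚᵘ-fromℕ j = ℚₚ.toℚᵘ-fromℚᵘ (mkℚᵘ (ℤ.+ j) 0)

  toℚᵘ-step : ∀ m → toℚᵘ (step m) ℚᵘ.≃ mkℚᵘ (ℤ.+ 1) m
  toℚᵘ-step m = ℚₚ.toℚᵘ-fromℚᵘ (mkℚᵘ (ℤ.+ 1) m)

  fromℕ-suc : ∀ j → fromℕ (suc j) ≡ fromℕ j + 1ℚ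
  fromℕ-suc j = ℚₚ.toℚᵘ-injective (
    ℚᵘₚ.≃-trans (toℚᵘ-fromℕ (suc j))
    (ℚᵘₚ.≃-trans (ℚᵘ.*≡* {mkℚᵘ (ℤ.+ suc j) 0} {mkℚᵘ (ℤ.+ j) 0 ℚᵘ.+ toℚᵘ 1ℚ} eq)
    (ℚᵘₚ.≃-trans (ℚᵘₚ.+-cong (ℚᵘₚ.≃-sym (toℚᵘ-fromℕ j)) (ℚᵘₚ.≃-refl {toℚᵘ 1ℚ}))
    (ℚᵘₚ.≃-sym (ℚₚ.toℚᵘ-homo-+ (fromℕ j) 1ℚ)))))
    where
    eq : ℤ.+ suc j ℤ.* ℤ.+ 1 ≡ (ℤ.+ j ℤ.* ℤ.+ 1 ℤ.+ ℤ.+ 1 ℤ.* ℤ.+ 1) ℤ.* ℤ.+ 1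
    eq = trans (ℤₚ.*-identityʳ (ℤ.+ suc j)) (sym (trans (ℤₚ.*-identityʳ _)
      (trans (cong (ℤ._+ ℤ.+ 1) (ℤₚ.*-identityʳ (ℤ.+ j))) (cong ℤ.+_ (ℕₚ.+-comm j 1)))))

  fromℕ-* : ∀ j k → fromℕ (j ℕ.* k) ≡ fromℕ j * fromℕ k
  fromℕ-* j k = ℚₚ.toℚᵘ-injective (
    ℚᵘₚ.≃-trans (toℚᵘ-fromℕ (j ℕ.* k))
    (ℚᵘₚ.≃-trans (ℚᵘ.*≡* (cong (ℤ._* ℤ.+ 1) (ℤₚ.pos-* j k)))
    (ℚᵘₚ.≃-trans (ℚᵘₚ.*-cong (ℚᵘₚ.≃-sym (toℚᵘ-fromℕ j)) (ℚᵘₚ.≃-sym (toℚᵘ-fromℕ k)))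
    (ℚᵘₚ.≃-sym (ℚₚ.toℚᵘ-homo-* (fromℕ j) (fromℕ k))))))

  fromℕ-step : ∀ m → fromℕ (suc m) * step m ≡ 1ℚ
  fromℕ-step m = ℚₚ.toℚᵘ-injective (
    ℚᵘₚ.≃-trans (ℚₚ.toℚᵘ-homo-* (fromℕ (suc m)) (step m))
    (ℚᵘₚ.≃-trans (ℚᵘₚ.*-cong (toℚᵘ-fromℕ (suc m)) (toℚᵘ-step m))
    (ℚᵘ.*≡* (trans (ℤₚ.*-identityʳ _) (trans (ℤₚ.*-comm (ℤ.+ suc m) (ℤ.+ 1))
      (cong (λ k → ℤ.+ 1 ℤ.* ℤ.+ k) (sym (ℕₚ.+-identityʳ (suc m)))))))))

  fromℕ-nonNeg : ∀ j → 0ℚ ≤ fromℕ j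
  fromℕ-nonNeg j = ℚₚ.nonNegative⁻¹ (fromℕ j) {{ℚₚ.normalize-nonNeg j 1}}

  step-pos : ∀ m → 0ℚ < step m
  step-pos m = ℚₚ.positive⁻¹ (step m) {{ℚₚ.normalize-pos 1 (suc m)}}

  step-small : ∀ {η} → 0ℚ < η → ∃[ K ] ∀ m → K ℕ.≤ m → step m < η
  step-small {η} η>0 with η | positive η>0
  ... | mkℚ +[1+ a ] d c | _ = suc d , λ m K≤m →
    ℚₚ.toℚᵘ-cancel-< (ℚᵘₚ.<-respˡ-≃ (ℚᵘₚ.≃-sym (toℚᵘ-step m)) (ℚᵘ.*<* (ineq m K≤m)))
    where
    ineq : ∀ m → suc d ℕ.≤ m → ℤ.+ 1 ℤ.* ℤ.+ suc d ℤ.< +[1+ a ] ℤ.* ℤ.+ suc m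
    ineq m K≤m = ℤ.+<+ (ℕₚ.≤-trans
      (ℕₚ.≤-reflexive (cong suc (ℕₚ.+-identityʳ (suc d))))
      (ℕₚ.≤-trans (ℕ.s≤s K≤m) (ℕₚ.m≤m+n (suc m) (a ℕ.* suc m))))

  p≤fromℕ∣↥p∣ : ∀ p → p ≤ fromℕ ℤ.∣ ↥ p ∣
  p≤fromℕ∣↥p∣ p@(mkℚ n d c) =
    ℚₚ.toℚᵘ-cancel-≤ (ℚᵘₚ.≤-respʳ-≃ (ℚᵘₚ.≃-sym (toℚᵘ-fromℕ ℤ.∣ n ∣)) (ℚᵘ.*≤* (ineq n)))
    where
    ineq : ∀ n → n ℤ.* ℤ.+ 1 ℤ.≤ ℤ.+ ℤ.∣ n ∣ ℤ.* ℤ.+ suc d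
    ineq (ℤ.+ a) = subst₂ ℤ._≤_ (ℤₚ.pos-* a 1) (ℤₚ.pos-* a (suc d))
      (ℤ.+≤+ (ℕₚ.*-monoʳ-≤ a (ℕ.s≤s ℕ.z≤n)))
    ineq -[1+ a ] = ℤ.-≤+

  fromℕ-suc-* : ∀ j h → fromℕ (suc j) * h ≡ fromℕ j * h + h
  fromℕ-suc-* j h = trans (cong (_* h) (fromℕ-suc j))
    (solve 2 (λ x h → (x :+ con 1ℚ) :* h := x :* h :+ h) refl (fromℕ j) h)

  gridRoot-nonNeg : ∀ r {h} j → 0ℚ ≤ h → 0ℚ ≤ gridRoot r h j
  gridRoot-nonNeg r zero h≥0 = ℚₚ.≤-refl
  gridRoot-nonNeg r {h} (suc j) h≥0
    with (fromℕ (suc j) * h) * (fromℕ (suc j) * h) ℚₚ.≤? r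
  ... | yes _ = subst (_≤ fromℕ (suc j) * h) (ℚₚ.*-zeroˡ 0ℚ)
                  (*-mono-≤ ℚₚ.≤-refl h≥0 (fromℕ-nonNeg (suc j)) h≥0)
  ... | no _  = gridRoot-nonNeg r j h≥0

  gridRoot-lower : ∀ {r} h j → 0ℚ ≤ r → gridRoot r h j * gridRoot r h j ≤ r
  gridRoot-lower h zero r≥0 = r≥0
  gridRoot-lower {r} h (suc j) r≥0
    with (fromℕ (suc j) * h) * (fromℕ (suc j) * h) ℚₚ.≤? r
  ... | yes s²≤r = s²≤r
  ... | no _     = gridRoot-lower h j r≥0

  gridRoot-upper : ∀ {r h} j → r < (fromℕ j * h + h) * (fromℕ j * h + h) →
                   r < (gridRoot r h j + h) * (gridRoot r h j + h)
  gridRoot-upper {r} {h} zero r< = subst (λ x → r < (x + h) * (x + h)) (ℚₚ.*-zeroˡ h) r<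
  gridRoot-upper {r} {h} (suc j) r<
    with (fromℕ (suc j) * h) * (fromℕ (suc j) * h) ℚₚ.≤? r
  ... | yes _   = r<
  ... | no s²≰r = gridRoot-upper j
    (subst (λ x → r < x * x) (fromℕ-suc-* j h) (ℚₚ.≰⇒> s²≰r))

  rootApprox-nonNeg : ∀ m p → 0ℚ ≤ rootApprox m p
  rootApprox-nonNeg m p = gridRoot-nonNeg (p ⊔ 0ℚ) (suc m ℕ.* suc ℤ.∣ ↥ (p ⊔ 0ℚ) ∣) (ℚₚ.<⇒≤ (step-pos m))

  rootApprox-lower : ∀ m p → rootApprox m p * rootApprox m p ≤ p ⊔ 0ℚ
  rootApprox-lower m p =
    gridRoot-lower (step m) (suc m ℕ.* suc ℤ.∣ ↥ (p ⊔ 0ℚ) ∣) (ℚₚ.p≤q⊔p p 0ℚ)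

  rootApprox-upper : ∀ m p → p ⊔ 0ℚ < (rootApprox m p + step m) * (rootApprox m p + step m)
  rootApprox-upper m p = gridRoot-upper (suc m ℕ.* suc k) (begin-strict
    r                     ≤⟨ p≤fromℕ∣↥p∣ r ⟩
    fromℕ k               ≡⟨ ℚₚ.+-identityʳ (fromℕ k) ⟨
    fromℕ k + 0ℚ          <⟨ ℚₚ.+-monoʳ-< (fromℕ k) (ℚₚ.positive⁻¹ 1ℚ) ⟩
    fromℕ k + 1ℚ          ≡⟨ fromℕ-suc k ⟨
    fromℕ (suc k)         ≡⟨ ℚₚ.*-identityʳ (fromℕ (suc k)) ⟨
    fromℕ (suc k) * 1ℚ    ≤⟨ *-mono-≤ (fromℕ-nonNeg (suc k)) y≥0 k≤y (ℚₚ.≤-trans 1≤k k≤y) ⟩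
    y * y                 ∎)
    where
    r = p ⊔ 0ℚ
    k = ℤ.∣ ↥ r ∣
    h = step m
    x = fromℕ (suc m ℕ.* suc k) * h
    y = x + h
    x≡k : x ≡ fromℕ (suc k)
    x≡k = trans (cong (_* h) (fromℕ-* (suc m) (suc k)))
      (trans (solve 3 (λ a b c → (a :* b) :* c := b :* (a :* c)) refl (fromℕ (suc m)) (fromℕ (suc k)) h)
      (trans (cong (fromℕ (suc k) *_) (fromℕ-step m)) (ℚₚ.*-identityʳ (fromℕ (suc k)))))
    k≤y : fromℕ (suc k) ≤ y
    k≤y = begin
      fromℕ (suc k)  ≡⟨ x≡k ⟨
      x              ≡⟨ ℚₚ.+-identityʳ x ⟨
      x + 0ℚ         ≤⟨ ℚₚ.+-monoʳ-≤ x (ℚₚ.<⇒≤ (step-pos m)) ⟩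
      y              ∎
    1≤k : 1ℚ ≤ fromℕ (suc k)
    1≤k = begin
      1ℚ             ≡⟨ ℚₚ.+-identityˡ 1ℚ ⟨
      0ℚ + 1ℚ        ≤⟨ ℚₚ.+-monoˡ-≤ 1ℚ (fromℕ-nonNeg k) ⟩
      fromℕ k + 1ℚ   ≡⟨ fromℕ-suc k ⟨
      fromℕ (suc k)  ∎
    y≥0 : 0ℚ ≤ y
    y≥0 = ℚₚ.≤-trans (fromℕ-nonNeg (suc k)) k≤y

  dist-root : ∀ m n {a b ε} → 0ℚ < ε → step m < ½ * ε → step n < ½ * ε →
              ∣ a - b ∣ < (½ * ε) * (½ * ε) →
              ∣ rootApprox m a - rootApprox n b ∣ < ε
  dist-root m n {a} {b} {ε} ε>0 hm hn d =
    <⇒dist (one m n a b hn d) (one n m b a hm (subst (_< _) (dist-sym a b) d))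
    where
    η = ½ * ε
    η>0 = half-pos ε>0
    one : ∀ m n a b → step n < η → ∣ a - b ∣ < η * η → rootApprox m a < rootApprox n b + ε
    one m n a b hn d = square-cancel-< t+ε≥0 (begin-strict
      s * s                            ≤⟨ rootApprox-lower m a ⟩
      a ⊔ 0ℚ                           <⟨ dist⇒< (a ⊔ 0ℚ) (b ⊔ 0ℚ) (dist-max {a} {0ℚ} {b} {0ℚ} d (dist-refl {0ℚ} η²>0)) ⟩
      (b ⊔ 0ℚ) + η * η                 <⟨ ℚₚ.+-monoˡ-< (η * η) (rootApprox-upper n b) ⟩
      (t + step n) * (t + step n) + η * η
                                       <⟨ ℚₚ.+-monoˡ-< (η * η) (*-mono-< th≥0 th≥0 th<tη th<tη) ⟩
      (t + η) * (t + η) + η * η        ≡⟨ ℚₚ.+-identityʳ _ ⟨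
      (t + η) * (t + η) + η * η + 0ℚ   ≤⟨ ℚₚ.+-monoʳ-≤ ((t + η) * (t + η) + η * η) cross ⟩
      (t + η) * (t + η) + η * η + ((t + η) * η + (t + η) * η)
        ≡⟨ solve 2 (λ t η → (t :+ η) :* (t :+ η) :+ η :* η :+ ((t :+ η) :* η :+ (t :+ η) :* η)
                         := (t :+ (η :+ η)) :* (t :+ (η :+ η))) refl t η ⟩
      (t + (η + η)) * (t + (η + η))    ≡⟨ cong (λ e → (t + e) * (t + e)) (halves ε) ⟩
      (t + ε) * (t + ε)                ∎)
      where
      s = rootApprox m a
      t = rootApprox n b
      η²>0 = *-pos η>0 η>0
      t≥0 = rootApprox-nonNeg n b
      th<tη : t + step n < t + η
      th<tη = ℚₚ.+-monoʳ-< t hn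
      th≥0 : 0ℚ ≤ t + step n
      th≥0 = ℚₚ.+-mono-≤ t≥0 (ℚₚ.<⇒≤ (step-pos n))
      t+ε≥0 : 0ℚ ≤ t + ε
      t+ε≥0 = ℚₚ.+-mono-≤ t≥0 (ℚₚ.<⇒≤ ε>0)
      tηη>0 : 0ℚ < (t + η) * η
      tηη>0 = *-pos (ℚₚ.≤-<-trans th≥0 th<tη) η>0
      cross : 0ℚ ≤ (t + η) * η + (t + η) * η
      cross = ℚₚ.+-mono-≤ (ℚₚ.<⇒≤ tηη>0) (ℚₚ.<⇒≤ tηη>0)

  root-positive : ∀ {ε} → 0ℚ < ε →
    ∃[ δ ] 0ℚ < δ × ∃[ K ] ∀ m p → K ℕ.≤ m → ε < p → δ < rootApprox m p
  root-positive {ε} ε>0 = δ , δ>0 , K , λ m p K≤m ε<p → lemma m p (small m K≤m) ε<p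
    where
    η = ε ⊓ 1ℚ
    η>0 : 0ℚ < η
    η>0 with ℚₚ.⊓-sel ε 1ℚ
    ... | inj₁ e = subst (0ℚ <_) (sym e) ε>0
    ... | inj₂ e = subst (0ℚ <_) (sym e) (ℚₚ.positive⁻¹ 1ℚ)
    δ = ½ * η
    δ>0 = half-pos η>0
    K = proj₁ (step-small δ>0)
    small = proj₂ (step-small δ>0)
    lemma : ∀ m p → step m < δ → ε < p → δ < rootApprox m p
    lemma m p h<δ ε<p = ℚₚ.≰⇒> λ s≤δ → ℚₚ.<-irrefl refl (begin-strict
      η                                    <⟨ square-cancel-< s+h≥0 sq ⟩
      rootApprox m p + step m              <⟨ ℚₚ.+-mono-≤-< s≤δ h<δ ⟩
      δ + δ                                ≡⟨ halves η ⟩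
      η                                    ∎)
      where
      s+h≥0 : 0ℚ ≤ rootApprox m p + step m
      s+h≥0 = ℚₚ.+-mono-≤ (rootApprox-nonNeg m p) (ℚₚ.<⇒≤ (step-pos m))
      sq : η * η < (rootApprox m p + step m) * (rootApprox m p + step m)
      sq = begin-strict
        η * η    ≤⟨ *-mono-≤ (ℚₚ.<⇒≤ η>0) (ℚₚ.<⇒≤ (ℚₚ.positive⁻¹ 1ℚ)) (ℚₚ.p⊓q≤p ε 1ℚ) (ℚₚ.p⊓q≤q ε 1ℚ) ⟩
        ε * 1ℚ   ≡⟨ ℚₚ.*-identityʳ ε ⟩
        ε        <⟨ ε<p ⟩
        p        ≤⟨ ℚₚ.p≤p⊔q p 0ℚ ⟩
        p ⊔ 0ℚ   <⟨ rootApprox-upper m p ⟩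
        (rootApprox m p + step m) * (rootApprox m p + step m) ∎

open RationalLemmas

IsCauchy : (ℕ → ℚ) → Set
IsCauchy f = ∀ ε → 0ℚ ℚ.< ε → ∃[ M ] ∀ m n → M ℕ.≤ m → M ℕ.≤ n → ℚ.∣ f m ℚ.- f n ∣ ℚ.< ε

-- Real numbers as Cauchy sequences of rationals with a modulus of convergence;
-- equality of reals is _≃_, not _≡_.
record ℝ : Set where
  constructor mkℝ
  field
    approx : ℕ → ℚ
    cauchy : IsCauchy approx

open ℝ

infix  4 _≃_ _≤_ _<_
infix  8 -_ √_
infixl 5 _⊖_
infix  5 _/_[_]
infixl 7 _*_
infixl 6 _+_ _-_ _⊔_

_≃_ : ℝ → ℝ → Set
x ≃ y = ∀ ε → 0ℚ ℚ.< ε → ∃[ M ] ∀ m → M ℕ.≤ m → ℚ.∣ approx x m ℚ.- approx y m ∣ ℚ.< ε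

_≤_ : ℝ → ℝ → Set
x ≤ y = ∀ ε → 0ℚ ℚ.< ε → ∃[ M ] ∀ m → M ℕ.≤ m → approx x m ℚ.< approx y m ℚ.+ ε

_<_ : ℝ → ℝ → Set
x < y = ∃[ ε ] 0ℚ ℚ.< ε × ∃[ M ] ∀ m → M ℕ.≤ m → approx x m ℚ.+ ε ℚ.< approx y m

ofℚ : ℚ → ℝ
ofℚ p = mkℝ (λ _ → p) λ ε ε>0 → 0 , λ _ _ _ _ → dist-refl {p} ε>0

0ℝ 1ℝ : ℝ
0ℝ = ofℚ 0ℚ
1ℝ = ofℚ 1ℚ

_+_ : ℝ → ℝ → ℝ
x + y = mkℝ (λ m → approx x m ℚ.+ approx y m) λ ε ε>0 →
  let M₁ , p = cauchy x (½ ℚ.* ε) (half-pos ε>0)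
      M₂ , q = cauchy y (½ ℚ.* ε) (half-pos ε>0)
  in M₁ ℕ.⊔ M₂ , λ m n M≤m M≤n →
    dist-add {approx x m} {approx y m} {approx x n} {approx y n}
      (p m n (ℕₚ.m⊔n≤o⇒m≤o M₁ M₂ M≤m) (ℕₚ.m⊔n≤o⇒m≤o M₁ M₂ M≤n))
      (q m n (ℕₚ.m⊔n≤o⇒n≤o M₁ M₂ M≤m) (ℕₚ.m⊔n≤o⇒n≤o M₁ M₂ M≤n))

-_ : ℝ → ℝ
- x = mkℝ (λ m → ℚ.- approx x m) λ ε ε>0 →
  let M , p = cauchy x ε ε>0
  in M , λ m n M≤m M≤n → dist-neg {approx x m} {approx x n} (p m n M≤m M≤n)

_-_ : ℝ → ℝ → ℝ
x - y = x + - y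

∣_∣ : ℝ → ℝ
∣ x ∣ = mkℝ (λ m → ℚ.∣ approx x m ∣) λ ε ε>0 →
  let M , p = cauchy x ε ε>0
  in M , λ m n M≤m M≤n → dist-abs {approx x m} {approx x n} (p m n M≤m M≤n)

_⊔_ : ℝ → ℝ → ℝ
x ⊔ y = mkℝ (λ m → approx x m ℚ.⊔ approx y m) λ ε ε>0 →
  let M₁ , p = cauchy x ε ε>0
      M₂ , q = cauchy y ε ε>0
  in M₁ ℕ.⊔ M₂ , λ m n M≤m M≤n →
    dist-max {approx x m} {approx y m} {approx x n} {approx y n}
      (p m n (ℕₚ.m⊔n≤o⇒m≤o M₁ M₂ M≤m) (ℕₚ.m⊔n≤o⇒m≤o M₁ M₂ M≤n))
      (q m n (ℕₚ.m⊔n≤o⇒n≤o M₁ M₂ M≤m) (ℕₚ.m⊔n≤o⇒n≤o M₁ M₂ M≤n))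

bounded : ∀ x → ∃[ B ] 0ℚ ℚ.< B × ∃[ M ] ∀ m → M ℕ.≤ m → ℚ.∣ approx x m ∣ ℚ.< B
bounded x =
  let M , p = cauchy x 1ℚ (ℚₚ.positive⁻¹ 1ℚ)
      c     = ℚ.∣ approx x M ∣
  in c ℚ.+ 1ℚ , ℚₚ.+-mono-≤-< (ℚₚ.0≤∣p∣ (approx x M)) (ℚₚ.positive⁻¹ 1ℚ) , M , λ m M≤m →
     dist⇒< ℚ.∣ approx x m ∣ c
       (dist-abs {approx x m} {approx x M} (p m M M≤m ℕₚ.≤-refl))

_*_ : ℝ → ℝ → ℝ
x * y = mkℝ (λ m → approx x m ℚ.* approx y m) (isCauchy (bounded x) (bounded y))
  where
  isCauchy : (∃[ B ] 0ℚ ℚ.< B × ∃[ M ] ∀ m → M ℕ.≤ m → ℚ.∣ approx x m ∣ ℚ.< B) →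
             (∃[ B ] 0ℚ ℚ.< B × ∃[ M ] ∀ m → M ℕ.≤ m → ℚ.∣ approx y m ∣ ℚ.< B) →
             IsCauchy (λ m → approx x m ℚ.* approx y m)
  isCauchy (B₁ , B₁>0 , K₁ , b₁) (B₂ , B₂>0 , K₂ , b₂) ε ε>0 = M , λ m n M≤m M≤n →
    subst (ℚ._<_ _) total
      (dist-mul {approx x m} {approx y m} {approx x n} {approx y n}
        (ℚₚ.<-trans (b₁ m (K₁≤ M≤m)) B₁<B)
        (ℚₚ.<-trans (b₂ n (K₂≤ M≤n)) B₂<B)
        (p m n (M₁≤ M≤m) (M₁≤ M≤n)) (q m n (M₂≤ M≤m) (M₂≤ M≤n)))
    where
    B = B₁ ℚ.+ B₂
    B₁<B : B₁ ℚ.< B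
    B₁<B = subst (ℚ._< B) (ℚₚ.+-identityʳ B₁) (ℚₚ.+-monoʳ-< B₁ B₂>0)
    B₂<B : B₂ ℚ.< B
    B₂<B = subst (ℚ._< B) (ℚₚ.+-identityˡ B₂) (ℚₚ.+-monoˡ-< B₂ B₁>0)
    B>0 = ℚₚ.<-trans B₁>0 B₁<B
    δ   = ½ ℚ.* (ε ℚ.* recip B)
    δ>0 = half-pos (*-pos ε>0 (recip-pos B>0))
    total : B ℚ.* δ ℚ.+ δ ℚ.* B ≡ ε
    total = trans
      (solve 3 (λ B ε r → B :* (con ½ :* (ε :* r)) :+ (con ½ :* (ε :* r)) :* B
                       := ε :* (B :* r)) refl B ε (recip B))
      (trans (cong (ε ℚ.*_) (recip-* B>0)) (ℚₚ.*-identityʳ ε))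
      where open +-*-Solver
    M₁ = proj₁ (cauchy x δ δ>0)
    p  = proj₂ (cauchy x δ δ>0)
    M₂ = proj₁ (cauchy y δ δ>0)
    q  = proj₂ (cauchy y δ δ>0)
    M  = (K₁ ℕ.⊔ K₂) ℕ.⊔ (M₁ ℕ.⊔ M₂)
    K₁≤ : ∀ {m} → M ℕ.≤ m → K₁ ℕ.≤ m
    K₁≤ le = ℕₚ.m⊔n≤o⇒m≤o K₁ K₂ (ℕₚ.m⊔n≤o⇒m≤o (K₁ ℕ.⊔ K₂) (M₁ ℕ.⊔ M₂) le)
    K₂≤ : ∀ {m} → M ℕ.≤ m → K₂ ℕ.≤ m
    K₂≤ le = ℕₚ.m⊔n≤o⇒n≤o K₁ K₂ (ℕₚ.m⊔n≤o⇒m≤o (K₁ ℕ.⊔ K₂) (M₁ ℕ.⊔ M₂) le)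
    M₁≤ : ∀ {m} → M ℕ.≤ m → M₁ ℕ.≤ m
    M₁≤ le = ℕₚ.m⊔n≤o⇒m≤o M₁ M₂ (ℕₚ.m⊔n≤o⇒n≤o (K₁ ℕ.⊔ K₂) (M₁ ℕ.⊔ M₂) le)
    M₂≤ : ∀ {m} → M ℕ.≤ m → M₂ ℕ.≤ m
    M₂≤ le = ℕₚ.m⊔n≤o⇒n≤o M₁ M₂ (ℕₚ.m⊔n≤o⇒n≤o (K₁ ℕ.⊔ K₂) (M₁ ℕ.⊔ M₂) le)

-- Division by a positive real.  The proof of positivity supplies the modulus
-- of convergence only; it does not affect the approximations.
_/_[_] : (x y : ℝ) → 0ℝ < y → ℝ
x / y [ δ , δ>0 , K , δ<y ] = x * mkℝ (λ m → recip (approx y m)) λ ε ε>0 →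
  let M , p = cauchy y (ε ℚ.* (δ ℚ.* δ)) (*-pos ε>0 (*-pos δ>0 δ>0))
  in K ℕ.⊔ M , λ m n le le′ →
    dist-recip {approx y m} {approx y n} δ>0
      (above m (ℕₚ.m⊔n≤o⇒m≤o K M le)) (above n (ℕₚ.m⊔n≤o⇒m≤o K M le′)) ε>0
      (p m n (ℕₚ.m⊔n≤o⇒n≤o K M le) (ℕₚ.m⊔n≤o⇒n≤o K M le′))
  where
  above : ∀ m → K ℕ.≤ m → δ ℚ.< approx y m
  above m K≤m = subst (ℚ._< approx y m) (ℚₚ.+-identityˡ δ) (δ<y m K≤m)

-- Square root, extended by 0 to negative reals.
√_ : ℝ → ℝ
√ x = mkℝ (λ m → rootApprox m (approx x m)) λ ε ε>0 →
  let η>0   = half-pos ε>0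
      K , s = step-small η>0
      M , p = cauchy x ((½ ℚ.* ε) ℚ.* (½ ℚ.* ε)) (*-pos η>0 η>0)
  in K ℕ.⊔ M , λ m n le le′ →
    dist-root m n {approx x m} {approx x n} ε>0
      (s m (ℕₚ.m⊔n≤o⇒m≤o K M le)) (s n (ℕₚ.m⊔n≤o⇒m≤o K M le′))
      (p m n (ℕₚ.m⊔n≤o⇒n≤o K M le) (ℕₚ.m⊔n≤o⇒n≤o K M le′))

√-positive : ∀ x → 0ℝ < x → 0ℝ < √ x
√-positive x (ε , ε>0 , M , ε<x) =
  let δ , δ>0 , K , δ<s = root-positive ε>0
  in δ , δ>0 , K ℕ.⊔ M , λ m le →
    subst (ℚ._< _) (sym (ℚₚ.+-identityˡ δ))
      (δ<s m (approx x m) (ℕₚ.m⊔n≤o⇒m≤o K M le)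
        (subst (ℚ._< _) (ℚₚ.+-identityˡ ε) (ε<x m (ℕₚ.m⊔n≤o⇒n≤o K M le))))

*-positive : ∀ x y → 0ℝ < x → 0ℝ < y → 0ℝ < x * y
*-positive x y (ε , ε>0 , K , ε<x) (δ , δ>0 , M , δ<y) =
  ε ℚ.* δ , *-pos ε>0 δ>0 , K ℕ.⊔ M , λ m le →
    subst (ℚ._< _) (sym (ℚₚ.+-identityˡ (ε ℚ.* δ)))
      (*-mono-< (ℚₚ.<⇒≤ ε>0) (ℚₚ.<⇒≤ δ>0)
        (subst (ℚ._< _) (ℚₚ.+-identityˡ ε) (ε<x m (ℕₚ.m⊔n≤o⇒m≤o K M le)))
        (subst (ℚ._< _) (ℚₚ.+-identityˡ δ) (δ<y m (ℕₚ.m⊔n≤o⇒n≤o K M le))))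

1<⇒positive : ∀ N → 1ℝ < N → 0ℝ < N
1<⇒positive N (ε , ε>0 , M , 1+ε<N) =
  ε , ε>0 , M , λ m le → ℚₚ.<-trans (ℚₚ.+-monoˡ-< ε (ℚₚ.positive⁻¹ 1ℚ)) (1+ε<N m le)

ofℕ : ℕ → ℝ
ofℕ k = ofℚ (fromℕ k)

ofℕ-positive : ∀ k → ℕ.NonZero k → 0ℝ < ofℕ k
ofℕ-positive k k≢0 = h , half-pos k>0 , 0 , λ _ _ →
  subst₂ ℚ._<_ (trans (ℚₚ.+-identityʳ h) (sym (ℚₚ.+-identityˡ h))) (halves (fromℕ k))
    (ℚₚ.+-monoʳ-< h (half-pos k>0))
  where
  h = ½ ℚ.* fromℕ k
  k>0 : 0ℚ ℚ.< fromℕ k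
  k>0 = ℚₚ.positive⁻¹ (fromℕ k) {{ℚₚ.normalize-pos k 1 {{_}} {{k≢0}}}}

_⊖_ : ∀ {d} → Vector ℝ d → Vector ℝ d → Vector ℝ d
(x ⊖ y) i = x i - y i

∑ : ∀ {d} → Vector ℝ d → ℝ
∑ = foldr _+_ 0ℝ

-- Supremum norm; starting the maximum at 0 is harmless since absolute values are nonnegative.
‖_‖ : ∀ {d} → Vector ℝ d → ℝ
‖ x ‖ = foldr (λ t M → ∣ t ∣ ⊔ M) 0ℝ x

S : (n : ℕ) → Pred (Vector ℝ (suc n)) 0ℓ
S n x = ∑ (λ i → x i * x i) ≃ 1ℝ

ratPoint : ∀ {d} → Vector ℤ d → (q : ℕ) → ℕ.NonZero q → Vector ℝ d
ratPoint p q q≢0 i = ofℚ ((p i ℚ./ q) {{q≢0}})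

√q√N-positive : ∀ q → ℕ.NonZero q → ∀ N → 1ℝ < N → 0ℝ < √ ofℕ q * √ N
√q√N-positive q q≢0 N N>1 =
  *-positive (√ ofℕ q) (√ N)
    (√-positive (ofℕ q) (ofℕ-positive q q≢0)) (√-positive N (1<⇒positive N N>1))

-- (C,a,b)-uniformly Dirichlet in X for a = b = 1/2, so that q^a N^b is √q √N.
-- N is real, and the fraction p/q need not be in lowest terms.
UniformlyDirichlet½½ : ∀ {d} → ℝ → Pred (Vector ℝ d) 0ℓ → Pred (Vector ℝ d) 0ℓ
UniformlyDirichlet½½ {d} C X α =
  ∀ (N : ℝ) (N>1 : 1ℝ < N) →
  Σ[ p ∈ Vector ℤ d ] Σ[ q ∈ ℕ ] Σ[ q≢0 ∈ ℕ.NonZero q ]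
    ratPoint p q q≢0 ∈ X
    × ofℕ q ≤ N
    × ‖ α ⊖ ratPoint p q q≢0 ‖ < C / (√ ofℕ q * √ N) [ √q√N-positive q q≢0 N N>1 ]

{-# OPTIONS --safe #-}
module Submission where

-- A rational point p/q of the sphere is an integer null vector v = (p, q) of the Lorentz form
-- ⟨(x, y), (x′, y′)⟩ = y y′ - x · x′.  Let w = (W, w₀) be an integer timelike vector with W / w₀ close to α
-- and ⟨w, w⟩ / w₀² of size 1/N².  If ⟨w, v⟩² = O(⟨w, w⟩), then q = O(N) and |α - p/q|² = O(1/(qN)).
-- Such a v is reached by descent (after Cassels' bound for the zeros of a quadratic form): if ⟨w, v⟩² is
-- large against ⟨w, w⟩, the pigeonhole principle gives an integer vector b whose projection along v to the
-- orthogonal complement of w has squared length e / ⟨w, v⟩ < 1, and the reflection of v in b, scaled to be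
-- integral, is a null vector v* with ⟨w, v*⟩ = e < ⟨w, v⟩.

-- The squared length e / ⟨w, v⟩ is a positive semidefinite quadratic form in b whose kernel is
-- spanned by v, so its smallness leaves the component of b along v free. A bound |h| < m on a null
-- coordinate h of b controls that component; it is what saves the case e = 0. Together with κ = ⟨v,
-- b⟩ and n spatial forms this makes n + 2 linear forms in the n + 2 coordinates of b. Up to a
-- factor depending on n, their determinant is the product of the widths granted to h and to the
-- spatial forms. The width S left for κ therefore depends on n alone, and neither v nor w enters
-- the final constant. The order on Cauchy reals is undecidable. So N is replaced by an integer k
-- with k ≤ N ≤ 4 k, and α by one rational approximation, close to the sphere but in general not on
-- it; the point p/q found from it has to serve all later approximations of α.

-- Integer inequalities as nonnegative differences

module IntegerOrder where
  open import Data.Integer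
  open import Data.Integer.Properties
  open import Data.Integer.Tactic.RingSolver
  open import Data.Nat.Base as ℕ using (ℕ)
  open import Data.Product.Base using (_×_; _,_)
  open import Relation.Binary.PropositionalEquality

  0≤+ : ∀ {a b} → 0ℤ ≤ a → 0ℤ ≤ b → 0ℤ ≤ a + b
  0≤+ = +-mono-≤

  0<+ : ∀ {a b} → 0ℤ ≤ a → 0ℤ < b → 0ℤ < a + b
  0<+ = +-mono-≤-<

  0≤* : ∀ {a b} → 0ℤ ≤ a → 0ℤ ≤ b → 0ℤ ≤ a * b
  0≤* {a} {b} 0≤a 0≤b =
    subst (_≤ a * b) (*-zeroʳ a) (*-monoˡ-≤-nonNeg a {{nonNegative 0≤a}} 0≤b)

  0<* : ∀ {a b} → 0ℤ < a → 0ℤ < b → 0ℤ < a * b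
  0<* {a} {b} 0<a 0<b =
    subst (_< a * b) (*-zeroʳ a) (*-monoˡ-<-pos a {{positive 0<a}} 0<b)

  0≤□ : ∀ a → 0ℤ ≤ a * a
  0≤□ a@(+ _)    = 0≤* {a} {a} (+≤+ ℕ.z≤n) (+≤+ ℕ.z≤n)
  0≤□ -[1+ _ ]  = +≤+ ℕ.z≤n

  0≤+ℕ : ∀ {k} → 0ℤ ≤ + k
  0≤+ℕ = +≤+ ℕ.z≤n

  ≤⇒0≤ : ∀ {a b} → a ≤ b → 0ℤ ≤ b - a
  ≤⇒0≤ = i≤j⇒0≤j-i

  <⇒0< : ∀ {a b} → a < b → 0ℤ < b - a
  <⇒0< {a} {b} a<b = subst (_< b - a) (+-inverseʳ a) (+-monoˡ-< (- a) a<b)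

  -- Most estimates below have this form: the difference is written as a sum of products of
  -- nonnegative quantities, and the ring solver checks the identity.
  0≤⇒≤ : ∀ {a b c} → 0ℤ ≤ c → b - a ≡ c → a ≤ b
  0≤⇒≤ 0≤c e = 0≤i-j⇒j≤i (subst (0ℤ ≤_) (sym e) 0≤c)

  0<⇒< : ∀ {a b c} → 0ℤ < c → b - a ≡ c → a < b
  0<⇒< {a} {b} 0<c refl = subst₂ _<_ (+-identityˡ a) (eq a b) (+-monoˡ-< a 0<c)
    where
    eq : ∀ a b → b - a + a ≡ b
    eq = solve-∀

  *-cancel-0≤ : ∀ {a b} → 0ℤ < a → 0ℤ ≤ a * b → 0ℤ ≤ b
  *-cancel-0≤ {a} {b} 0<a 0≤ab = *-cancelˡ-≤-pos 0ℤ b a {{positive 0<a}}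
    (subst (_≤ a * b) (sym (*-zeroʳ a)) 0≤ab)

  *-cancel-0< : ∀ {a b} → 0ℤ < a → 0ℤ < a * b → 0ℤ < b
  *-cancel-0< {a} {b} 0<a 0<ab = *-cancelˡ-<-nonNeg a {{nonNegative (<⇒≤ 0<a)}}
    (subst (_< a * b) (sym (*-zeroʳ a)) 0<ab)

  infix 4 _≤±_ _<±_

  -- A bound on |a|, split so that each half can enter directly as a nonnegative factor.
  _≤±_ _<±_ : ℤ → ℤ → Set
  a ≤± A = 0ℤ ≤ A + a × 0ℤ ≤ A - a
  a <± A = 0ℤ < A + a × 0ℤ < A - a

  *-≤± : ∀ {a A b B} → 0ℤ ≤ A → a ≤± A → 0ℤ ≤ b → 0ℤ ≤ B - b → b * a ≤± A * B
  *-≤± {a} {A} {b} {B} 0≤A (a₁ , a₂) 0≤b b≤B =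
    subst (0ℤ ≤_) (e₁ a A b B) (0≤+ (0≤* 0≤A b≤B) (0≤* 0≤b a₁)) ,
    subst (0ℤ ≤_) (e₂ a A b B) (0≤+ (0≤* 0≤A b≤B) (0≤* 0≤b a₂))
    where
    e₁ : ∀ a A b B → A * (B - b) + b * (A + a) ≡ A * B + b * a
    e₁ = solve-∀
    e₂ : ∀ a A b B → A * (B - b) + b * (A - a) ≡ A * B - b * a
    e₂ = solve-∀

  same-cell : ∀ {a b} c c′ {d} → c ≡ c′ → 0ℤ ≤ a - c → 0ℤ < d - (a - c) →
              0ℤ ≤ b - c′ → 0ℤ < d - (b - c′) → a - b <± d
  same-cell {a} {b} c _ {d} refl a₁ a₂ b₁ b₂ =
    subst (0ℤ <_) (e₁ a b c d) (0<+ a₁ b₂) , subst (0ℤ <_) (e₂ a b c d) (0<+ b₁ a₂)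
    where
    e₁ : ∀ a b c d → (a - c) + (d - (b - c)) ≡ d + (a - b)
    e₁ = solve-∀
    e₂ : ∀ a b c d → (b - c) + (d - (a - c)) ≡ d - (a - b)
    e₂ = solve-∀

  <±⇒□< : ∀ {a A} → a <± A → a * a < A * A
  <±⇒□< {a} {A} (a₁ , a₂) = 0<⇒< (0<* a₁ a₂) (e a A)
    where
    e : ∀ a A → A * A - a * a ≡ (A + a) * (A - a)
    e = solve-∀

  □≤⇒≤± : ∀ {a A} → 0ℤ ≤ A → a * a ≤ A * A → a ≤± A
  □≤⇒≤± {a} {A} 0≤A a²≤A² = one a a²≤A² (e₁ a A) , one (- a) (subst (_≤ A * A) (e₀ a) a²≤A²) (e₂ a A)
    where
    e₀ : ∀ a → a * a ≡ (- a) * (- a)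
    e₀ = solve-∀
    e₁ : ∀ a A → A + a ≡ A - (- a)
    e₁ = solve-∀
    e₂ : ∀ a A → A - a ≡ A - (- - a)
    e₂ = solve-∀
    eq : ∀ a A → a * a - A * A ≡ (- a - A) * (- a - A) + (A + A) * (- a - A)
    eq = solve-∀
    one : ∀ a → a * a ≤ A * A → ∀ {d} → d ≡ A - (- a) → 0ℤ ≤ d
    one a a²≤A² refl = ≤⇒0≤ (≮⇒≥ λ A<-a →
      let d>0 = <⇒0< {A} { - a} A<-a in
      <-irrefl refl (<-≤-trans
        (0<⇒< (+-mono-<-≤ (0<* d>0 d>0) (0≤* (0≤+ 0≤A 0≤A) (<⇒≤ d>0))) (eq a A)) a²≤A²))

-- Dot product of integer vectors

module IntegerVectors where
  open import Data.Integer hiding (suc)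
  open import Data.Integer.Properties
  open import Data.Integer.Tactic.RingSolver
  open import Data.Nat.Base using (zero; suc)
  open import Data.Fin.Base using (zero; suc)
  open import Data.Product.Base using (_,_)
  open import Data.Vec.Functional using (Vector; tail)
  open import Function.Base using (_∘_)
  open import Relation.Binary.PropositionalEquality
  open IntegerOrder

  infix 8 _·_

  _·_ : ∀ {n} → Vector ℤ n → Vector ℤ n → ℤ
  _·_ {zero}  x y = 0ℤ
  _·_ {suc n} x y = x zero * y zero + tail x · tail y

  ·-congʳ : ∀ {n} (x : Vector ℤ n) {y z} → (∀ j → y j ≡ z j) → x · y ≡ x · z
  ·-congʳ {zero}  x e = refl
  ·-congʳ {suc n} x e = cong₂ (λ a b → x zero * a + b) (e zero) (·-congʳ (tail x) (e ∘ suc))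

  ·-zeroʳ : ∀ {n} (x : Vector ℤ n) {y} → (∀ j → y j ≡ 0ℤ) → x · y ≡ 0ℤ
  ·-zeroʳ {zero}  x e = refl
  ·-zeroʳ {suc n} x e rewrite e zero | ·-zeroʳ (tail x) (e ∘ suc) =
    trans (+-identityʳ _) (*-zeroʳ (x zero))

  ·-comm : ∀ {n} (x y : Vector ℤ n) → x · y ≡ y · x
  ·-comm {zero}  x y = refl
  ·-comm {suc n} x y = cong₂ _+_ (*-comm (x zero) (y zero)) (·-comm (tail x) (tail y))

  ·-linearʳ : ∀ {n} a b (x y z : Vector ℤ n) →
              x · (λ j → a * y j + b * z j) ≡ a * x · y + b * x · z
  ·-linearʳ {zero}  a b x y z = e a b
    where
    e : ∀ a b → 0ℤ ≡ a * 0ℤ + b * 0ℤ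
    e = solve-∀
  ·-linearʳ {suc n} a b x y z rewrite ·-linearʳ a b (tail x) (tail y) (tail z) =
    e a b (x zero) (y zero) (z zero) (tail x · tail y) (tail x · tail z)
    where
    e : ∀ a b x y z xy xz → x * (a * y + b * z) + (a * xy + b * xz)
                           ≡ a * (x * y + xy) + b * (x * z + xz)
    e = solve-∀

  ·-*ʳ : ∀ {n} a (x y : Vector ℤ n) → x · (λ j → a * y j) ≡ a * x · y
  ·-*ʳ {zero}  a x y = sym (*-zeroʳ a)
  ·-*ʳ {suc n} a x y rewrite ·-*ʳ a (tail x) (tail y) = e a (x zero) (y zero) (tail x · tail y)
    where
    e : ∀ a x y d → x * (a * y) + a * d ≡ a * (x * y + d)
    e = solve-∀

  -- The descent needs three summands; squares of combinations of two vectors are taken with `c`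
  -- equal to 0.
  □-expand : ∀ {n} a b c (x y z : Vector ℤ n) →
    (λ j → a * x j + b * y j + c * z j) · (λ j → a * x j + b * y j + c * z j) ≡
    a * a * x · x + b * b * y · y + c * c * z · z +
    (+ 2 * a * b * x · y + + 2 * a * c * x · z + + 2 * b * c * y · z)
  □-expand {zero} a b c x y z = e a b c
    where
    e : ∀ a b c → 0ℤ ≡ a * a * 0ℤ + b * b * 0ℤ + c * c * 0ℤ +
        (+ 2 * a * b * 0ℤ + + 2 * a * c * 0ℤ + + 2 * b * c * 0ℤ)
    e = solve-∀
  □-expand {suc n} a b c x y z rewrite □-expand a b c (tail x) (tail y) (tail z) =
    e a b c (x zero) (y zero) (z zero) (tail x · tail x) (tail y · tail y) (tail z · tail z)
      (tail x · tail y) (tail x · tail z) (tail y · tail z)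
    where
    e : ∀ a b c x y z xx yy zz xy xz yz →
      (a * x + b * y + c * z) * (a * x + b * y + c * z) +
      (a * a * xx + b * b * yy + c * c * zz + (+ 2 * a * b * xy + + 2 * a * c * xz + + 2 * b * c * yz))
      ≡ a * a * (x * x + xx) + b * b * (y * y + yy) + c * c * (z * z + zz) +
      (+ 2 * a * b * (x * y + xy) + + 2 * a * c * (x * z + xz) + + 2 * b * c * (y * z + yz))
    e = solve-∀

  0≤x·x : ∀ {n} (x : Vector ℤ n) → 0ℤ ≤ x · x
  0≤x·x {zero}  x = ≤-refl
  0≤x·x {suc n} x = 0≤+ (0≤□ (x zero)) (0≤x·x (tail x))

  □≤x·x : ∀ {n} (x : Vector ℤ n) j → x j * x j ≤ x · x
  □≤x·x {suc n} x zero = 0≤⇒≤ (0≤x·x (tail x)) (e (x zero * x zero) (tail x · tail x))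
    where
    e : ∀ a b → a + b - a ≡ b
    e = solve-∀
  □≤x·x {suc n} x (suc j) = ≤-trans (□≤x·x (tail x) j)
    (0≤⇒≤ (0≤□ (x zero)) (e (x zero * x zero) (tail x · tail x)))
    where
    e : ∀ a b → a + b - b ≡ a
    e = solve-∀

  □≤0⇒≡0 : ∀ {a} → a * a ≤ 0ℤ → a ≡ 0ℤ
  □≤0⇒≡0 {+ zero}  _ = refl
  □≤0⇒≡0 {+[1+ _ ]} (+≤+ ())
  □≤0⇒≡0 { -[1+ _ ]} (+≤+ ())

  x·x≡0⇒x≡0 : ∀ {n} (x : Vector ℤ n) → x · x ≡ 0ℤ → ∀ j → x j ≡ 0ℤ
  x·x≡0⇒x≡0 x e j = □≤0⇒≡0 (subst (x j * x j ≤_) e (□≤x·x x j))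

  ·-≤± : ∀ {n} (p x : Vector ℤ n) {A B} → 0ℤ ≤ A →
         (∀ j → p j ≤± A) → (∀ j → 0ℤ ≤ x j) → (∀ j → 0ℤ ≤ B - x j) →
         p · x ≤± + n * (A * B)
  ·-≤± {zero} p x {A} {B} _ _ _ _ = ≤-reflexive (e₁ (A * B)) , ≤-reflexive (e₂ (A * B))
    where
    e₁ : ∀ a → 0ℤ ≡ 0ℤ * a + 0ℤ
    e₁ = solve-∀
    e₂ : ∀ a → 0ℤ ≡ 0ℤ * a - 0ℤ
    e₂ = solve-∀
  ·-≤± {suc n} p x {A} {B} 0≤A p≤A 0≤x x≤B
    with h₁ , h₂ ← *-≤± {p zero} {A} {x zero} {B} 0≤A (p≤A zero) (0≤x zero) (x≤B zero)
    with t₁ , t₂ ← ·-≤± (tail p) (tail x) {A} {B} 0≤A (p≤A ∘ suc) (0≤x ∘ suc) (x≤B ∘ suc) =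
    subst (0ℤ ≤_) (e₁ (A * B) (p zero) (x zero) (+ n) (tail p · tail x)) (0≤+ h₁ t₁) ,
    subst (0ℤ ≤_) (e₂ (A * B) (p zero) (x zero) (+ n) (tail p · tail x)) (0≤+ h₂ t₂)
    where
    e₁ : ∀ C p x k d → (C + x * p) + (k * C + d) ≡ (1ℤ + k) * C + (p * x + d)
    e₁ = solve-∀
    e₂ : ∀ C p x k d → (C - x * p) + (k * C - d) ≡ (1ℤ + k) * C - (p * x + d)
    e₂ = solve-∀

  component-≤± : ∀ {n} (x : Vector ℤ n) {A} → 0ℤ ≤ A → x · x ≤ A * A → ∀ j → x j ≤± A
  component-≤± x 0≤A x²≤A² j = □≤⇒≤± 0≤A (≤-trans (□≤x·x x j) x²≤A²)

-- Pigeonhole principle for n + 2 linear forms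

module Dirichlet where
  open import Data.Integer hiding (suc)
  open import Data.Integer.DivMod using (a≡a%ℕn+[a/ℕn]*n; n%ℕd<d)
  open import Data.Integer.Properties hiding (<⇒≢)
  open import Data.Integer.Tactic.RingSolver
  open import Data.Nat.Base as ℕ using (ℕ; zero; suc)
  import Data.Nat.DivMod as ℕ
  import Data.Nat.Properties as ℕ
  open import Data.Nat.Tactic.RingSolver using () renaming (solve-∀ to ℕ-solve-∀)
  open import Data.Fin.Base using (Fin; zero; suc; toℕ; fromℕ<; combine; funToFin; finToFun)
  open import Data.Fin.Properties using (toℕ<n; toℕ-fromℕ<; toℕ-injective; combine-injective; finToFun-funToFin; funToFin-finToFin; pigeonhole; <⇒≢)
  open import Data.Product.Base using (_×_; _,_; proj₁; proj₂; Σ-syntax; ∃-syntax)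
  open import Data.Vec.Functional using (Vector)
  open import Function.Base using (_∘_; it)
  open import Relation.Binary.PropositionalEquality
  open import Relation.Nullary using (¬_)
  open IntegerOrder
  open IntegerVectors

  cell : ∀ d .{{_ : ℕ.NonZero d}} M {z} → 0ℤ ≤ z → 0ℤ < + M * + d - z →
         Σ[ c ∈ Fin M ] 0ℤ ≤ z - + toℕ c * + d × 0ℤ < + d - (z - + toℕ c * + d)
  cell d M {+ k} _ z<Md = fromℕ< k/d<M , subst (0ℤ ≤_) (sym r≡) 0≤+ℕ ,
    <⇒0< (subst (_< + d) (sym r≡) (+<+ (n%ℕd<d (+ k) d)))
    where
    k/d<M : k ℕ./ d ℕ.< M
    k/d<M = ℕ.m<n*o⇒m/o<n (drop‿+<+ (subst (+ k <_) (sym (pos-* M d)) (0<⇒< z<Md refl)))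
    e : ∀ r q → r + q - q ≡ r
    e = solve-∀
    r≡ : + k - + toℕ (fromℕ< k/d<M) * + d ≡ + (k ℕ.% d)
    r≡ = trans (cong₂ (λ a b → a - + b * + d) (a≡a%ℕn+[a/ℕn]*n (+ k) d) (toℕ-fromℕ< k/d<M))
               (e (+ (k ℕ.% d)) (+ (k ℕ./ d) * + d))

  funToFin-cong : ∀ {m n} {f g : Fin n → Fin m} → (∀ k → f k ≡ g k) → funToFin f ≡ funToFin g
  funToFin-cong {n = zero}  e = refl
  funToFin-cong {n = suc n} e = cong₂ combine (e zero) (funToFin-cong (e ∘ suc))

  finToFun-injective : ∀ {m n} (i j : Fin (m ℕ.^ n)) → (∀ k → finToFun {m} i k ≡ finToFun j k) → i ≡ j
  finToFun-injective {m} {n} i j e = trans (sym (funToFin-finToFin {n} {m} i))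
    (trans (funToFin-cong {m} {n} e) (funToFin-finToFin {n} {m} j))

  funToFin-injective : ∀ {m n} (f g : Fin n → Fin m) → funToFin f ≡ funToFin g → ∀ k → f k ≡ g k
  funToFin-injective f g e k = trans (sym (finToFun-funToFin f k))
    (trans (cong (λ i → finToFun i k) e) (finToFun-funToFin g k))

  ^-distribʳ-* : ∀ k a b → (a ℕ.* b) ℕ.^ k ≡ a ℕ.^ k ℕ.* b ℕ.^ k
  ^-distribʳ-* zero    a b = refl
  ^-distribʳ-* (suc k) a b rewrite ^-distribʳ-* k a b = e a b (a ℕ.^ k) (b ℕ.^ k)
    where
    e : ∀ a b c d → a ℕ.* b ℕ.* (c ℕ.* d) ≡ a ℕ.* c ℕ.* (b ℕ.* d)
    e = ℕ-solve-∀

  -- Counts the cells in dirichlet below, up to the factors that cancel against the number of points.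
  cellBound : ℕ → ℕ
  cellBound n = 2 ℕ.* (n ℕ.+ 4) ℕ.* (12 ℕ.* n) ℕ.^ n

  module _
    (n q m g S r : ℕ)
    {{_ : ℕ.NonZero n}} {{_ : ℕ.NonZero q}} {{_ : ℕ.NonZero m}} {{_ : ℕ.NonZero g}}
    {{_ : ℕ.NonZero S}} {{_ : ℕ.NonZero r}}
    (p P θ : Vector ℤ n)
    (q≤m : q ℕ.≤ m) (m≤2q : m ℕ.≤ 2 ℕ.* q)
    (cellBound<S : cellBound n ℕ.< S)
    (p≤q : ∀ j → p j ≤± + q) (P≤g : ∀ j → P j ≤± + g) (θ≤r : ∀ j → θ j ≤± + r)
    where

    -- In the descent this is ⟨v, b⟩ for b with spatial part (t, x) and time coordinate t + h, where
    -- `m` = q - p₁ and `p` is the tail of the spatial part of v.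
    κ : ℤ → ℤ → Vector ℤ n → ℤ
    κ t h x = + m * t + + q * h - p · x

    -- The descent takes `g` = m β, `P` = β p and `θ` = μ p - m W. The factor 2 n keeps the joint
    -- contribution of the n coordinates to e below or at β / 4. The argument `k` is separate from
    -- `κ` because cells are assigned with another value than differences are measured with.
    G : ℤ → ℤ → Vector ℤ n → ℤ → Vector ℤ n
    G t h x k j = + 2 * + n * (+ g * x j - h * P j + k * θ j)

    0<+ℕ : ∀ k .{{_ : ℕ.NonZero k}} → 0ℤ < + k
    0<+ℕ k = +<+ (ℕ.>-nonZero⁻¹ k)

    module Pigeonhole (R M₁ M₂ M₃ : ℕ) (0<R : 0ℤ < + R)
      (M₁≡ : + R ≡ + M₁ * + m)
      (M₂≡ : + 2 * (+ n + + 4) * (+ q * + R) ≡ + M₂ * + S)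
      (M₃≡ : + 12 * + n * + R * + g ≡ + M₃ * + g)
      (rS≤R : + r * + S ≤ + R)
      (few-cells : M₁ ℕ.* (M₂ ℕ.* M₃ ℕ.^ n) ℕ.< R ℕ.^ (2 ℕ.+ n)) where

      module Point (u : Fin (R ℕ.^ (2 ℕ.+ n))) where
        coord : Vector ℤ (2 ℕ.+ n)
        coord i = + toℕ (finToFun {R} u i)

        t h : ℤ
        t = coord zero
        h = coord (suc zero)
        x : Vector ℤ n
        x j = coord (suc (suc j))

        0≤coord : ∀ i → 0ℤ ≤ coord i
        0≤coord i = 0≤+ℕ
        coord<R : ∀ i → 0ℤ < + R - coord i
        coord<R i = <⇒0< (+<+ (toℕ<n (finToFun {R} u i)))
        coord≤R : ∀ i → 0ℤ ≤ + R - coord i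
        coord≤R i = <⇒≤ (coord<R i)

        px-bound : p · x ≤± + n * (+ q * + R)
        px-bound = ·-≤± p x 0≤+ℕ p≤q (λ j → 0≤coord (suc (suc j))) (λ j → coord≤R (suc (suc j)))

        h-cell : Σ[ c ∈ Fin M₁ ] 0ℤ ≤ h - + toℕ c * + m × 0ℤ < + m - (h - + toℕ c * + m)
        h-cell = cell m M₁ (0≤coord (suc zero)) (subst (λ a → 0ℤ < a - h) M₁≡ (coord<R (suc zero)))

        -- From `m` ≤ 2 q and |p · x| ≤ n q R, κ lies between - n q R and (n + 3) q R. The shift
        -- moves this range inside [0, 2 (n + 4) q R).
        shift : ℤ
        shift = (+ n + + 4) * (+ q * + R)

        κ-cell : Σ[ c ∈ Fin M₂ ] 0ℤ ≤ κ t h x + shift - + toℕ c * + S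
                               × 0ℤ < + S - (κ t h x + shift - + toℕ c * + S)
        κ-cell = cell S M₂
          (subst (0ℤ ≤_) (e₁ (+ m) t (+ q) h (p · x) (+ n) (+ R))
            (0≤+ (proj₂ px-bound) (0≤+ (0≤+ (0≤* {+ m} 0≤+ℕ (0≤coord zero)) (0≤* {+ q} 0≤+ℕ (0≤coord (suc zero))))
              (0≤* {+ 4} 0≤+ℕ (0≤* {+ q} {+ R} 0≤+ℕ 0≤+ℕ)))))
          (subst (0ℤ <_) (trans (e₂ (+ m) t (+ q) h (p · x) (+ n) (+ R))
                                (cong (_- (κ t h x + shift)) M₂≡))
            (0<+ (0≤+ (0≤+ (proj₁ px-bound)
                       (0≤+ (0≤* {+ m} 0≤+ℕ (coord≤R zero)) (0≤* {+ q} 0≤+ℕ (coord≤R (suc zero)))))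
                  (0≤* m≤2q′ (<⇒≤ 0<R)))
                 (0<* {+ q} (0<+ℕ q) 0<R)))
          where
          e₁ : ∀ m t q h d n R → (n * (q * R) - d) + (m * t + q * h + + 4 * (q * R)) ≡
               m * t + q * h - d + (n + + 4) * (q * R)
          e₁ = solve-∀
          e₂ : ∀ m t q h d n R →
               (n * (q * R) + d) + (m * (R - t) + q * (R - h)) + (+ 2 * q - m) * R + q * R ≡
               + 2 * (n + + 4) * (q * R) - (m * t + q * h - d + (n + + 4) * (q * R))
          e₂ = solve-∀
          m≤2q′ : 0ℤ ≤ + 2 * + q - + m
          m≤2q′ = ≤⇒0≤ (subst (+ m ≤_) (pos-* 2 q) (+≤+ m≤2q))

        -- The offset of κ within its cell. The entries of `θ` may be arbitrarily large compared
        -- with `g`, so κ θ could spread over too many cells; k̄ θ is at most r S ≤ R. Points of one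
        -- κ-cell lose the same corner, so this shear of the cells disappears in differences.
        k̄ : ℤ
        k̄ = κ t h x + shift - + toℕ (proj₁ κ-cell) * + S

        0≤k̄ : 0ℤ ≤ k̄
        0≤k̄ = proj₁ (proj₂ κ-cell)
        k̄<S : 0ℤ < + S - k̄
        k̄<S = proj₂ (proj₂ κ-cell)

        -- Each of g x, h P and k̄ θ is at most g R in absolute value; three such terms times 2 n
        -- give 6 n g R.
        G-shift : ℤ
        G-shift = + 6 * + n * (+ g * + R)

        gR-bound : ∀ {z} → z ≤± + R → z ≤± + g * + R
        gR-bound {z} (a , b) = subst (0ℤ ≤_) (e₁ (+ g) (+ R) z) (0≤+ (0≤* 1≤g 0≤R) a) ,
                           subst (0ℤ ≤_) (e₂ (+ g) (+ R) z) (0≤+ (0≤* 1≤g 0≤R) b)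
          where
          0≤R : 0ℤ ≤ + R
          0≤R = 0≤+ℕ
          1≤g : 0ℤ ≤ + g - 1ℤ
          1≤g = ≤⇒0≤ (+≤+ (ℕ.>-nonZero⁻¹ g))
          e₁ : ∀ g R z → (g - 1ℤ) * R + (R + z) ≡ g * R + z
          e₁ = solve-∀
          e₂ : ∀ g R z → (g - 1ℤ) * R + (R - z) ≡ g * R - z
          e₂ = solve-∀

        kθ-bound : ∀ j → k̄ * θ j ≤± + g * + R
        kθ-bound j = gR-bound (widen (*-≤± {θ j} {+ r} {k̄} {+ S} 0≤+ℕ (θ≤r j) 0≤k̄ (<⇒≤ k̄<S)))
          where
          gap : 0ℤ ≤ + R - + r * + S
          gap = ≤⇒0≤ rS≤R
          e₁ : ∀ R a z → (R - a) + (a + z) ≡ R + z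
          e₁ = solve-∀
          e₂ : ∀ R a z → (R - a) + (a - z) ≡ R - z
          e₂ = solve-∀
          widen : ∀ {z} → z ≤± + r * + S → z ≤± + R
          widen {z} (a , b) = subst (0ℤ ≤_) (e₁ (+ R) (+ r * + S) z) (0≤+ gap a) ,
                          subst (0ℤ ≤_) (e₂ (+ R) (+ r * + S) z) (0≤+ gap b)

        hP-bound : ∀ j → h * P j ≤± + g * + R
        hP-bound j = *-≤± {P j} {+ g} {h} {+ R} 0≤+ℕ (P≤g j) (0≤coord (suc zero)) (coord≤R (suc zero))

        G-cell : ∀ j → Σ[ c ∈ Fin M₃ ] 0ℤ ≤ G t h x k̄ j + G-shift - + toℕ c * + g
                                     × 0ℤ < + g - (G t h x k̄ j + G-shift - + toℕ c * + g)
        G-cell j = cell g M₃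
          (subst (0ℤ ≤_) (e₁ (+ n) (+ g) (x j) (+ R) (h * P j) (k̄ * θ j))
            (0≤* {+ 2 * + n} (0≤* {+ 2} {+ n} 0≤+ℕ 0≤+ℕ)
              (0≤+ (0≤+ (0≤* {+ g} 0≤+ℕ (0≤coord (suc (suc j)))) (0≤* {+ g} {+ R} 0≤+ℕ 0≤+ℕ))
                   (0≤+ (proj₂ (hP-bound j)) (proj₁ (kθ-bound j))))))
          (subst (0ℤ <_) (trans (e₂ (+ n) (+ g) (x j) (+ R) (h * P j) (k̄ * θ j))
                                (cong (_- (G t h x k̄ j + G-shift)) M₃≡))
            (0<* {+ 2 * + n} (0<* {+ 2} {+ n} (0<+ℕ 2) (0<+ℕ n))
              (0<+ (0≤+ (proj₁ (hP-bound j)) (proj₂ (kθ-bound j))) (0<* {+ g} (0<+ℕ g) (coord<R (suc (suc j)))))))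
          where
          e₁ : ∀ n g x R hP kθ → + 2 * n * (g * x + g * R + ((g * R - hP) + (g * R + kθ))) ≡
               + 2 * n * (g * x - hP + kθ) + + 6 * n * (g * R)
          e₁ = solve-∀
          e₂ : ∀ n g x R hP kθ → + 2 * n * ((g * R + hP) + (g * R - kθ) + g * (R - x)) ≡
               + 12 * n * R * g - (+ 2 * n * (g * x - hP + kθ) + + 6 * n * (g * R))
          e₂ = solve-∀

        code : Fin (M₁ ℕ.* (M₂ ℕ.* M₃ ℕ.^ n))
        code = combine (proj₁ h-cell) (combine (proj₁ κ-cell) (funToFin (λ j → proj₁ (G-cell j))))

      module Difference (u v : Fin (R ℕ.^ (2 ℕ.+ n))) (u≢v : u ≢ v) (eq : Point.code u ≡ Point.code v) where
        module U = Point u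
        module V = Point v

        Δt Δh : ℤ
        Δt = U.t - V.t
        Δh = U.h - V.h

        Δx : Vector ℤ n
        Δx j = U.x j - V.x j

        nonzero : ¬ (Δt ≡ 0ℤ × Δh ≡ 0ℤ × (∀ j → Δx j ≡ 0ℤ))
        nonzero (t≡ , h≡ , x≡) = u≢v (finToFun-injective {R} {2 ℕ.+ n} u v λ where
            zero          → same t≡
            (suc zero)    → same h≡
            (suc (suc j)) → same (x≡ j))
          where
          same : ∀ {i j : Fin R} → + toℕ i - + toℕ j ≡ 0ℤ → i ≡ j
          same {i} {j} e = toℕ-injective (+-injective (i-j≡0⇒i≡j (+ toℕ i) (+ toℕ j) e))

        eq₁ : proj₁ U.h-cell ≡ proj₁ V.h-cell × combine (proj₁ U.κ-cell) (funToFin (λ j → proj₁ (U.G-cell j)))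
                                              ≡ combine (proj₁ V.κ-cell) (funToFin (λ j → proj₁ (V.G-cell j)))
        eq₁ = combine-injective (proj₁ U.h-cell) (combine (proj₁ U.κ-cell) (funToFin (λ j → proj₁ (U.G-cell j))))
          (proj₁ V.h-cell) (combine (proj₁ V.κ-cell) (funToFin (λ j → proj₁ (V.G-cell j)))) eq

        eq₂ : proj₁ U.κ-cell ≡ proj₁ V.κ-cell ×
              funToFin (λ j → proj₁ (U.G-cell j)) ≡ funToFin (λ j → proj₁ (V.G-cell j))
        eq₂ = combine-injective (proj₁ U.κ-cell) (funToFin (λ j → proj₁ (U.G-cell j)))
          (proj₁ V.κ-cell) (funToFin (λ j → proj₁ (V.G-cell j))) (proj₂ eq₁)

        eq₃ : ∀ j → proj₁ (U.G-cell j) ≡ proj₁ (V.G-cell j)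
        eq₃ = funToFin-injective (λ j → proj₁ (U.G-cell j)) (λ j → proj₁ (V.G-cell j)) (proj₂ eq₂)

        h-small : Δh <± + m
        h-small = same-cell {U.h} {V.h} (+ toℕ (proj₁ U.h-cell) * + m) (+ toℕ (proj₁ V.h-cell) * + m) {+ m}
          (cong (λ c → + toℕ c * + m) (proj₁ eq₁))
          (proj₁ (proj₂ U.h-cell)) (proj₂ (proj₂ U.h-cell)) (proj₁ (proj₂ V.h-cell)) (proj₂ (proj₂ V.h-cell))

        κ-diff : κ Δt Δh Δx ≡ κ U.t U.h U.x - κ V.t V.h V.x
        κ-diff = trans (cong (λ a → + m * Δt + + q * Δh - a)
            (trans (·-congʳ p (λ j → x-y (U.x j) (V.x j))) (·-linearʳ 1ℤ -1ℤ p U.x V.x)))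
          (e (+ m) (+ q) U.t V.t U.h V.h (p · U.x) (p · V.x))
          where
          x-y : ∀ a b → a - b ≡ 1ℤ * a + -1ℤ * b
          x-y = solve-∀
          e : ∀ m q t t′ h h′ d d′ → m * (t - t′) + q * (h - h′) - (1ℤ * d + -1ℤ * d′) ≡
              m * t + q * h - d - (m * t′ + q * h′ - d′)
          e = solve-∀

        κ-cell≡ : + toℕ (proj₁ U.κ-cell) * + S ≡ + toℕ (proj₁ V.κ-cell) * + S
        κ-cell≡ = cong (λ c → + toℕ c * + S) (proj₁ eq₂)

        κ-small : κ Δt Δh Δx <± + S
        κ-small = subst (_<± + S) (trans (e (κ U.t U.h U.x) (κ V.t V.h V.x) U.shift) (sym κ-diff))
          (same-cell {κ U.t U.h U.x + U.shift} {κ V.t V.h V.x + U.shift}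
            (+ toℕ (proj₁ U.κ-cell) * + S) (+ toℕ (proj₁ V.κ-cell) * + S) {+ S} κ-cell≡
            U.0≤k̄ U.k̄<S V.0≤k̄ V.k̄<S)
          where
          e : ∀ a b s → (a + s) - (b + s) ≡ a - b
          e = solve-∀

        k̄-diff : U.k̄ - V.k̄ ≡ κ Δt Δh Δx
        k̄-diff = trans (trans (cong (λ a → U.k̄ - (κ V.t V.h V.x + V.shift - a)) (sym κ-cell≡))
            (e (κ U.t U.h U.x) (κ V.t V.h V.x) U.shift (+ toℕ (proj₁ U.κ-cell) * + S))) (sym κ-diff)
          where
          e : ∀ a b s c → a + s - c - (b + s - c) ≡ a - b
          e = solve-∀

        G-diff : ∀ j → (G U.t U.h U.x U.k̄ j + U.G-shift) - (G V.t V.h V.x V.k̄ j + V.G-shift) ≡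
                       G Δt Δh Δx (κ Δt Δh Δx) j
        G-diff j = trans (e (+ n) (+ g) (U.x j) (V.x j) U.h V.h (P j) U.k̄ V.k̄ (θ j) U.G-shift)
          (cong (λ k → + 2 * + n * (+ g * (U.x j - V.x j) - (U.h - V.h) * P j + k * θ j)) k̄-diff)
          where
          e : ∀ n g x x′ h h′ P k k′ θ s →
            (+ 2 * n * (g * x - h * P + k * θ) + s) - (+ 2 * n * (g * x′ - h′ * P + k′ * θ) + s) ≡
            + 2 * n * (g * (x - x′) - (h - h′) * P + (k - k′) * θ)
          e = solve-∀

        G-small : ∀ j → G Δt Δh Δx (κ Δt Δh Δx) j <± + g
        G-small j = subst (_<± + g) (G-diff j)
          (same-cell {G U.t U.h U.x U.k̄ j + U.G-shift} {G V.t V.h V.x V.k̄ j + V.G-shift}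
            (+ toℕ (proj₁ (U.G-cell j)) * + g) (+ toℕ (proj₁ (V.G-cell j)) * + g) {+ g}
            (cong (λ c → + toℕ c * + g) (eq₃ j))
            (proj₁ (proj₂ (U.G-cell j))) (proj₂ (proj₂ (U.G-cell j)))
            (proj₁ (proj₂ (V.G-cell j))) (proj₂ (proj₂ (V.G-cell j))))

      collision : ∃[ t ] ∃[ h ] Σ[ x ∈ Vector ℤ n ]
        ¬ (t ≡ 0ℤ × h ≡ 0ℤ × (∀ j → x j ≡ 0ℤ))
        × h <± + m × κ t h x <± + S × (∀ j → G t h x (κ t h x) j <± + g)
      collision = let u , v , u<v , eq = pigeonhole few-cells Point.code
                      open Difference u v (<⇒≢ u<v) eq
                  in Δt , Δh , Δx , nonzero , h-small , κ-small , G-small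

    dirichlet : ∃[ t ] ∃[ h ] Σ[ x ∈ Vector ℤ n ]
      ¬ (t ≡ 0ℤ × h ≡ 0ℤ × (∀ j → x j ≡ 0ℤ))
      × h <± + m × κ t h x <± + S × (∀ j → G t h x (κ t h x) j <± + g)
    dirichlet = Pigeonhole.collision R M₁ M₂ M₃ (0<+ℕ R) M₁≡ M₂≡ M₃≡ rS≤R few-cells
      where
      R M₁ M₂ M₃ : ℕ
      -- A multiple of `m` and of `S`, so that whole cells tile the ranges of h and κ; the factor
      -- `r` gives r S ≤ R, the bound on k̄ θ.
      R = m ℕ.* (S ℕ.* r)
      M₁ = S ℕ.* r
      M₂ = 2 ℕ.* (n ℕ.+ 4) ℕ.* (q ℕ.* (m ℕ.* r))
      M₃ = 12 ℕ.* n ℕ.* R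
      instance
        R-nz : ℕ.NonZero R
        R-nz = ℕ.m*n≢0 m (S ℕ.* r) {{it}} {{ℕ.m*n≢0 S r}}
      ℤR : + R ≡ + m * (+ S * + r)
      ℤR = trans (pos-* m (S ℕ.* r)) (cong (+ m *_) (pos-* S r))
      M₁≡ : + R ≡ + M₁ * + m
      M₁≡ = trans (pos-* m M₁) (*-comm (+ m) (+ M₁))
      M₂≡ : + 2 * (+ n + + 4) * (+ q * + R) ≡ + M₂ * + S
      M₂≡ = trans (cong (λ a → + 2 * (+ n + + 4) * (+ q * a)) ℤR)
        (trans (e (+ 2 * (+ n + + 4)) (+ q) (+ m) (+ r) (+ S))
          (cong (_* + S) (sym (trans (pos-* (2 ℕ.* (n ℕ.+ 4)) (q ℕ.* (m ℕ.* r)))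
            (cong₂ _*_ (pos-* 2 (n ℕ.+ 4)) (trans (pos-* q (m ℕ.* r)) (cong (+ q *_) (pos-* m r))))))))
        where
        e : ∀ a q m r S → a * (q * (m * (S * r))) ≡ a * (q * (m * r)) * S
        e = solve-∀
      M₃≡ : + 12 * + n * + R * + g ≡ + M₃ * + g
      M₃≡ = cong (_* + g) (sym (trans (pos-* (12 ℕ.* n) R) (cong (_* + R) (pos-* 12 n))))
      rS≤R : + r * + S ≤ + R
      rS≤R = subst (_≤ + R) (trans (pos-* S r) (*-comm (+ S) (+ r))) (+≤+ (ℕ.m≤n*m (S ℕ.* r) m))
      -- After cancelling R ^ n, S r and m r this says q `cellBound n` < m S. The size of `r` drops
      -- out, which is why `θ` does not influence S.
      few-cells : M₁ ℕ.* (M₂ ℕ.* M₃ ℕ.^ n) ℕ.< R ℕ.^ (2 ℕ.+ n)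
      few-cells = begin-strict
        M₁ ℕ.* (M₂ ℕ.* M₃ ℕ.^ n)
          ≡⟨ cong (λ a → M₁ ℕ.* (M₂ ℕ.* a)) (^-distribʳ-* n (12 ℕ.* n) R) ⟩
        M₁ ℕ.* (M₂ ℕ.* ((12 ℕ.* n) ℕ.^ n ℕ.* R ℕ.^ n))
          ≡⟨ e₁ S r q m (2 ℕ.* (n ℕ.+ 4)) ((12 ℕ.* n) ℕ.^ n) (R ℕ.^ n) ⟩
        (q ℕ.* cellBound n) ℕ.* (S ℕ.* r ℕ.* (m ℕ.* r) ℕ.* R ℕ.^ n)
          ≤⟨ ℕ.*-monoˡ-≤ (S ℕ.* r ℕ.* (m ℕ.* r) ℕ.* R ℕ.^ n) (ℕ.*-monoˡ-≤ (cellBound n) q≤m) ⟩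
        (m ℕ.* cellBound n) ℕ.* (S ℕ.* r ℕ.* (m ℕ.* r) ℕ.* R ℕ.^ n)
          <⟨ ℕ.*-monoˡ-< (S ℕ.* r ℕ.* (m ℕ.* r) ℕ.* R ℕ.^ n) {{nz}} (ℕ.*-monoʳ-< m cellBound<S) ⟩
        (m ℕ.* S) ℕ.* (S ℕ.* r ℕ.* (m ℕ.* r) ℕ.* R ℕ.^ n)
          ≡⟨ e₂ S r m (R ℕ.^ n) ⟩
        R ℕ.^ (2 ℕ.+ n) ∎
        where
        open ℕ.≤-Reasoning
        e₁ : ∀ S r q m a b c → (S ℕ.* r) ℕ.* (a ℕ.* (q ℕ.* (m ℕ.* r)) ℕ.* (b ℕ.* c)) ≡
             (q ℕ.* (a ℕ.* b)) ℕ.* (S ℕ.* r ℕ.* (m ℕ.* r) ℕ.* c)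
        e₁ = ℕ-solve-∀
        e₂ : ∀ S r m c → (m ℕ.* S) ℕ.* (S ℕ.* r ℕ.* (m ℕ.* r) ℕ.* c) ≡
             m ℕ.* (S ℕ.* r) ℕ.* (m ℕ.* (S ℕ.* r) ℕ.* c)
        e₂ = ℕ-solve-∀
        nz : ℕ.NonZero (S ℕ.* r ℕ.* (m ℕ.* r) ℕ.* R ℕ.^ n)
        nz = ℕ.m*n≢0 _ _ {{ℕ.m*n≢0 _ _ {{ℕ.m*n≢0 S r}} {{ℕ.m*n≢0 m r}}}} {{ℕ.m^n≢0 R n}}

-- The Lorentz form, future timelike vectors and null vectors

module LightCone where
  open import Data.Integer hiding (suc)
  open import Data.Integer.Properties
  open import Data.Integer.Tactic.RingSolver
  open import Data.Nat.Base as ℕ using (ℕ; zero; suc)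
  open import Data.Fin.Base using (zero; suc)
  open import Data.Product.Base using (_×_; _,_; proj₁; proj₂)
  open import Data.Sum.Base using (inj₁; inj₂)
  open import Data.Vec.Functional using (Vector; tail; _∷_)
  open import Relation.Binary.PropositionalEquality
  open import Relation.Nullary using (contradiction)
  open IntegerOrder
  open IntegerVectors

  Event : ℕ → Set
  Event d = Vector ℤ d × ℤ

  ⟨_,_⟩ : ∀ {d} → Event d → Event d → ℤ
  ⟨ (x , y) , (x′ , y′) ⟩ = y * y′ - x · x′

  infixl 6 _*ᵉ_+_*ᵉ_

  _*ᵉ_+_*ᵉ_ : ∀ {d} → ℤ → Event d → ℤ → Event d → Event d
  a *ᵉ (x , y) + b *ᵉ (x′ , y′) = (λ j → a * x j + b * x′ j) , a * y + b * y′

  ⟨⟩-linearʳ : ∀ {d} a b (w u v : Event d) → ⟨ w , a *ᵉ u + b *ᵉ v ⟩ ≡ a * ⟨ w , u ⟩ + b * ⟨ w , v ⟩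
  ⟨⟩-linearʳ a b (W , w) (x , y) (x′ , y′) =
    trans (cong (λ s → w * (a * y + b * y′) - s) (·-linearʳ a b W x x′)) (e a b w y y′ (W · x) (W · x′))
    where
    e : ∀ a b w y y′ d d′ → w * (a * y + b * y′) - (a * d + b * d′) ≡ a * (w * y - d) + b * (w * y′ - d′)
    e = solve-∀

  ⟨⟩-comm : ∀ {d} (u v : Event d) → ⟨ u , v ⟩ ≡ ⟨ v , u ⟩
  ⟨⟩-comm (x , y) (x′ , y′) = cong₂ _-_ (*-comm y y′) (·-comm x x′)

  ⟨⟩-□ : ∀ {d} a b (u v : Event d) → let c = a *ᵉ u + b *ᵉ v in
         ⟨ c , c ⟩ ≡ a * a * ⟨ u , u ⟩ + + 2 * a * b * ⟨ u , v ⟩ + b * b * ⟨ v , v ⟩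
  ⟨⟩-□ a b u v = begin
    ⟨ c , c ⟩
      ≡⟨ ⟨⟩-linearʳ a b c u v ⟩
    a * ⟨ c , u ⟩ + b * ⟨ c , v ⟩
      ≡⟨ cong₂ (λ s t → a * s + b * t) (trans (⟨⟩-comm c u) (⟨⟩-linearʳ a b u u v))
                                       (trans (⟨⟩-comm c v) (⟨⟩-linearʳ a b v u v)) ⟩
    a * (a * ⟨ u , u ⟩ + b * ⟨ u , v ⟩) + b * (a * ⟨ v , u ⟩ + b * ⟨ v , v ⟩)
      ≡⟨ cong (λ s → a * (a * ⟨ u , u ⟩ + b * ⟨ u , v ⟩) + b * (a * s + b * ⟨ v , v ⟩)) (⟨⟩-comm v u) ⟩
    a * (a * ⟨ u , u ⟩ + b * ⟨ u , v ⟩) + b * (a * ⟨ u , v ⟩ + b * ⟨ v , v ⟩)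
      ≡⟨ e a b ⟨ u , u ⟩ ⟨ u , v ⟩ ⟨ v , v ⟩ ⟩
    a * a * ⟨ u , u ⟩ + + 2 * a * b * ⟨ u , v ⟩ + b * b * ⟨ v , v ⟩ ∎
    where
    open ≡-Reasoning
    c = a *ᵉ u + b *ᵉ v
    e : ∀ a b uu uv vv → a * (a * uu + b * uv) + b * (a * uv + b * vv) ≡
        a * a * uu + + 2 * a * b * uv + b * b * vv
    e = solve-∀

  -- Arranges p₁ ≤ 0, so that the null coordinate m = q - p₁ is at least q.
  mirror : ∀ {n} → Event (suc n) → Event (suc n)
  mirror (x , y) = - x zero ∷ tail x , y

  ⟨⟩-mirror : ∀ {n} (u v : Event (suc n)) → ⟨ mirror u , mirror v ⟩ ≡ ⟨ u , v ⟩
  ⟨⟩-mirror (x , y) (x′ , y′) = e (x zero) (x′ zero) (tail x · tail x′) (y * y′)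
    where
    e : ∀ a b c d → d - (- a * - b + c) ≡ d - (a * b + c)
    e = solve-∀

  ⟨⟩-mirrorʳ : ∀ {n} (u v : Event (suc n)) → ⟨ u , mirror v ⟩ ≡ ⟨ mirror u , v ⟩
  ⟨⟩-mirrorʳ (x , y) (x′ , y′) = e (x zero) (x′ zero) (tail x · tail x′) (y * y′)
    where
    e : ∀ a b c d → d - (a * - b + c) ≡ d - (- a * b + c)
    e = solve-∀

  x·x≡□ : ∀ {d} (v : Event d) → ⟨ v , v ⟩ ≡ 0ℤ → proj₁ v · proj₁ v ≡ proj₂ v * proj₂ v
  x·x≡□ (p , q) null = sym (i-j≡0⇒i≡j (q * q) (p · p) null)

  0≤⇒0<-factor : ∀ {a} b → 0ℤ ≤ a → 0ℤ < a * b → 0ℤ < a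
  0≤⇒0<-factor {+[1+ _ ]} b _ _ = +<+ (ℕ.s≤s ℕ.z≤n)
  0≤⇒0<-factor {+0}       b _ 0<0 = contradiction 0<0 (<-irrefl refl)

  sum-zero : ∀ {a b} → 0ℤ ≤ a → 0ℤ ≤ b → a + b ≡ 0ℤ → a ≡ 0ℤ × b ≡ 0ℤ
  sum-zero {+0} {+0} _ _ _ = refl , refl
  sum-zero {+0} {+[1+ _ ]} _ _ ()
  sum-zero {+[1+ _ ]} {+0} _ _ ()
  sum-zero {+[1+ _ ]} {+[1+ _ ]} _ _ ()
  sum-zero { -[1+ _ ]} () _ _
  sum-zero {+0} { -[1+ _ ]} _ () _
  sum-zero {+[1+ _ ]} { -[1+ _ ]} _ () _

  factor-zero : ∀ {a b} → 0ℤ < a → a * b ≡ 0ℤ → b ≡ 0ℤ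
  factor-zero {a} {b} 0<a ab≡0 with i*j≡0⇒i≡0∨j≡0 a ab≡0
  ... | inj₁ refl = contradiction 0<a (<-irrefl refl)
  ... | inj₂ b≡0 = b≡0

  Future : ∀ {d} → Event d → Set
  Future w = 0ℤ < proj₂ w × 0ℤ < ⟨ w , w ⟩

  mirror-future : ∀ {n} (w : Event (suc n)) → Future w → Future (mirror w)
  mirror-future w (w₀>0 , Δ>0) = w₀>0 , subst (0ℤ <_) (sym (⟨⟩-mirror w w)) Δ>0

  0<w₀-W₁ : ∀ {n} (w : Event (suc n)) → Future w → 0ℤ < proj₂ w - proj₁ w zero
  0<w₀-W₁ (W , w₀) (w₀>0 , Δ>0) =
    0≤⇒0<-factor (w₀ + W zero) (proj₂ (□≤⇒≤± (<⇒≤ w₀>0) (≤-trans (□≤x·x W zero) (<⇒≤ (0<⇒< Δ>0 refl)))))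
      (subst (0ℤ <_) (e w₀ (W zero) (tail W · tail W)) (0<+ (0≤x·x (tail W)) Δ>0))
    where
    e : ∀ w a d → d + (w * w - (a * a + d)) ≡ (w - a) * (w + a)
    e = solve-∀

  -- Cauchy–Schwarz in null coordinates: with μ = w₀ - W₁ and m = q - p₁,
  -- 2 μ m ⟨w, v⟩ = |μ p′ - m W′|² + m² ⟨w, w⟩.
  null-pairing : ∀ {n} (w v : Event (suc n)) → ⟨ v , v ⟩ ≡ 0ℤ →
    let μ = proj₂ w - proj₁ w zero ; m = proj₂ v - proj₁ v zero in
    m * m * ⟨ w , w ⟩ ≤ + 2 * μ * ⟨ w , v ⟩ * m
  null-pairing (W , w₀) (p , q) null = 0≤⇒≤ (0≤x·x z) (trans
    (e w₀ (W zero) q (p zero) (tail p · tail p) (tail W · tail W) (tail p · tail W) (tail W · tail p)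
       (·-comm (tail W) (tail p)) (x·x≡□ (p , q) null))
    (sym (□-expand μ (- m) 0ℤ (tail p) (tail W) (tail W))))
    where
    μ = w₀ - W zero
    m = q - p zero
    z : Vector ℤ _
    z j = μ * tail p j + - m * tail W j + 0ℤ * tail W j
    e : ∀ w₀ W₁ q p₁ pp WW pW Wp → Wp ≡ pW → p₁ * p₁ + pp ≡ q * q →
      let μ = w₀ - W₁ ; m = q - p₁ in
      + 2 * μ * (w₀ * q - (W₁ * p₁ + Wp)) * m - m * m * (w₀ * w₀ - (W₁ * W₁ + WW)) ≡
      μ * μ * pp + - m * - m * WW + 0ℤ * 0ℤ * WW +
      (+ 2 * μ * - m * pW + + 2 * μ * 0ℤ * pW + + 2 * - m * 0ℤ * WW)
    e w₀ W₁ q p₁ pp WW pW Wp refl null = begin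
      + 2 * μ′ * (w₀ * q - (W₁ * p₁ + Wp)) * m′ - m′ * m′ * (w₀ * w₀ - (W₁ * W₁ + WW))
        ≡⟨ e′ w₀ W₁ q p₁ pp WW pW ⟩
      rhs + μ′ * μ′ * (q * q - (p₁ * p₁ + pp))
        ≡⟨ cong (λ s → rhs + μ′ * μ′ * (q * q - s)) null ⟩
      rhs + μ′ * μ′ * (q * q - q * q)
        ≡⟨ e″ rhs (μ′ * μ′) (q * q) ⟩
      rhs ∎
      where
      open ≡-Reasoning
      μ′ = w₀ - W₁
      m′ = q - p₁
      rhs = μ′ * μ′ * pp + - m′ * - m′ * WW + 0ℤ * 0ℤ * WW +
            (+ 2 * μ′ * - m′ * pW + + 2 * μ′ * 0ℤ * pW + + 2 * - m′ * 0ℤ * WW)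
      e″ : ∀ a b c → a + b * (c - c) ≡ a
      e″ = solve-∀
      e′ : ∀ w₀ W₁ q p₁ pp WW pW →
        let μ = w₀ - W₁ ; m = q - p₁ in
        + 2 * μ * (w₀ * q - (W₁ * p₁ + pW)) * m - m * m * (w₀ * w₀ - (W₁ * W₁ + WW)) ≡
        μ * μ * pp + - m * - m * WW + 0ℤ * 0ℤ * WW +
        (+ 2 * μ * - m * pW + + 2 * μ * 0ℤ * pW + + 2 * - m * 0ℤ * WW) +
        μ * μ * (q * q - (p₁ * p₁ + pp))
      e′ = solve-∀

  module _ {n} (w : Event (suc n)) (future : Future w)
           (v : Event (suc n)) (null : ⟨ v , v ⟩ ≡ 0ℤ) (β>0 : 0ℤ < ⟨ w , v ⟩) where
    private
      W = proj₁ w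
      w₀ = proj₂ w
      p = proj₁ v
      q = proj₂ v
      β = ⟨ w , v ⟩
      Δ = ⟨ w , w ⟩

    0≤q-p₁ : 0ℤ ≤ q - p zero
    0≤q-p₁ = *-cancel-0≤ (0<* (0<* {+ 2} (+<+ (ℕ.s≤s ℕ.z≤n)) (0<w₀-W₁ w future)) β>0)
      (≤-trans (0≤* (0≤□ (q - p zero)) (<⇒≤ (proj₂ future))) (null-pairing w v null))

    Δm≤2μβ : Δ * (q - p zero) ≤ + 2 * (w₀ - W zero) * β
    Δm≤2μβ with q - p zero in eq | 0≤q-p₁
    ... | +0 | _ = subst (_≤ + 2 * (w₀ - W zero) * β) (sym (*-zeroʳ Δ))
      (<⇒≤ (0<* (0<* {+ 2} (+<+ (ℕ.s≤s ℕ.z≤n)) (0<w₀-W₁ w future)) β>0))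
    ... | m@(+[1+ _ ]) | _ = *-cancelʳ-≤-pos _ _ m (subst (_≤ + 2 * (w₀ - W zero) * β * m) (e m Δ)
            (subst (λ m → m * m * Δ ≤ + 2 * (w₀ - W zero) * β * m) eq (null-pairing w v null)))
      where
      e : ∀ m Δ → m * m * Δ ≡ Δ * m * m
      e = solve-∀

  module _ {n} (w : Event (suc n)) (future : Future w)
           (v : Event (suc n)) (null : ⟨ v , v ⟩ ≡ 0ℤ) (β>0 : 0ℤ < ⟨ w , v ⟩) where
    private
      W = proj₁ w
      w₀ = proj₂ w
      p = proj₁ v
      q = proj₂ v
      β = ⟨ w , v ⟩
      β≡ : ⟨ mirror w , mirror v ⟩ ≡ β
      β≡ = ⟨⟩-mirror w v
      null′ : ⟨ mirror v , mirror v ⟩ ≡ 0ℤ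
      null′ = trans (⟨⟩-mirror v v) null
      β>0′ : 0ℤ < ⟨ mirror w , mirror v ⟩
      β>0′ = subst (0ℤ <_) (sym β≡) β>0

    -- The null coordinates of v for the first axis and for its mirror image add up to 2 q, those of
    -- w to 2 w₀; the bound is half the sum of the two instances of `Δm≤2μβ`.
    Δq≤2w₀β : ⟨ w , w ⟩ * q ≤ + 2 * w₀ * β
    Δq≤2w₀β = *-cancelˡ-≤-pos _ _ (+ 2) (0≤⇒≤
      (0≤+ (≤⇒0≤ (Δm≤2μβ w future v null β>0))
           (≤⇒0≤ (subst₂ (λ d b → d * (q - - p zero) ≤ + 2 * (w₀ - - W zero) * b) (⟨⟩-mirror w w) β≡
             (Δm≤2μβ (mirror w) (mirror-future w future) (mirror v) null′ β>0′))))
      (e w₀ (W zero) q (p zero) ⟨ w , w ⟩ β))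
      where
      e : ∀ w₀ W₁ q p₁ Δ β → + 2 * (+ 2 * w₀ * β) - + 2 * (Δ * q) ≡
        + 2 * (w₀ - W₁) * β - Δ * (q - p₁) + (+ 2 * (w₀ - - W₁) * β - Δ * (q - - p₁))
      e = solve-∀

    -- Both null coordinates are nonnegative, hence so is q; q = 0 would force p = 0 by nullity, and
    -- then β = 0.
    0<q : 0ℤ < q
    0<q = ≤∧≢⇒< 0≤q λ { refl → <-irrefl (β≡0 refl) β>0 }
      where
      e : ∀ q p → q - p + (q - - p) ≡ + 2 * q
      e = solve-∀
      0≤q : 0ℤ ≤ q
      0≤q = *-cancel-0≤ {+ 2} (+<+ (ℕ.s≤s ℕ.z≤n)) (subst (0ℤ ≤_) (e q (p zero))
        (0≤+ (0≤q-p₁ w future v null β>0) (0≤q-p₁ (mirror w) (mirror-future w future) (mirror v) null′ β>0′)))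
      β≡0 : 0ℤ ≡ q → 0ℤ ≡ β
      β≡0 q≡0 = sym (cong₂ _-_ (trans (cong (w₀ *_) (sym q≡0)) (*-zeroʳ w₀))
        (·-zeroʳ W (x·x≡0⇒x≡0 p (trans (x·x≡□ v null) (cong₂ _*_ (sym q≡0) (sym q≡0))))))

-- One reflection step and its iteration

module Descent where
  open import Data.Integer hiding (suc)
  open import Data.Integer.Properties
  open import Data.Integer.Tactic.RingSolver
  open import Data.Nat.Base as ℕ using (ℕ; zero; suc)
  open import Data.Fin.Base using (zero; suc)
  open import Data.Product.Base using (_×_; _,_; proj₁; proj₂; Σ-syntax; ∃-syntax)
  open import Data.Sum.Base using (inj₁; inj₂; _⊎_)
  open import Data.Vec.Functional using (Vector; tail; _∷_)
  open import Relation.Binary.PropositionalEquality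
  open import Relation.Binary.Definitions using (tri<; tri≈; tri>)
  open import Relation.Nullary using (¬_; yes; no; contradiction)
  open import Induction.WellFounded using (Acc; acc)
  open import Data.Nat.Induction using (<-wellFounded)
  import Data.Nat.Properties as ℕₚ
  open IntegerOrder
  open IntegerVectors
  open Dirichlet using (cellBound; dirichlet)
  open LightCone

  positive⇒ℕ : ∀ {a} → 0ℤ < a → ∃[ k ] ℕ.NonZero k × + k ≡ a
  positive⇒ℕ {+[1+ k ]} _ = suc k , _ , refl
  positive⇒ℕ {+0} 0<0 = contradiction 0<0 (<-irrefl refl)

  vector-bound : ∀ {n} (x : Vector ℤ n) → ∃[ r ] ℕ.NonZero r × (∀ j → x j ≤± + r)
  vector-bound x with positive⇒ℕ (0<+ (0≤x·x x) (+<+ (ℕ.s≤s ℕ.z≤n)))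
  ... | r , nz , r≡ = r , nz , component-≤± x 0≤+ℕ
    (subst (λ A → x · x ≤ A * A) (sym r≡)
      (0≤⇒≤ (0≤+ (0≤+ (0≤□ (x · x)) (0≤x·x x)) 0≤+ℕ) (e (x · x))))
    where
    e : ∀ a → (a + 1ℤ) * (a + 1ℤ) - a ≡ a * a + a + + 1
    e = solve-∀

  x·x≤ : ∀ {n} (x : Vector ℤ n) {A} → (∀ j → x j * x j ≤ A) → x · x ≤ + n * A
  x·x≤ {zero}  x {A} _ = ≤-reflexive (sym (*-zeroˡ A))
  x·x≤ {suc n} x {A} b = subst (x · x ≤_) (e (+ n) A) (+-mono-≤ (b zero) (x·x≤ (tail x) (λ j → b (suc j))))
    where
    e : ∀ n A → A + n * A ≡ (1ℤ + n) * A
    e = solve-∀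

  Smaller : ∀ {d} → Event d → Event d → Set
  Smaller w v = Σ[ v* ∈ Event _ ] ⟨ v* , v* ⟩ ≡ 0ℤ × 0ℤ < ⟨ w , v* ⟩ × ⟨ w , v* ⟩ < ⟨ w , v ⟩

  module Step {n} .{{_ : ℕ.NonZero n}} (S : ℕ) (S> : cellBound n ℕ.< S)
    (w : Event (suc n)) (future : Future w)
    (v : Event (suc n)) (null : ⟨ v , v ⟩ ≡ 0ℤ) (β>0 : 0ℤ < ⟨ w , v ⟩)
    (p₁≤0 : 0ℤ ≤ - proj₁ v zero)
    (large : + 2 * (+ S * + S) * ⟨ w , w ⟩ ≤ ⟨ w , v ⟩ * ⟨ w , v ⟩) where

    W = tail (proj₁ w)
    W₁ = proj₁ w zero
    w₀ = proj₂ w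
    p = tail (proj₁ v)
    p₁ = proj₁ v zero
    q = proj₂ v
    β = ⟨ w , v ⟩
    Δ = ⟨ w , w ⟩
    m μ : ℤ
    m = q - p₁
    μ = w₀ - W₁

    q>0 : 0ℤ < q
    q>0 = 0<q w future v null β>0

    m>0 : 0ℤ < m
    m>0 = +-mono-<-≤ q>0 p₁≤0

    p≤±q : ∀ j → proj₁ v j ≤± q
    p≤±q = component-≤± (proj₁ v) (<⇒≤ q>0) (≤-reflexive (x·x≡□ v null))

    module WithShortVector (t h : ℤ) (x : Vector ℤ n)
      (nonzero : ¬ (t ≡ 0ℤ × h ≡ 0ℤ × (∀ j → x j ≡ 0ℤ)))
      (h<m : h <± m) (κ<S : m * t + q * h - p · x <± + S)
      (G<g : ∀ j → + 2 * + n * (m * β * x j - h * (β * p j) + (m * t + q * h - p · x) * (μ * p j - m * W j))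
                   <± m * β) where

      κ : ℤ
      κ = m * t + q * h - p · x

      -- In these coordinates `h` is the null coordinate of b, the analogue of `m` for v and `μ` for
      -- w.
      b : Event (suc n)
      b = t ∷ x , t + h

      N e : ℤ
      N = ⟨ b , b ⟩
      e = - N * β + + 2 * κ * ⟨ w , b ⟩

      vb≡κ : ⟨ v , b ⟩ ≡ κ
      vb≡κ = eq q p₁ t h (p · x)
        where
        eq : ∀ q p₁ t h d → q * (t + h) - (p₁ * t + d) ≡ (q - p₁) * t + q * h - d
        eq = solve-∀

      -- The image of v under the reflection in b, scaled by |b|² = - N.
      v* : Event (suc n)
      v* = - N *ᵉ v + + 2 * κ *ᵉ b

      v*-null : ⟨ v* , v* ⟩ ≡ 0ℤ
      v*-null = trans (⟨⟩-□ (- N) (+ 2 * κ) v b)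
        (trans (cong₂ (λ s u → - N * - N * s + + 2 * - N * (+ 2 * κ) * u + + 2 * κ * (+ 2 * κ) * N) null vb≡κ)
          (eq N κ))
        where
        eq : ∀ N κ → - N * - N * 0ℤ + + 2 * - N * (+ 2 * κ) * κ + + 2 * κ * (+ 2 * κ) * N ≡ 0ℤ
        eq = solve-∀

      wv*≡e : ⟨ w , v* ⟩ ≡ e
      wv*≡e = ⟨⟩-linearʳ (- N) (+ 2 * κ) w v b

      -- The form `G` of the pigeonhole argument, regrouped by the vectors x, p and W so that its
      -- square can be expanded.
      F : Vector ℤ n
      F j = + 2 * + n * (m * β) * x j + + 2 * + n * (κ * μ - h * β) * p j + + 2 * + n * - (κ * m) * W j

      F<±g : ∀ j → F j <± m * β
      F<±g j = subst (_<± m * β) (eq (+ n) m β (x j) h (p j) κ μ (W j)) (G<g j)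
        where
        eq : ∀ n m β x h p κ μ W → + 2 * n * (m * β * x - h * (β * p) + κ * (μ * p - m * W)) ≡
          + 2 * n * (m * β) * x + + 2 * n * (κ * μ - h * β) * p + + 2 * n * - (κ * m) * W
        eq = solve-∀

      -- Projecting along v onto the orthogonal complement of w turns b into a vector of squared
      -- length e / β; this is that length in the coordinates F and κ.
      e-decomposition : + 4 * (+ n * + n) * (m * m * β) * e ≡
                        F · F + + 4 * (+ n * + n) * (m * m) * Δ * (κ * κ)
      e-decomposition = trans
        (eq (+ n) q p₁ w₀ W₁ (t + h) t β κ ⟨ w , b ⟩ (x · x) (W · W) (p · p) (W · p) (p · x) (W · x)
          (solve-β w₀ q W₁ p₁ (W · p)) (solve-κ q p₁ t h (p · x))
          (solve-b w₀ t h W₁ (W · x)) (solve-pp p₁ (p · p) (q * q) (x·x≡□ v null)))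
        (cong (_+ + 4 * (+ n * + n) * (m * m) * Δ * (κ * κ))
          (sym (trans (□-expand A P C x p W)
            (cong₂ (λ u v → A * A * x · x + P * P * p · p + C * C * W · W +
                      (+ 2 * A * P * u + + 2 * A * C * v + + 2 * P * C * p · W))
              (·-comm x p) (·-comm x W)) ⟫
            cong (λ u → A * A * x · x + P * P * p · p + C * C * W · W +
                      (+ 2 * A * P * p · x + + 2 * A * C * W · x + + 2 * P * C * u)) (·-comm p W) ⟫ h≡)))
        where
        A = + 2 * + n * (m * β)
        P = + 2 * + n * (κ * μ - h * β)
        C = + 2 * + n * - (κ * m)
        infixr 1 _⟫_
        _⟫_ : ∀ {a b c : ℤ} → a ≡ b → b ≡ c → a ≡ c
        _⟫_ = trans
        t+h-t : ∀ t h → h ≡ t + h - t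
        t+h-t = solve-∀
        h≡ : A * A * x · x + P * P * p · p + C * C * W · W +
                      (+ 2 * A * P * p · x + + 2 * A * C * W · x + + 2 * P * C * W · p) ≡
             (let P = + 2 * + n * (κ * μ - (t + h - t) * β) in
              A * A * x · x + P * P * p · p + C * C * W · W +
                      (+ 2 * A * P * p · x + + 2 * A * C * W · x + + 2 * P * C * W · p))
        h≡ = cong (λ h → let P = + 2 * + n * (κ * μ - h * β) in
              A * A * x · x + P * P * p · p + C * C * W · W +
                      (+ 2 * A * P * p · x + + 2 * A * C * W · x + + 2 * P * C * W · p)) (t+h-t t h)
        solve-β : ∀ w₀ q W₁ p₁ Wp → Wp ≡ w₀ * q - W₁ * p₁ - (w₀ * q - (W₁ * p₁ + Wp))
        solve-β = solve-∀
        solve-κ : ∀ q p₁ t h px → px ≡ q * (t + h) - p₁ * t - ((q - p₁) * t + q * h - px)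
        solve-κ = solve-∀
        solve-b : ∀ w₀ t h W₁ Wx → Wx ≡ w₀ * (t + h) - W₁ * t - (w₀ * (t + h) - (W₁ * t + Wx))
        solve-b = solve-∀
        solve-pp : ∀ p₁ pp qq → p₁ * p₁ + pp ≡ qq → pp ≡ qq - p₁ * p₁
        solve-pp p₁ pp _ refl = eq′ p₁ pp
          where
          eq′ : ∀ p₁ pp → pp ≡ p₁ * p₁ + pp - p₁ * p₁
          eq′ = solve-∀
        -- The dot products W · p, p · x, W · x and p · p are determined by β, κ, ⟨w, b⟩ and
        -- nullity. Once they are eliminated, the remaining variables are independent and the claim
        -- is a polynomial identity.
        eq₀ : ∀ q p₁ w₀ W₁ y x₁ β κ b xx WW k →
          let m = q - p₁ ; h = y - x₁ ; μ = w₀ - W₁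
              Wp = w₀ * q - W₁ * p₁ - β
              px = q * y - p₁ * x₁ - κ
              Wx = w₀ * y - W₁ * x₁ - b
              A = + 2 * k * (m * β) ; P = + 2 * k * (κ * μ - h * β) ; C = + 2 * k * - (κ * m)
              pp = q * q - p₁ * p₁
              Δ = w₀ * w₀ - (W₁ * W₁ + WW)
          in + 4 * (k * k) * (m * m * β) * (- (y * y - (x₁ * x₁ + xx)) * β + + 2 * κ * b) ≡
             A * A * xx + P * P * pp + C * C * WW + (+ 2 * A * P * px + + 2 * A * C * Wx + + 2 * P * C * Wp)
             + + 4 * (k * k) * (m * m) * Δ * (κ * κ)
        eq₀ = solve-∀
        eq : ∀ k q p₁ w₀ W₁ y x₁ β κ b xx WW pp Wp px Wx →
          Wp ≡ w₀ * q - W₁ * p₁ - β → px ≡ q * y - p₁ * x₁ - κ → Wx ≡ w₀ * y - W₁ * x₁ - b →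
          pp ≡ q * q - p₁ * p₁ →
          let m = q - p₁ ; h = y - x₁ ; μ = w₀ - W₁
              A = + 2 * k * (m * β) ; P = + 2 * k * (κ * μ - h * β) ; C = + 2 * k * - (κ * m)
              Δ = w₀ * w₀ - (W₁ * W₁ + WW)
          in + 4 * (k * k) * (m * m * β) * (- (y * y - (x₁ * x₁ + xx)) * β + + 2 * κ * b) ≡
             A * A * xx + P * P * pp + C * C * WW + (+ 2 * A * P * px + + 2 * A * C * Wx + + 2 * P * C * Wp)
             + + 4 * (k * k) * (m * m) * Δ * (κ * κ)
        eq k q p₁ w₀ W₁ y x₁ β κ b xx WW _ _ _ _ refl refl refl refl = eq₀ q p₁ w₀ W₁ y x₁ β κ b xx WW k

      n>0 : 0ℤ < + n
      n>0 = +<+ (ℕ.>-nonZero⁻¹ n)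

      4n²>0 : 0ℤ < + 4 * (+ n * + n)
      4n²>0 = 0<* {+ 4} (+<+ (ℕ.s≤s ℕ.z≤n)) (0<* n>0 n>0)

      4n²m²>0 : 0ℤ < + 4 * (+ n * + n) * (m * m)
      4n²m²>0 = 0<* 4n²>0 (0<* m>0 m>0)

      4n²m²β>0 : 0ℤ < + 4 * (+ n * + n) * (m * m * β)
      4n²m²β>0 = 0<* 4n²>0 (0<* (0<* m>0 m>0) β>0)

      0≤Δ : 0ℤ ≤ Δ
      0≤Δ = <⇒≤ (proj₂ future)

      0≤e : 0ℤ ≤ e
      0≤e = *-cancel-0≤ 4n²m²β>0 (subst (0ℤ ≤_) (sym e-decomposition)
        (0≤+ (0≤x·x F) (0≤* (0≤* (<⇒≤ 4n²m²>0) 0≤Δ) (0≤□ κ))))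

      -- By `e-decomposition`, e is |F|² / (4 n² m² β) + Δ κ² / β. The first term is at most β / (4
      -- n); the second is at most Δ S² / β, hence at most β / 2 by `large`. The margin left over
      -- makes the inequality strict.
      e<β : e < β
      e<β = 0<⇒< (*-cancel-0< 4n²m²β>0 (subst (0ℤ <_)
          (trans (eq (+ n) m β Δ (+ S) κ (F · F) _ (sym e-decomposition))
            (sym (*-distribˡ-- (+ 4 * (+ n * + n) * (m * m * β)) β e)))
          (0<+ (0≤+ (0≤+ (≤⇒0≤ (x·x≤ F (λ j → <⇒≤ (<±⇒□< {F j} {m * β} (F<±g j)))))
                         (0≤* (0≤* {+ 2} 0≤+ℕ (0≤* (<⇒≤ (0<* n>0 n>0)) (<⇒≤ (0<* m>0 m>0)))) (≤⇒0≤ large)))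
                    (0≤* (0≤* (<⇒≤ 4n²m²>0) 0≤Δ) (<⇒≤ (<⇒0< (<±⇒□< {κ} {+ S} κ<S)))))
               (0<* (0<+ (0≤* (<⇒≤ n>0) n-1≥0) (0<* n>0 n>0)) (0<* (0<* m>0 m>0) (0<* β>0 β>0))))))
        refl
        where
        n-1≥0 : 0ℤ ≤ + n - 1ℤ
        n-1≥0 = ≤⇒0≤ (i<j⇒suc[i]≤j n>0)
        *-distribˡ-- : ∀ a b c → a * (b - c) ≡ a * b - a * c
        *-distribˡ-- = solve-∀
        eq₀ : ∀ n m β Δ S κ FF → (n * (m * β * (m * β)) - FF)
          + + 2 * (n * n * (m * m)) * (β * β - + 2 * (S * S) * Δ)
          + + 4 * (n * n) * (m * m) * Δ * (S * S - κ * κ)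
          + (n * (n - 1ℤ) + n * n) * (m * m * (β * β)) ≡
          + 4 * (n * n) * (m * m * β) * β - (FF + + 4 * (n * n) * (m * m) * Δ * (κ * κ))
        eq₀ = solve-∀
        eq : ∀ n m β Δ S κ FF E → FF + + 4 * (n * n) * (m * m) * Δ * (κ * κ) ≡ E → (n * (m * β * (m * β)) - FF)
          + + 2 * (n * n * (m * m)) * (β * β - + 2 * (S * S) * Δ)
          + + 4 * (n * n) * (m * m) * Δ * (S * S - κ * κ)
          + (n * (n - 1ℤ) + n * n) * (m * m * (β * β)) ≡
          + 4 * (n * n) * (m * m * β) * β - E
        eq n m β Δ S κ FF _ refl = eq₀ n m β Δ S κ FF

      -- Here the reflected vector may vanish, but m b = h v with |h| < m, so ± b itself is smaller.
      module Proportional (e≡0 : e ≡ 0ℤ) where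

        zeros : F · F ≡ 0ℤ × + 4 * (+ n * + n) * (m * m) * Δ * (κ * κ) ≡ 0ℤ
        zeros = sum-zero (0≤x·x F) (0≤* (0≤* (<⇒≤ 4n²m²>0) 0≤Δ) (0≤□ κ))
          (trans (sym e-decomposition) (trans (cong (+ 4 * (+ n * + n) * (m * m * β) *_) e≡0) (*-zeroʳ (+ 4 * (+ n * + n) * (m * m * β)))))

        κ≡0 : κ ≡ 0ℤ
        κ≡0 = □≤0⇒≡0 (≤-reflexive (factor-zero (0<* 4n²m²>0 (proj₂ future)) (proj₂ zeros)))

        mx≡hp : ∀ j → m * x j ≡ h * p j
        mx≡hp j = i-j≡0⇒i≡j _ _ (factor-zero (0<* (0<* {+ 2} (+<+ (ℕ.s≤s ℕ.z≤n)) n>0) β>0)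
          (trans (eq (+ n) m β (x j) h (p j) κ μ (W j) κ≡0) (x·x≡0⇒x≡0 F (proj₁ zeros) j)))
          where
          eq₀ : ∀ n m β x h p μ W → + 2 * n * β * (m * x - h * p) ≡
            + 2 * n * (m * β) * x + + 2 * n * (0ℤ * μ - h * β) * p + + 2 * n * - (0ℤ * m) * W
          eq₀ = solve-∀
          eq : ∀ n m β x h p κ μ W → κ ≡ 0ℤ → + 2 * n * β * (m * x - h * p) ≡
            + 2 * n * (m * β) * x + + 2 * n * (κ * μ - h * β) * p + + 2 * n * - (κ * m) * W
          eq n m β x h p _ μ W refl = eq₀ n m β x h p μ W

        -- From κ = 0 and m p · x = h |p|², with |p|² = q² - p₁² = m (q + p₁), one gets m (m t) = h
        -- m (q + p₁) - m q h = m h p₁.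
        mt≡hp₁ : m * t ≡ h * p₁
        mt≡hp₁ = i-j≡0⇒i≡j _ _ (factor-zero m>0
          (eq q p₁ t h (p · x) (p · p) (x·x≡□ v null) px≡ κ≡0))
          where
          px≡ : (q - p₁) * p · x ≡ h * p · p
          px≡ = trans (sym (·-*ʳ m p x)) (trans (·-congʳ p mx≡hp) (·-*ʳ h p p))
          eq₀ : ∀ q p₁ t h px pp → (q - p₁) * ((q - p₁) * t - h * p₁) ≡
            (q - p₁) * ((q - p₁) * t + q * h - px) + ((q - p₁) * px - h * pp) + h * (p₁ * p₁ + pp - q * q)
          eq₀ = solve-∀
          eq : ∀ q p₁ t h px pp → p₁ * p₁ + pp ≡ q * q → (q - p₁) * px ≡ h * pp →
            (q - p₁) * t + q * h - px ≡ 0ℤ → (q - p₁) * ((q - p₁) * t - h * p₁) ≡ 0ℤ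
          eq q p₁ t h px pp null px≡ κ≡0 = trans (eq₀ q p₁ t h px pp)
            (trans (cong₂ (λ a b → (q - p₁) * a + ((q - p₁) * px - b) + h * (p₁ * p₁ + pp - q * q)) κ≡0 (sym px≡))
            (trans (cong (λ a → (q - p₁) * 0ℤ + ((q - p₁) * px - (q - p₁) * px) + h * (a - q * q)) null)
              (eq₁ (q - p₁) px h (q * q))))
            where
            eq₁ : ∀ m px h qq → m * 0ℤ + (m * px - m * px) + h * (qq - qq) ≡ 0ℤ
            eq₁ = solve-∀

        h≢0 : h ≢ 0ℤ
        h≢0 h≡0 = nonzero (factor-zero m>0 (trans mt≡hp₁ (0* p₁)) , h≡0 ,
                           λ j → factor-zero m>0 (trans (mx≡hp j) (0* (p j))))
          where
          0* : ∀ a → h * a ≡ 0ℤ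
          0* a = trans (cong (_* a) h≡0) (*-zeroˡ a)

        mb≡hv : ∀ j → m * (t ∷ x) j ≡ h * proj₁ v j
        mb≡hv zero    = mt≡hp₁
        mb≡hv (suc j) = mx≡hp j

        m⟨u,b⟩≡h⟨u,v⟩ : ∀ u → m * ⟨ u , b ⟩ ≡ h * ⟨ u , v ⟩
        m⟨u,b⟩≡h⟨u,v⟩ (U , u₀) = trans (eq m u₀ (t + h) (U · (t ∷ x)))
          (trans (cong₂ (λ a b → u₀ * a - b)
                   (trans (eq₂ m t h) (trans (cong (_+ m * h) mt≡hp₁) (eq₃ h p₁ q)))
                   (trans (sym (·-*ʳ m U (t ∷ x)))
                     (trans (·-congʳ U {λ j → m * (t ∷ x) j} {λ j → h * proj₁ v j} mb≡hv) (·-*ʳ h U (proj₁ v)))))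
            (sym (eq h u₀ q (U · proj₁ v))))
          where
          eq : ∀ m u y d → m * (u * y - d) ≡ u * (m * y) - m * d
          eq = solve-∀
          eq₂ : ∀ m t h → m * (t + h) ≡ m * t + m * h
          eq₂ = solve-∀
          eq₃ : ∀ h p₁ q → h * p₁ + (q - p₁) * h ≡ h * q
          eq₃ = solve-∀

        b-null : ⟨ b , b ⟩ ≡ 0ℤ
        b-null = factor-zero m>0 (trans (m⟨u,b⟩≡h⟨u,v⟩ b) (trans (cong (h *_)
          (factor-zero m>0 (trans (cong (m *_) (⟨⟩-comm b v))
            (trans (m⟨u,b⟩≡h⟨u,v⟩ v) (trans (cong (h *_) null) (*-zeroʳ h)))))) (*-zeroʳ h)))

        -- With s the sign of h, ⟨w, s b⟩ = |h| β / m, a proper positive fraction of β. In this way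
        -- the descent also handles vectors v that are not primitive.
        signed : ∀ s → 0ℤ < s * h → 0ℤ < m - s * h → Smaller w v
        signed s 0<sh sh<m = s *ᵉ b + 0ℤ *ᵉ b ,
          trans (⟨⟩-□ s 0ℤ b b) (trans (cong (λ N → s * s * N + + 2 * s * 0ℤ * N + 0ℤ * 0ℤ * N) b-null) (eq₁ s)) ,
          *-cancel-0< m>0 (subst (0ℤ <_) (sym m⟨⟩) (0<* 0<sh β>0)) ,
          0<⇒< (*-cancel-0< m>0 (subst (0ℤ <_) (trans (eq₂ m s h β) (trans (cong (λ a → m * β - a) (sym m⟨⟩))
            (eq₃ m β _))) (0<* sh<m β>0))) refl
          where
          eq₁ : ∀ s → s * s * 0ℤ + + 2 * s * 0ℤ * 0ℤ + 0ℤ * 0ℤ * 0ℤ ≡ 0ℤ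
          eq₁ = solve-∀
          eq₂ : ∀ m s h β → (m - s * h) * β ≡ m * β - s * h * β
          eq₂ = solve-∀
          eq₃ : ∀ m β a → m * β - m * a ≡ m * (β - a)
          eq₃ = solve-∀
          eq₄ : ∀ m s b → m * (s * b + 0ℤ * b) ≡ s * (m * b)
          eq₄ = solve-∀
          m⟨⟩ : m * ⟨ w , s *ᵉ b + 0ℤ *ᵉ b ⟩ ≡ s * h * β
          m⟨⟩ = trans (cong (m *_) (⟨⟩-linearʳ s 0ℤ w b b)) (trans (eq₄ m s ⟨ w , b ⟩)
            (trans (cong (s *_) (m⟨u,b⟩≡h⟨u,v⟩ w)) (sym (*-assoc s h β))))

        smaller : Smaller w v
        smaller with <-cmp 0ℤ h
        ... | tri< 0<h _ _ = signed 1ℤ (subst (0ℤ <_) (sym (*-identityˡ h)) 0<h)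
                               (subst (λ a → 0ℤ < m - a) (sym (*-identityˡ h)) (proj₂ h<m))
        ... | tri≈ _ 0≡h _ = contradiction (sym 0≡h) h≢0
        ... | tri> _ _ h<0 = signed -1ℤ (subst (0ℤ <_) (sym (-1*i≡-i h)) (neg-mono-< h<0))
                               (subst (0ℤ <_) (eq m h) (proj₁ h<m))
          where
          eq : ∀ m h → m + h ≡ m - -1ℤ * h
          eq = solve-∀

      smaller : Smaller w v
      smaller with e ≟ 0ℤ
      ... | yes e≡0 = Proportional.smaller e≡0
      ... | no  e≢0 = v* , v*-null , subst (0ℤ <_) (sym wv*≡e) (≤∧≢⇒< 0≤e (λ 0≡e → e≢0 (sym 0≡e))) ,
                      subst (_< β) (sym wv*≡e) e<β

    θ : Vector ℤ n
    θ j = μ * p j - m * W j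

    smaller-from-bounds : (∃[ q′ ] ℕ.NonZero q′ × + q′ ≡ q) → (∃[ m′ ] ℕ.NonZero m′ × + m′ ≡ m) →
      (∃[ g′ ] ℕ.NonZero g′ × + g′ ≡ m * β) → (∃[ r ] ℕ.NonZero r × (∀ j → θ j ≤± + r)) → Smaller w v
    smaller-from-bounds (q′ , q-nz , q≡) (m′ , m-nz , m≡) (g′ , g-nz , g≡) (r , r-nz , θ≤r) =
      conclude (dirichlet n q′ m′ g′ S r {{ℕ.>-nonZero (ℕ.>-nonZero⁻¹ n)}} {{q-nz}} {{m-nz}} {{g-nz}} {{S-nz}} {{r-nz}}
        p (λ j → β * p j) θ q≤m m≤2q S>
        (λ j → subst (p j ≤±_) (sym q≡) (p≤±q (suc j))) βp≤g θ≤r)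
      where
      conclude : (∃[ t ] ∃[ h ] Σ[ x ∈ Vector ℤ n ]
        ¬ (t ≡ 0ℤ × h ≡ 0ℤ × (∀ j → x j ≡ 0ℤ))
        × h <± + m′ × + m′ * t + + q′ * h - p · x <± + S ×
        (∀ j → + 2 * + n * (+ g′ * x j - h * (β * p j) + (+ m′ * t + + q′ * h - p · x) * (μ * p j - m * W j))
               <± + g′)) → Smaller w v
      conclude (t , h , x , nonzero , h< , κ< , G<) = WithShortVector.smaller t h x nonzero
        (subst (h <±_) m≡ h<) (subst (_<± + S) κ≡ κ<)
        (λ j → subst₂ _<±_
          (cong₂ (λ g k → + 2 * + n * (g * x j - h * (β * p j) + k * (μ * p j - m * W j))) g≡ κ≡) g≡ (G< j))
        where
        κ≡ : + m′ * t + + q′ * h - p · x ≡ m * t + q * h - p · x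
        κ≡ = cong₂ (λ m q → m * t + q * h - p · x) m≡ q≡
      S-nz : ℕ.NonZero S
      S-nz = ℕ.>-nonZero (ℕₚ.≤-<-trans ℕ.z≤n S>)
      q≤m : q′ ℕ.≤ m′
      q≤m = drop‿+≤+ (subst₂ _≤_ (sym q≡) (sym m≡) (0≤⇒≤ p₁≤0 (eq q p₁)))
        where
        eq : ∀ q p → q - p - q ≡ - p
        eq = solve-∀
      m≤2q : m′ ℕ.≤ 2 ℕ.* q′
      m≤2q = drop‿+≤+ (subst₂ _≤_ (sym m≡) (sym (trans (pos-* 2 q′) (cong (+ 2 *_) q≡)))
               (0≤⇒≤ (proj₁ (p≤±q zero)) (eq q p₁)))
        where
        eq : ∀ q p → + 2 * q - (q - p) ≡ q + p
        eq = solve-∀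
      βp≤g : ∀ j → β * p j ≤± + g′
      βp≤g j = subst (β * p j ≤±_) (sym g≡)
        ( subst (0ℤ ≤_) (eq₁ q p₁ (p j) β) (0≤* (<⇒≤ β>0) (0≤+ p₁≤0 (proj₁ (p≤±q (suc j)))))
        , subst (0ℤ ≤_) (eq₂ q p₁ (p j) β) (0≤* (<⇒≤ β>0) (0≤+ p₁≤0 (proj₂ (p≤±q (suc j))))) )
        where
        eq₁ : ∀ q p₁ p β → β * (- p₁ + (q + p)) ≡ (q - p₁) * β + β * p
        eq₁ = solve-∀
        eq₂ : ∀ q p₁ p β → β * (- p₁ + (q - p)) ≡ (q - p₁) * β - β * p
        eq₂ = solve-∀

    smaller : Smaller w v
    smaller = smaller-from-bounds (positive⇒ℕ q>0) (positive⇒ℕ m>0) (positive⇒ℕ (0<* m>0 β>0)) (vector-bound θ)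

  mirror-smaller : ∀ {n} (w v : Event (suc n)) → Smaller (mirror w) (mirror v) → Smaller w v
  mirror-smaller w v (u , u-null , 0<wu , wu<β) = mirror u , trans (⟨⟩-mirror u u) u-null ,
    subst (0ℤ <_) (sym (⟨⟩-mirrorʳ w u)) 0<wu ,
    subst₂ _<_ (sym (⟨⟩-mirrorʳ w u)) (⟨⟩-mirror w v) wu<β

  descent-step : ∀ {n} .{{_ : ℕ.NonZero n}} S → cellBound n ℕ.< S → (w : Event (suc n)) → Future w →
    (v : Event (suc n)) → ⟨ v , v ⟩ ≡ 0ℤ → 0ℤ < ⟨ w , v ⟩ →
    + 2 * (+ S * + S) * ⟨ w , w ⟩ ≤ ⟨ w , v ⟩ * ⟨ w , v ⟩ → Smaller w v
  descent-step {n} S S> w future v null β>0 large = by-sign (≤-total (proj₁ v zero) 0ℤ)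
    where
    by-sign : proj₁ v zero ≤ 0ℤ ⊎ 0ℤ ≤ proj₁ v zero → Smaller w v
    by-sign (inj₁ p₁≤0) = Step.smaller S S> w future v null β>0 (neg-mono-≤ p₁≤0) large
    by-sign (inj₂ p₁≥0) = mirror-smaller w v
      (Step.smaller S S> (mirror w) (mirror-future w future) (mirror v)
        (trans (⟨⟩-mirror v v) null) (subst (0ℤ <_) (sym (⟨⟩-mirror w v)) β>0)
        (subst (0ℤ ≤_) (sym (neg-involutive (proj₁ v zero))) p₁≥0)
        (subst₂ (λ d b → + 2 * (+ S * + S) * d ≤ b * b) (sym (⟨⟩-mirror w w)) (sym (⟨⟩-mirror w v)) large))

  <-≤-connex : ∀ a b → a < b ⊎ b ≤ a
  <-≤-connex a b with a <? b
  ... | yes a<b = inj₁ a<b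
  ... | no  a≮b = inj₂ (≮⇒≥ a≮b)

  -- The positive integer ⟨w, v⟩ drops at each step. The start (1, 0, ..., 0; 1) has ⟨w, v₀⟩ = w₀ -
  -- W₁, which is positive for every future vector w.
  descent : ∀ {n} .{{_ : ℕ.NonZero n}} S → cellBound n ℕ.< S → (w : Event (suc n)) → Future w →
    Σ[ v ∈ Event (suc n) ] ⟨ v , v ⟩ ≡ 0ℤ × 0ℤ < ⟨ w , v ⟩
      × ⟨ w , v ⟩ * ⟨ w , v ⟩ < + 2 * (+ S * + S) * ⟨ w , w ⟩
  descent {n} S S> w future = go (<-wellFounded _) v₀ v₀-null v₀>0 refl
    where
    v₀ : Event (suc n)
    v₀ = 1ℤ ∷ (λ _ → 0ℤ) , 1ℤ
    v₀-null : ⟨ v₀ , v₀ ⟩ ≡ 0ℤ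
    v₀-null = cong (λ d → 1ℤ * 1ℤ - (1ℤ * 1ℤ + d)) (·-zeroʳ {n} (λ _ → 0ℤ) (λ _ → refl))
    v₀>0 : 0ℤ < ⟨ w , v₀ ⟩
    v₀>0 = subst (0ℤ <_) (trans (eq (proj₂ w) (proj₁ w zero))
      (cong (λ d → proj₂ w * 1ℤ - (proj₁ w zero * 1ℤ + d)) (sym (·-zeroʳ (tail (proj₁ w)) (λ _ → refl)))))
      (0<w₀-W₁ w future)
      where
      eq : ∀ a b → a - b ≡ a * 1ℤ - (b * 1ℤ + 0ℤ)
      eq = solve-∀
    Result = Σ[ v ∈ Event (suc n) ] ⟨ v , v ⟩ ≡ 0ℤ × 0ℤ < ⟨ w , v ⟩
               × ⟨ w , v ⟩ * ⟨ w , v ⟩ < + 2 * (+ S * + S) * ⟨ w , w ⟩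
    go : ∀ {k} → Acc ℕ._<_ k → (v : Event (suc n)) → ⟨ v , v ⟩ ≡ 0ℤ → 0ℤ < ⟨ w , v ⟩ → ∣ ⟨ w , v ⟩ ∣ ≡ k → Result
    go (acc rec) v null β>0 refl = by-size (<-≤-connex (⟨ w , v ⟩ * ⟨ w , v ⟩) (+ 2 * (+ S * + S) * ⟨ w , w ⟩))
      where
      continue : Smaller w v → Result
      continue (u , u-null , 0<wu , wu<β) = go (rec (drop‿+<+ (subst₂ _<_
        (sym (0≤i⇒+∣i∣≡i (<⇒≤ 0<wu))) (sym (0≤i⇒+∣i∣≡i (<⇒≤ β>0))) wu<β))) u u-null 0<wu refl
      by-size : ⟨ w , v ⟩ * ⟨ w , v ⟩ < + 2 * (+ S * + S) * ⟨ w , w ⟩ ⊎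
                + 2 * (+ S * + S) * ⟨ w , w ⟩ ≤ ⟨ w , v ⟩ * ⟨ w , v ⟩ → Result
      by-size (inj₁ small) = v , null , β>0 , small
      by-size (inj₂ large) = continue (descent-step S S> w future v null β>0 large)

-- Integers inside the rationals, and rational inequalities

module RationalOrder where
  open import Data.Integer.Base as ℤ using (ℤ)
  import Data.Integer.Properties as ℤ
  import Data.Integer.DivMod as ℤ using (a≡a%ℕn+[a/ℕn]*n; n%ℕd<d)
  open import Data.Maybe.Base using (Maybe; just; nothing)
  open import Data.Nat.Base as ℕ using (ℕ; suc)
  import Data.Nat.Properties as ℕ
  open import Data.Product.Base using (_×_; _,_; ∃-syntax)
  open import Data.Rational.Base
  open import Data.Rational.Properties
  open import Data.Rational.Unnormalised.Base as ℚᵘ using (mkℚᵘ)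
  import Data.Rational.Unnormalised.Properties as ℚᵘ
  open import Data.Sum.Base using (inj₁; inj₂)
  open import Level using (0ℓ)
  open import Relation.Binary.PropositionalEquality
  open import Relation.Nullary using (¬_; yes; no)
  open import Tactic.RingSolver using (solve-∀)
  open import Tactic.RingSolver.Core.AlmostCommutativeRing using (AlmostCommutativeRing; fromCommutativeRing)

  ℚ-ring : AlmostCommutativeRing 0ℓ 0ℓ
  ℚ-ring = fromCommutativeRing +-*-commutativeRing isZero
    where
    isZero : ∀ x → Maybe (0ℚ ≡ x)
    isZero x with 0ℚ ≟ x
    ... | yes 0≡x = just 0≡x
    ... | no  _   = nothing

  ι : ℤ → ℚ
  ι z = z / 1

  toℚᵘ-ι : ∀ z → toℚᵘ (ι z) ℚᵘ.≃ mkℚᵘ z 0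
  toℚᵘ-ι z = toℚᵘ-fromℚᵘ (mkℚᵘ z 0)

  ι-+ : ∀ a b → ι (a ℤ.+ b) ≡ ι a + ι b
  ι-+ a b = toℚᵘ-injective (ℚᵘ.≃-trans (toℚᵘ-ι (a ℤ.+ b))
    (ℚᵘ.≃-trans (ℚᵘ.*≡* (cong (ℤ._* ℤ.1ℤ) (cong₂ ℤ._+_ (sym (ℤ.*-identityʳ a)) (sym (ℤ.*-identityʳ b)))))
    (ℚᵘ.≃-trans (ℚᵘ.+-cong (ℚᵘ.≃-sym (toℚᵘ-ι a)) (ℚᵘ.≃-sym (toℚᵘ-ι b)))
    (ℚᵘ.≃-sym (toℚᵘ-homo-+ (ι a) (ι b))))))

  ι-* : ∀ a b → ι (a ℤ.* b) ≡ ι a * ι b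
  ι-* a b = toℚᵘ-injective (ℚᵘ.≃-trans (toℚᵘ-ι (a ℤ.* b))
    (ℚᵘ.≃-trans (ℚᵘ.*-cong (ℚᵘ.≃-sym (toℚᵘ-ι a)) (ℚᵘ.≃-sym (toℚᵘ-ι b)))
    (ℚᵘ.≃-sym (toℚᵘ-homo-* (ι a) (ι b)))))

  ι-neg : ∀ a → ι (ℤ.- a) ≡ - ι a
  ι-neg a = toℚᵘ-injective (ℚᵘ.≃-trans (toℚᵘ-ι (ℤ.- a))
    (ℚᵘ.≃-trans (ℚᵘ.-‿cong (ℚᵘ.≃-sym (toℚᵘ-ι a))) (ℚᵘ.≃-sym (toℚᵘ-homo‿- (ι a)))))

  ι-- : ∀ a b → ι (a ℤ.- b) ≡ ι a - ι b
  ι-- a b = trans (ι-+ a (ℤ.- b)) (cong (ι a +_) (ι-neg b))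

  ι-mono-≤ : ∀ {a b} → a ℤ.≤ b → ι a ≤ ι b
  ι-mono-≤ {a} {b} a≤b = toℚᵘ-cancel-≤ (ℚᵘ.≤-respˡ-≃ (ℚᵘ.≃-sym (toℚᵘ-ι a))
    (ℚᵘ.≤-respʳ-≃ (ℚᵘ.≃-sym (toℚᵘ-ι b)) (ℚᵘ.*≤* (ℤ.*-monoʳ-≤-nonNeg ℤ.1ℤ a≤b))))

  ι-mono-< : ∀ {a b} → a ℤ.< b → ι a < ι b
  ι-mono-< {a} {b} a<b = toℚᵘ-cancel-< (ℚᵘ.<-respˡ-≃ (ℚᵘ.≃-sym (toℚᵘ-ι a))
    (ℚᵘ.<-respʳ-≃ (ℚᵘ.≃-sym (toℚᵘ-ι b)) (ℚᵘ.*<* (ℤ.*-monoʳ-<-pos ℤ.1ℤ a<b))))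

  <⇒≱ : ∀ {a b} → a < b → ¬ (b ≤ a)
  <⇒≱ a<b b≤a = <-irrefl refl (<-≤-trans a<b b≤a)

  ι-cancel-≤ : ∀ {a b} → ι a ≤ ι b → a ℤ.≤ b
  ι-cancel-≤ ιa≤ιb = ℤ.≮⇒≥ λ b<a → <⇒≱ (ι-mono-< b<a) ιa≤ιb

  /-*-cancel : ∀ p q .{{_ : ℕ.NonZero q}} → p / q * ι (ℤ.+ q) ≡ ι p
  /-*-cancel p (suc q) = toℚᵘ-injective (ℚᵘ.≃-trans (toℚᵘ-homo-* (p / suc q) (ι (ℤ.+ suc q)))
    (ℚᵘ.≃-trans (ℚᵘ.*-cong (toℚᵘ-fromℚᵘ (mkℚᵘ p q)) (toℚᵘ-ι (ℤ.+ suc q)))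
    (ℚᵘ.≃-trans (ℚᵘ.*≡* (trans (ℤ.*-identityʳ (p ℤ.* ℤ.+ suc q))
                                (cong (λ s → p ℤ.* ℤ.+ s) (sym (ℕ.*-identityʳ (suc q))))))
    (ℚᵘ.≃-sym (toℚᵘ-ι p)))))

  0≤+ : ∀ {a b} → 0ℚ ≤ a → 0ℚ ≤ b → 0ℚ ≤ a + b
  0≤+ = +-mono-≤

  0≤* : ∀ {a b} → 0ℚ ≤ a → 0ℚ ≤ b → 0ℚ ≤ a * b
  0≤* {a} {b} 0≤a 0≤b = subst (_≤ a * b) (*-zeroʳ a) (*-monoˡ-≤-nonNeg a {{nonNegative 0≤a}} 0≤b)

  ∣a∣□ : ∀ a → ∣ a ∣ * ∣ a ∣ ≡ a * a
  ∣a∣□ a with ∣p∣≡p∨∣p∣≡-p a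
  ... | inj₁ eq = cong₂ _*_ eq eq
  ... | inj₂ eq = trans (cong₂ _*_ eq eq) (e a)
    where
    e : ∀ a → (- a) * (- a) ≡ a * a
    e = solve-∀ ℚ-ring

  0≤□ : ∀ a → 0ℚ ≤ a * a
  0≤□ a = subst (0ℚ ≤_) (∣a∣□ a) (0≤* (0≤∣p∣ a) (0≤∣p∣ a))

  ≤⇒0≤ : ∀ {a b} → a ≤ b → 0ℚ ≤ b - a
  ≤⇒0≤ {a} {b} a≤b = subst (_≤ b - a) (+-inverseʳ a) (+-monoˡ-≤ (- a) a≤b)

  <⇒0< : ∀ {a b} → a < b → 0ℚ < b - a
  <⇒0< {a} {b} a<b = subst (_< b - a) (+-inverseʳ a) (+-monoˡ-< (- a) a<b)

  0≤⇒≤ : ∀ {a b c} → 0ℚ ≤ c → b - a ≡ c → a ≤ b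
  0≤⇒≤ {a} {b} 0≤c refl = subst₂ _≤_ (+-identityˡ a) (e a b) (+-monoˡ-≤ a 0≤c)
    where
    e : ∀ a b → b - a + a ≡ b
    e = solve-∀ ℚ-ring

  *-cancel-0≤ : ∀ {a b} → 0ℚ < a → 0ℚ ≤ a * b → 0ℚ ≤ b
  *-cancel-0≤ {a} {b} 0<a 0≤ab = *-cancelˡ-≤-pos a {{positive 0<a}} (subst (_≤ a * b) (sym (*-zeroʳ a)) 0≤ab)

  0≤ι : ∀ {a} → ℤ.0ℤ ℤ.≤ a → 0ℚ ≤ ι a
  0≤ι = ι-mono-≤

  0<ι : ∀ {a} → ℤ.0ℤ ℤ.< a → 0ℚ < ι a
  0<ι = ι-mono-<

  infix 4 _≤±_

  -- A record, unlike the integer version, so that `a` and `A` can be inferred from the type of a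
  -- proof.
  record _≤±_ (a A : ℚ) : Set where
    constructor _,_
    field
      lower : 0ℚ ≤ A + a
      upper : 0ℚ ≤ A - a
  open _≤±_ public

  □≤⇒≤± : ∀ {a A} → 0ℚ ≤ A → a * a ≤ A * A → a ≤± A
  □≤⇒≤± {a} {A} 0≤A a²≤A² = one a a²≤A² (e₁ a A) , one (- a) (subst (_≤ A * A) (e₀ a) a²≤A²) (e₂ a A)
    where
    e₀ : ∀ a → a * a ≡ (- a) * (- a)
    e₀ = solve-∀ ℚ-ring
    e₁ : ∀ a A → A + a ≡ A - (- a)
    e₁ = solve-∀ ℚ-ring
    e₂ : ∀ a A → A - a ≡ A - (- - a)
    e₂ = solve-∀ ℚ-ring
    eq : ∀ a A → A * A + ((- a - A) * (- a - A) + (A + A) * (- a - A)) ≡ a * a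
    eq = solve-∀ ℚ-ring
    one : ∀ a → a * a ≤ A * A → ∀ {d} → d ≡ A - (- a) → 0ℚ ≤ d
    one a a²≤A² refl = ≤⇒0≤ (≮⇒≥ λ A<-a →
      let d>0 = <⇒0< {A} { - a} A<-a in
      <⇒≱ (subst₂ _<_ (+-identityʳ (A * A)) (eq a A) (+-monoʳ-< (A * A) (+-mono-<-≤
        (subst (_< (- a - A) * (- a - A)) (*-zeroʳ (- a - A)) (*-monoʳ-<-pos (- a - A) {{positive d>0}} d>0))
        (0≤* (0≤+ 0≤A 0≤A) (<⇒≤ d>0))))) a²≤A²)

  ≤±⇒□≤ : ∀ {a A} → a ≤± A → a * a ≤ A * A
  ≤±⇒□≤ {a} {A} (a₁ , a₂) = 0≤⇒≤ (0≤* a₁ a₂) (e a A)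
    where
    e : ∀ a A → A * A - a * a ≡ (A + a) * (A - a)
    e = solve-∀ ℚ-ring

  ∣∣<⇒≤± : ∀ {a A} → ∣ a ∣ < A → a ≤± A
  ∣∣<⇒≤± {a} {A} ∣a∣<A = □≤⇒≤± (<⇒≤ (≤-<-trans (0≤∣p∣ a) ∣a∣<A)) (≤-trans (≤-reflexive (sym (∣a∣□ a)))
    (≤-trans (*-monoˡ-≤-nonNeg ∣ a ∣ {{nonNegative (0≤∣p∣ a)}} (<⇒≤ ∣a∣<A))
      (*-monoʳ-≤-nonNeg A {{nonNegative (<⇒≤ (≤-<-trans (0≤∣p∣ a) ∣a∣<A))}} (<⇒≤ ∣a∣<A))))

  floor-bounds : ∀ x → ∃[ z ] 0ℚ ≤ x - ι z × 0ℚ ≤ 1ℚ - (x - ι z)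
  floor-bounds x = z , *-cancel-0≤ d>0 (subst (0ℚ ≤_) (trans (sym xz) (*-comm (x - ι z) (ι d))) (0≤ι {ℤ.+ r} (ℤ.+≤+ ℕ.z≤n)))
    , *-cancel-0≤ d>0 (subst (0ℚ ≤_) (trans (cong (λ a → ι d - a) (sym xz)) (e₂ (ι d) (x - ι z)))
        (≤⇒0≤ (ι-mono-≤ {ℤ.+ r} {d} (ℤ.+≤+ (ℕ.<⇒≤ (ℤ.n%ℕd<d (↥ x) (↧ₙ x)))))))
    where
    z = ↥ x ℤ./ℕ ↧ₙ x
    r = ↥ x ℤ.%ℕ ↧ₙ x
    d = ℤ.+ ↧ₙ x
    d>0 : 0ℚ < ι d
    d>0 = 0<ι {d} (ℤ.+<+ (ℕ.s≤s ℕ.z≤n))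
    e₁ : ∀ r z d → r + z * d - z * d ≡ r
    e₁ = solve-∀ ℚ-ring
    e₂ : ∀ d a → d - a * d ≡ d * (1ℚ - a)
    e₂ = solve-∀ ℚ-ring
    e₃ : ∀ x z d → (x - z) * d ≡ x * d - z * d
    e₃ = solve-∀ ℚ-ring
    xz : (x - ι z) * ι d ≡ ι (ℤ.+ r)
    xz = trans (e₃ x (ι z) (ι d)) (trans (cong (_- ι z * ι d)
      (trans (cong (_* ι d) (sym (↥p/↧p≡p x))) (trans (/-*-cancel (↥ x) (↧ₙ x))
        (trans (cong ι (ℤ.a≡a%ℕn+[a/ℕn]*n (↥ x) (↧ₙ x)))
          (trans (ι-+ (ℤ.+ r) (z ℤ.* d)) (cong (ι (ℤ.+ r) +_) (ι-* z d)))))))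
      (e₁ (ι (ℤ.+ r)) (ι z) (ι d)))

-- Denominator and distance of the null vector that ends the descent

module IntegerApproximation where
  open import Data.Integer hiding (suc)
  open import Data.Integer.Properties
  open import Data.Integer.Tactic.RingSolver
  open import Data.Nat.Base as ℕ using (ℕ; suc)
  open import Data.Product.Base using (_×_; _,_; proj₁; proj₂; Σ-syntax; ∃-syntax)
  open import Data.Vec.Functional using (Vector)
  open import Relation.Binary.PropositionalEquality
  open IntegerOrder
  open IntegerVectors
  open Dirichlet using (cellBound)
  open LightCone
  open Descent

  -- The right-hand side is exactly |q W - w₀ p|² when v is null; one coordinate contributes at most
  -- that much.
  distance : ∀ {d} (w v : Event d) → ⟨ v , v ⟩ ≡ 0ℤ → let (W , w₀) = w ; (p , q) = v in
    ∀ j → (W j * q - p j * w₀) * (W j * q - p j * w₀) ≤ + 2 * q * w₀ * ⟨ w , v ⟩ - q * q * ⟨ w , w ⟩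
  distance (W , w₀) (p , q) null j = subst₂ _≤_ (cong (λ a → a * a) (eq₁ q w₀ (W j) (p j)))
    (trans (□-expand q (- w₀) 0ℤ W p p)
      (trans (cong (λ s → q * q * W · W + - w₀ * - w₀ * s + 0ℤ * 0ℤ * s +
               (+ 2 * q * - w₀ * W · p + + 2 * q * 0ℤ * W · p + + 2 * - w₀ * 0ℤ * s)) (x·x≡□ (p , q) null))
        (eq₂ q w₀ (W · W) (W · p))))
    (□≤x·x (λ j → q * W j + - w₀ * p j + 0ℤ * p j) j)
    where
    eq₁ : ∀ q w₀ W p → q * W + - w₀ * p + 0ℤ * p ≡ W * q - p * w₀
    eq₁ = solve-∀
    eq₂ : ∀ q w₀ WW Wp → q * q * WW + - w₀ * - w₀ * (q * q) + 0ℤ * 0ℤ * (q * q) +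
               (+ 2 * q * - w₀ * Wp + + 2 * q * 0ℤ * Wp + + 2 * - w₀ * 0ℤ * (q * q)) ≡
               + 2 * q * w₀ * (w₀ * q - Wp) - q * q * (w₀ * w₀ - WW)
    eq₂ = solve-∀

  Approximation : ∀ {d} → ℤ → ℤ → ℤ → Vector ℤ d → Set
  Approximation {d} S t k W = Σ[ p ∈ Vector ℤ d ] ∃[ q ] ℕ.NonZero q × p · p ≡ + q * + q × + q ≤ k ×
    (∀ j → (W j * + q - p j * (t * (k * k))) * (W j * + q - p j * (t * (k * k)))
           ≤ + 12 * + q * (S * S * (t * t) * (k * k * k)))

  -- Write X = t² S² k². The upper bound 17 X on ⟨w, w⟩ controls ⟨w, v⟩ and thereby the distance;
  -- the lower bound 14 X keeps the denominator below or at k.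
  approximation : ∀ {n} .{{_ : ℕ.NonZero n}} S → cellBound n ℕ.< S → ∀ t k → 0ℤ < t → 0ℤ < k →
    (W : Vector ℤ (suc n)) →
    + 14 * (t * t * (+ S * + S) * (k * k)) ≤ ⟨ (W , t * (k * k)) , (W , t * (k * k)) ⟩ →
    ⟨ (W , t * (k * k)) , (W , t * (k * k)) ⟩ ≤ + 17 * (t * t * (+ S * + S) * (k * k)) →
    Approximation (+ S) t k W
  approximation {n} S₀ S> t k t>0 k>0 W Δ-lower Δ-upper = conclude (descent S₀ S> w future)
    where
    S = + S₀
    D = t * (k * k)
    w : Event (suc n)
    w = W , D
    Δ = ⟨ w , w ⟩
    S>0 : 0ℤ < S
    S>0 = +<+ (ℕₚ.≤-<-trans ℕ.z≤n S>)
      where import Data.Nat.Properties as ℕₚ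
    D>0 : 0ℤ < D
    D>0 = 0<* t>0 (0<* k>0 k>0)
    X>0 : 0ℤ < t * t * (S * S) * (k * k)
    X>0 = 0<* (0<* (0<* t>0 t>0) (0<* S>0 S>0)) (0<* k>0 k>0)
    future : Future w
    future = D>0 , <-≤-trans (0<* {+ 14} (+<+ (ℕ.s≤s ℕ.z≤n)) X>0) Δ-lower
    conclude : Σ[ v ∈ Event (suc n) ] ⟨ v , v ⟩ ≡ 0ℤ × 0ℤ < ⟨ w , v ⟩
      × ⟨ w , v ⟩ * ⟨ w , v ⟩ < + 2 * (S * S) * Δ → Approximation S t k W
    conclude (v , null , β>0 , β²<) = as-ℕ (positive⇒ℕ q>0)
      where
      p = proj₁ v
      q = proj₂ v
      β = ⟨ w , v ⟩
      q>0 : 0ℤ < q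
      q>0 = 0<q w future v null β>0
      -- B² = 36 S² X, whereas β² < 2 S² Δ ≤ 34 S² X.
      B = + 6 * (S * S) * t * k
      0≤B : 0ℤ ≤ B
      0≤B = <⇒≤ (0<* (0<* (0<* {+ 6} (+<+ (ℕ.s≤s ℕ.z≤n)) (0<* S>0 S>0)) t>0) k>0)
      β≤B : 0ℤ ≤ B - β
      β≤B = proj₂ (□≤⇒≤± 0≤B (≤-trans (<⇒≤ β²<) (0≤⇒≤
        (0≤+ (0≤* (0≤* {+ 2} 0≤+ℕ (0≤□ S)) (≤⇒0≤ Δ-upper))
             (0≤* {+ 2} 0≤+ℕ (0≤* (0≤□ S) (<⇒≤ X>0)))) (eq S t k Δ))))
        where
        eq : ∀ S t k Δ → + 6 * (S * S) * t * k * (+ 6 * (S * S) * t * k) - + 2 * (S * S) * Δ ≡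
          + 2 * (S * S) * (+ 17 * (t * t * (S * S) * (k * k)) - Δ) + + 2 * ((S * S) * (t * t * (S * S) * (k * k)))
        eq = solve-∀
      -- Since 14 X q ≤ Δ q ≤ 2 D β ≤ 2 D B = 12 X k, even 14 q ≤ 12 k holds; this is where 14 has
      -- to exceed 12.
      q≤k : q ≤ k
      q≤k = 0≤⇒≤ (*-cancel-0≤ (0<* {+ 12} (+<+ (ℕ.s≤s ℕ.z≤n)) X>0) (subst (0ℤ ≤_) (eq S t k Δ β q)
        (0≤+ (0≤+ (0≤* (≤⇒0≤ Δ-lower) (<⇒≤ q>0)) (≤⇒0≤ (Δq≤2w₀β w future v null β>0)))
             (0≤+ (0≤* (0≤* {+ 2} 0≤+ℕ (<⇒≤ D>0)) β≤B) (0≤* (0≤* {+ 2} 0≤+ℕ (<⇒≤ X>0)) (<⇒≤ q>0)))))) refl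
        where
        eq : ∀ S t k Δ β q → (Δ - + 14 * (t * t * (S * S) * (k * k))) * q
          + (+ 2 * (t * (k * k)) * β - Δ * q)
          + (+ 2 * (t * (k * k)) * (+ 6 * (S * S) * t * k - β) + + 2 * (t * t * (S * S) * (k * k)) * q) ≡
          + 12 * (t * t * (S * S) * (k * k)) * (k - q)
        eq = solve-∀
      near : ∀ j → (W j * q - p j * D) * (W j * q - p j * D) ≤ + 12 * q * (S * S * (t * t) * (k * k * k))
      near j = ≤-trans (distance w v null j) (0≤⇒≤
        (0≤+ (0≤* (0≤* (0≤* {+ 2} 0≤+ℕ (<⇒≤ q>0)) (<⇒≤ D>0)) β≤B) (0≤* (0≤□ q) (<⇒≤ (proj₂ future))))
        (eq S t k Δ β q))
        where
        eq : ∀ S t k Δ β q → + 12 * q * (S * S * (t * t) * (k * k * k)) -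
          (+ 2 * q * (t * (k * k)) * β - q * q * Δ) ≡
          + 2 * q * (t * (k * k)) * (+ 6 * (S * S) * t * k - β) + q * q * Δ
        eq = solve-∀
      as-ℕ : (∃[ q′ ] ℕ.NonZero q′ × + q′ ≡ q) → Approximation S t k W
      as-ℕ (q′ , nz , q≡) = p , q′ , nz ,
        trans (x·x≡□ v null) (sym (cong (λ a → a * a) q≡)) , subst (_≤ k) (sym q≡) q≤k ,
        λ j → subst (λ a → (W j * a - p j * D) * (W j * a - p j * D) ≤ + 12 * a * (S * S * (t * t) * (k * k * k)))
                    (sym q≡) (near j)

-- Approximating a rational vector close to the sphere

module RationalApproximation where
  open import Data.Integer.Base as ℤ using (ℤ; +_)
  import Data.Integer.Properties as ℤ
  import Data.Integer.Tactic.RingSolver as ℤ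
  open import Data.Fin.Base using (zero; suc)
  open import Data.Nat.Base as ℕ using (ℕ; zero; suc)
  import Data.Nat.Properties as ℕ
  open import Data.Product.Base using (_×_; _,_; proj₁; proj₂; Σ-syntax; ∃-syntax)
  open import Data.Rational.Base
  open import Data.Rational.Properties
  open import Data.Sum.Base using (inj₁; inj₂; _⊎_)
  open import Data.Vec.Functional using (Vector; tail; _∷_)
  open import Relation.Binary.PropositionalEquality hiding (J)
  open import Tactic.RingSolver using (solve-∀)
  module ℤᵒ = IntegerOrder
  open IntegerVectors using (_·_; ·-zeroʳ)
  open Dirichlet using (cellBound)
  open LightCone using (⟨_,_⟩)
  open IntegerApproximation
  open RationalOrder

  2ℚ 4ℚ : ℚ
  2ℚ = ι (+ 2)
  4ℚ = ι (+ 4)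

  2>0 : 0ℚ < 2ℚ
  2>0 = positive⁻¹ 2ℚ

  0≤ℕ : ∀ k → 0ℚ ≤ ι (+ k)
  0≤ℕ k = 0≤ι {+ k} (ℤ.+≤+ ℕ.z≤n)

  sumsq : ∀ {d} → Vector ℚ d → ℚ
  sumsq {zero}  x = 0ℚ
  sumsq {suc d} x = x zero * x zero + sumsq (tail x)

  0≤sumsq : ∀ {d} (x : Vector ℚ d) → 0ℚ ≤ sumsq x
  0≤sumsq {zero}  x = ≤-refl
  0≤sumsq {suc d} x = 0≤+ (0≤□ (x zero)) (0≤sumsq (tail x))

  □≤sumsq : ∀ {d} (x : Vector ℚ d) j → x j * x j ≤ sumsq x
  □≤sumsq {suc d} x zero = 0≤⇒≤ (0≤sumsq (tail x)) (e (x zero * x zero) (sumsq (tail x)))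
    where
    e : ∀ a b → a + b - a ≡ b
    e = solve-∀ ℚ-ring
  □≤sumsq {suc d} x (suc j) = ≤-trans (□≤sumsq (tail x) j)
    (0≤⇒≤ (0≤□ (x zero)) (e (x zero * x zero) (sumsq (tail x))))
    where
    e : ∀ a b → a + b - b ≡ a
    e = solve-∀ ℚ-ring

  +-≤± : ∀ {a b A B} → a ≤± A → b ≤± B → a + b ≤± A + B
  +-≤± {a} {b} {A} {B} (a₁ , a₂) (b₁ , b₂) =
    subst (0ℚ ≤_) (e₁ a b A B) (0≤+ a₁ b₁) , subst (0ℚ ≤_) (e₂ a b A B) (0≤+ a₂ b₂)
    where
    e₁ : ∀ a b A B → (A + a) + (B + b) ≡ (A + B) + (a + b)
    e₁ = solve-∀ ℚ-ring
    e₂ : ∀ a b A B → (A - a) + (B - b) ≡ (A + B) - (a + b)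
    e₂ = solve-∀ ℚ-ring

  -- No case distinction on signs: 2 (A B + a b) = (A + a) (B + b) + (A - a) (B - b), and similarly
  -- for the difference.
  *-≤± : ∀ {a b A B} → a ≤± A → b ≤± B → a * b ≤± A * B
  *-≤± {a} {b} {A} {B} (a₁ , a₂) (b₁ , b₂) =
    *-cancel-0≤ 2>0 (subst (0ℚ ≤_) (e₁ a b A B) (0≤+ (0≤* a₁ b₁) (0≤* a₂ b₂))) ,
    *-cancel-0≤ 2>0 (subst (0ℚ ≤_) (e₂ a b A B) (0≤+ (0≤* a₁ b₂) (0≤* a₂ b₁)))
    where
    e₁ : ∀ a b A B → (A + a) * (B + b) + (A - a) * (B - b) ≡ ι (+ 2) * (A * B + a * b)
    e₁ = solve-∀ ℚ-ring
    e₂ : ∀ a b A B → (A + a) * (B - b) + (A - a) * (B + b) ≡ ι (+ 2) * (A * B - a * b)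
    e₂ = solve-∀ ℚ-ring

  neg-≤± : ∀ {a A} → a ≤± A → - a ≤± A
  neg-≤± {a} {A} (a₁ , a₂) = a₂ , subst (0ℚ ≤_) (e a A) a₁
    where
    e : ∀ a A → A + a ≡ A - - a
    e = solve-∀ ℚ-ring

  0≤⇒self-≤± : ∀ {a} → 0ℚ ≤ a → a ≤± a
  0≤⇒self-≤± {a} 0≤a = 0≤+ 0≤a 0≤a , ≤-reflexive (sym (+-inverseʳ a))

  ≤±-weaken : ∀ {a A B} → a ≤± A → 0ℚ ≤ B - A → a ≤± B
  ≤±-weaken {a} {A} {B} (a₁ , a₂) A≤B = subst (0ℚ ≤_) (e₁ a A B) (0≤+ A≤B a₁) , subst (0ℚ ≤_) (e₂ a A B) (0≤+ A≤B a₂)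
    where
    e₁ : ∀ a A B → (B - A) + (A + a) ≡ B + a
    e₁ = solve-∀ ℚ-ring
    e₂ : ∀ a A B → (B - A) + (A - a) ≡ B - a
    e₂ = solve-∀ ℚ-ring

  -- With f = J x - W the difference of squares factors as - f (2 J x - f).
  □-rounding : ∀ {J x W} → 0ℚ ≤ J → x ≤± 2ℚ → J * x - W ≤± 1ℚ →
               W * W - J * J * (x * x) ≤± 4ℚ * J + 1ℚ
  □-rounding {J} {x} {W} 0≤J x≤2 f≤1 = subst₂ _≤±_ (e₁ J x W) (e₂ J)
    (*-≤± (neg-≤± f≤1) (+-≤± (*-≤± (0≤⇒self-≤± (0≤* (<⇒≤ 2>0) 0≤J)) x≤2) (neg-≤± f≤1)))
    where
    e₁ : ∀ J x W → - (J * x - W) * (ι (+ 2) * J * x + - (J * x - W)) ≡ W * W - J * J * (x * x)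
    e₁ = solve-∀ ℚ-ring
    e₂ : ∀ J → 1ℚ * (ι (+ 2) * J * ι (+ 2) + 1ℚ) ≡ ι (+ 4) * J + 1ℚ
    e₂ = solve-∀ ℚ-ring

  sumsq-rounding : ∀ {d} (x : Vector ℚ d) (W : Vector ℤ d) {J} → 0ℚ ≤ J → (∀ j → x j ≤± 2ℚ) →
    (∀ j → J * x j - ι (W j) ≤± 1ℚ) → ι (W · W) - J * J * sumsq x ≤± ι (+ d) * (4ℚ * J + 1ℚ)
  sumsq-rounding {zero} x W {J} _ _ _ = subst₂ _≤±_ (e₁ J) (e₂ J) (0≤⇒self-≤± {0ℚ} ≤-refl)
    where
    e₁ : ∀ J → 0ℚ ≡ 0ℚ - J * J * 0ℚ
    e₁ = solve-∀ ℚ-ring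
    e₂ : ∀ J → 0ℚ ≡ 0ℚ * (ι (+ 4) * J + 1ℚ)
    e₂ = solve-∀ ℚ-ring
  sumsq-rounding {suc d} x W {J} 0≤J x≤2 f≤1 = subst₂ _≤±_
    (trans (e₁ (ι (W zero)) J (x zero) (ι (tail W · tail W)) (sumsq (tail x)))
      (cong (_- J * J * sumsq x) (sym (trans (ι-+ (W zero ℤ.* W zero) (tail W · tail W))
        (cong (_+ ι (tail W · tail W)) (ι-* (W zero) (W zero)))))))
    (trans (e₂ (ι (+ d)) J) (cong (_* (4ℚ * J + 1ℚ)) (sym (ι-+ ℤ.1ℤ (+ d)))))
    (+-≤± (□-rounding 0≤J (x≤2 zero) (f≤1 zero))
          (sumsq-rounding (tail x) (tail W) 0≤J (λ j → x≤2 (suc j)) (λ j → f≤1 (suc j))))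
    where
    e₁ : ∀ w J x ww s → (w * w - J * J * (x * x)) + (ww - J * J * s) ≡ w * w + ww - J * J * (x * x + s)
    e₁ = solve-∀ ℚ-ring
    e₂ : ∀ d J → (ι (+ 4) * J + 1ℚ) + d * (ι (+ 4) * J + 1ℚ) ≡ (1ℚ + d) * (ι (+ 4) * J + 1ℚ)
    e₂ = solve-∀ ℚ-ring

  -- The tolerance 1 / (2 k²) on |x|² is chosen so that multiplication by J² ≤ t² k⁴ leaves an error
  -- of at most t² k² / 2.
  NearSphere : ∀ {d} → ℚ → Vector ℚ d → Set
  NearSphere k x = 2ℚ * (k * k) * (sumsq x - 1ℚ) ≤± 1ℚ

  nearSphere-bounded : ∀ {d k} (x : Vector ℚ d) → 1ℚ ≤ k → NearSphere k x → ∀ j → x j ≤± 2ℚ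
  nearSphere-bounded {k = k} x 1≤k (_ , near) j = □≤⇒≤± (<⇒≤ 2>0) (≤-trans (□≤sumsq x j)
    (0≤⇒≤ (*-cancel-0≤ {2ℚ * (k * k)} 2k²>0 (subst (0ℚ ≤_) (e k (sumsq x))
      (0≤+ near (0≤+ (0≤* (0≤ℕ 6) (0≤+ (0≤* 0≤k k-1≥0) k-1≥0)) (0≤ℕ 5))))) refl))
    where
    k-1≥0 = ≤⇒0≤ 1≤k
    0≤k = ≤-trans (nonNegative⁻¹ 1ℚ) 1≤k
    0<k = <-≤-trans (positive⁻¹ 1ℚ) 1≤k
    2k²>0 : 0ℚ < 2ℚ * (k * k)
    2k²>0 = positive⁻¹ (2ℚ * (k * k)) {{pos*pos⇒pos 2ℚ (k * k) {{pos*pos⇒pos k {{positive 0<k}} k {{positive 0<k}}}}}}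
    e : ∀ k Q → 1ℚ - ι (+ 2) * (k * k) * (Q - 1ℚ) + (ι (+ 6) * (k * (k - 1ℚ) + (k - 1ℚ)) + ι (+ 5)) ≡
        ι (+ 2) * (k * k) * (ι (+ 2) * ι (+ 2) - Q)
    e = solve-∀ ℚ-ring

  -- Leaving the sphere costs at most t² k² / 2. Rounding costs at most d (4 J + 1) ≤ 5 d D, which
  -- is again t² k² / 2 because t = 10 d: this fixes the scale t. The sum is t² k² ≤ t² S² k².
  norm-estimate : ∀ {d k S Q ww} → let t = ι (+ 10) * d ; D = t * (k * k) ; J = t * (k * k - ι (+ 8) * (S * S)) in
    0ℚ < k → 0ℚ ≤ d → 1ℚ ≤ D → 1ℚ ≤ S * S → 0ℚ ≤ J →
    2ℚ * (k * k) * (Q - 1ℚ) ≤± 1ℚ → ww - J * J * Q ≤± d * (4ℚ * J + 1ℚ) →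
    ww - J * J ≤± t * t * (S * S) * (k * k)
  norm-estimate {d} {k} {S} {Q} {ww} 0<k 0≤d 1≤D 1≤S² 0≤J (Q₁ , Q₂) (w₁ , w₂) =
    *-cancel-0≤ 2k²>0 (subst (0ℚ ≤_) (e₁ d k S Q ww) (0≤+ (0≤+ (0≤* 2k²≥0 w₁) (0≤* (0≤□ J) Q₁)) rest)) ,
    *-cancel-0≤ 2k²>0 (subst (0ℚ ≤_) (e₂ d k S Q ww) (0≤+ (0≤+ (0≤* 2k²≥0 w₂) (0≤* (0≤□ J) Q₂)) rest))
    where
    t = ι (+ 10) * d
    D = t * (k * k)
    J = t * (k * k - ι (+ 8) * (S * S))
    2k²>0 : 0ℚ < 2ℚ * (k * k)
    2k²>0 = positive⁻¹ (2ℚ * (k * k)) {{pos*pos⇒pos 2ℚ (k * k) {{pos*pos⇒pos k {{positive 0<k}} k {{positive 0<k}}}}}}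
    2k²≥0 = <⇒≤ 2k²>0
    D≥0 = ≤-trans (nonNegative⁻¹ 1ℚ) 1≤D
    8tS²≥0 : 0ℚ ≤ ι (+ 8) * (t * (S * S))
    8tS²≥0 = 0≤* (0≤ℕ 8) (0≤* (0≤* (0≤ℕ 10) 0≤d) (0≤□ S))
    rest : 0ℚ ≤ 2ℚ * (D * D) * (S * S - 1ℚ) + 2ℚ * (k * k) * d * (4ℚ * (ι (+ 8) * (t * (S * S))) + (D - 1ℚ))
                + ι (+ 8) * (t * (S * S)) * (D + J)
    rest = 0≤+ (0≤+ (0≤* (0≤* (<⇒≤ 2>0) (0≤□ D)) (≤⇒0≤ 1≤S²))
                    (0≤* (0≤* 2k²≥0 0≤d) (0≤+ (0≤* (0≤ℕ 4) 8tS²≥0) (≤⇒0≤ 1≤D))))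
               (0≤* 8tS²≥0 (0≤+ D≥0 0≤J))
    e₁ : ∀ d k S Q ww → let t = ι (+ 10) * d ; D = t * (k * k) ; J = t * (k * k - ι (+ 8) * (S * S)) in
      ι (+ 2) * (k * k) * (d * (ι (+ 4) * J + 1ℚ) + (ww - J * J * Q)) + J * J * (1ℚ + ι (+ 2) * (k * k) * (Q - 1ℚ))
      + (ι (+ 2) * (D * D) * (S * S - 1ℚ) + ι (+ 2) * (k * k) * d * (ι (+ 4) * (ι (+ 8) * (t * (S * S))) + (D - 1ℚ))
                + ι (+ 8) * (t * (S * S)) * (D + J))
      ≡ ι (+ 2) * (k * k) * (t * t * (S * S) * (k * k) + (ww - J * J))
    e₁ = solve-∀ ℚ-ring
    e₂ : ∀ d k S Q ww → let t = ι (+ 10) * d ; D = t * (k * k) ; J = t * (k * k - ι (+ 8) * (S * S)) in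
      ι (+ 2) * (k * k) * (d * (ι (+ 4) * J + 1ℚ) - (ww - J * J * Q)) + J * J * (1ℚ - ι (+ 2) * (k * k) * (Q - 1ℚ))
      + (ι (+ 2) * (D * D) * (S * S - 1ℚ) + ι (+ 2) * (k * k) * d * (ι (+ 4) * (ι (+ 8) * (t * (S * S))) + (D - 1ℚ))
                + ι (+ 8) * (t * (S * S)) * (D + J))
      ≡ ι (+ 2) * (k * k) * (t * t * (S * S) * (k * k) - (ww - J * J))
    e₂ = solve-∀ ℚ-ring

  -- Split D (x′ - A) = U + V with U = D x′ - W and V = W - D A, and use (U + V)² ≤ 2 U² + 2 V².
  -- Here |U| ≤ t k + 16 S² t + 1 ≤ 18 S² t k, and V² q ≤ 12 S² t² k³ by `near`. With q ≤ k the two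
  -- parts give 2 · 18² = 648 and 2 · 12 = 24, which add up to 672.
  final-estimate : ∀ {q k S t x x′ W p A} → let D = t * (k * k) ; J = t * (k * k - ι (+ 8) * (S * S)) in
    0ℚ < q → q ≤ k → 1ℚ ≤ k → 1ℚ ≤ t → 1ℚ ≤ S * S → k * (x′ - x) ≤± 1ℚ → x ≤± 2ℚ → J * x - W ≤± 1ℚ →
    A * q ≡ p → (W * q - p * D) * (W * q - p * D) ≤ ι (+ 12) * q * (S * S * (t * t) * (k * k * k)) →
    q * k * ((x′ - A) * (x′ - A)) ≤ ι (+ 672) * (S * S * (S * S))
  final-estimate {q} {k} {S} {t} {x} {x′} {W} {_} {A} 0<q q≤k 1≤k 1≤t 1≤S² x′-x x≤2 f≤1 refl near =
    0≤⇒≤ (*-cancel-0≤ D²>0 (subst (0ℚ ≤_) (eq q k S t x x′ W A)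
      (0≤+ (0≤+ (0≤* 0≤qk (0≤□ (U - V))) (0≤* (0≤* (<⇒≤ 2>0) 0≤qk) (≤⇒0≤ (≤±⇒□≤ U≤B))))
           (0≤+ (0≤* (0≤* (<⇒≤ 2>0) 0≤k) V-bound)
                (0≤+ (0≤* (0≤* (0≤ℕ 648) (0≤* (0≤* (0≤□ (S * S)) (0≤□ t)) (0≤* (0≤* 0≤k 0≤k) 0≤k))) (≤⇒0≤ q≤k))
                     (0≤* (0≤* (0≤ℕ 24) (0≤* (0≤* (0≤□ S) (0≤□ t)) (0≤* (0≤* 0≤k 0≤k) (0≤* 0≤k 0≤k)))) S²-1)))))) refl
    where
    D = t * (k * k)
    J = t * (k * k - ι (+ 8) * (S * S))
    U = t * k * (k * (x′ - x)) + ι (+ 8) * (S * S * t) * x + (J * x - W)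
    V = W - D * A
    B = ι (+ 18) * (S * S) * t * k
    0<k = <-≤-trans 0<q q≤k
    0≤k = <⇒≤ 0<k
    0≤q = <⇒≤ 0<q
    0≤t = ≤-trans (nonNegative⁻¹ 1ℚ) 1≤t
    0<t = <-≤-trans (positive⁻¹ 1ℚ) 1≤t
    0≤qk = 0≤* 0≤q 0≤k
    S²-1 = ≤⇒0≤ 1≤S²
    0<* : ∀ {a b} → 0ℚ < a → 0ℚ < b → 0ℚ < a * b
    0<* {a} {b} 0<a 0<b = positive⁻¹ (a * b) {{pos*pos⇒pos a {{positive 0<a}} b {{positive 0<b}}}}
    D²>0 : 0ℚ < D * D
    D²>0 = 0<* (0<* 0<t (0<* 0<k 0<k)) (0<* 0<t (0<* 0<k 0<k))
    U≤B : U ≤± B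
    U≤B = ≤±-weaken (+-≤± (+-≤± (*-≤± (0≤⇒self-≤± (0≤* 0≤t 0≤k)) x′-x)
                                (*-≤± (0≤⇒self-≤± (0≤* (0≤ℕ 8) (0≤* (0≤□ S) 0≤t))) x≤2)) f≤1)
      (subst (0ℚ ≤_) (e S t k)
        (0≤+ (0≤+ (0≤* (0≤* (<⇒≤ 2>0) (0≤* 0≤t 0≤k)) S²-1)
                  (0≤* (0≤* (0≤ℕ 16) (0≤* (0≤□ S) 0≤t)) (≤⇒0≤ 1≤k)))
             (0≤+ (0≤* 0≤t (≤⇒0≤ 1≤k)) (≤⇒0≤ 1≤t))))
      where
      e : ∀ S t k → ι (+ 2) * (t * k) * (S * S - 1ℚ) + ι (+ 16) * (S * S * t) * (k - 1ℚ) + (t * (k - 1ℚ) + (t - 1ℚ)) ≡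
        ι (+ 18) * (S * S) * t * k - (t * k * 1ℚ + ι (+ 8) * (S * S * t) * ι (+ 2) + 1ℚ)
      e = solve-∀ ℚ-ring
    V-bound : 0ℚ ≤ ι (+ 12) * (S * S * (t * t) * (k * k * k)) - V * V * q
    V-bound = *-cancel-0≤ 0<q (subst (0ℚ ≤_) (e q k S t W A) (≤⇒0≤ near))
      where
      e : ∀ q k S t W A → ι (+ 12) * q * (S * S * (t * t) * (k * k * k))
        - (W * q - A * q * (t * (k * k))) * (W * q - A * q * (t * (k * k))) ≡
        q * (ι (+ 12) * (S * S * (t * t) * (k * k * k)) - (W - t * (k * k) * A) * (W - t * (k * k) * A) * q)
      e = solve-∀ ℚ-ring
    eq : ∀ q k S t x x′ W A →
      let D = t * (k * k) ; J = t * (k * k - ι (+ 8) * (S * S))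
          U = t * k * (k * (x′ - x)) + ι (+ 8) * (S * S * t) * x + (J * x - W)
          V = W - D * A ; B = ι (+ 18) * (S * S) * t * k in
      q * k * ((U - V) * (U - V)) + ι (+ 2) * (q * k) * (B * B - U * U)
      + (ι (+ 2) * k * (ι (+ 12) * (S * S * (t * t) * (k * k * k)) - V * V * q)
        + (ι (+ 648) * (S * S * (S * S) * (t * t) * (k * k * k)) * (k - q)
          + ι (+ 24) * (S * S * (t * t) * (k * k * (k * k))) * (S * S - 1ℚ)))
      ≡ D * D * (ι (+ 672) * (S * S * (S * S)) - q * k * ((x′ - A) * (x′ - A)))
    eq = solve-∀ ℚ-ring

  -- The bound is demanded for every x′ within 1 / k of a coordinate of x, so that one point p/q
  -- serves all later approximations of a real vector.
  RationalApproximation : ∀ {d} → ℕ → ℕ → Vector ℚ d → Set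
  RationalApproximation {d} S k x = Σ[ p ∈ Vector ℤ d ] Σ[ q ∈ ℕ ] Σ[ q≢0 ∈ ℕ.NonZero q ]
    p · p ≡ + q ℤ.* + q × q ℕ.≤ k ×
    (∀ x′ j → ι (+ k) * (x′ - x j) ≤± 1ℚ → x′ ≤± 2ℚ →
      ι (+ q) * ι (+ k) * ((x′ - (p j / q) {{q≢0}}) * (x′ - (p j / q) {{q≢0}}))
      ≤ ι (+ 672) * (ι (+ S) * ι (+ S) * (ι (+ S) * ι (+ S))))

  1≤ι : ∀ k → 1 ℕ.≤ k → 1ℚ ≤ ι (+ k)
  1≤ι k 1≤k = ι-mono-≤ {+ 1} {+ k} (ℤ.+≤+ 1≤k)

  1≤* : ∀ {a b} → 1ℚ ≤ a → 1ℚ ≤ b → 1ℚ ≤ a * b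
  1≤* {a} {b} 1≤a 1≤b = 0≤⇒≤ (0≤+ (0≤* (≤⇒0≤ 1≤a) (≤-trans (nonNegative⁻¹ 1ℚ) 1≤b)) (≤⇒0≤ 1≤b)) (e a b)
    where
    e : ∀ a b → a * b - 1ℚ ≡ (a - 1ℚ) * b + (b - 1ℚ)
    e = solve-∀ ℚ-ring

  -- For k ≤ 8 S the fixed point (1, 0, ..., 0) with denominator 1 is good enough: the coordinates
  -- differ by at most 3, and 9 k ≤ 72 S ≤ 672 S⁴.
  small-scale : ∀ {n} S k → 1 ℕ.≤ S → 1 ℕ.≤ k → k ℕ.≤ 8 ℕ.* S → (x : Vector ℚ (suc n)) →
                RationalApproximation S k x
  small-scale {n} S k 1≤S 1≤k k≤8S x = p , 1 , _ , cong (λ a → + 1 ℤ.+ a) (·-zeroʳ {n} (λ _ → + 0) (λ _ → refl)) , 1≤k ,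
    λ x′ j _ x′≤2 → bound (ι (+ k)) (ι (+ S)) (0≤ℕ k) (1≤ι S 1≤S) k≤8S′ (x′ - ι (p j)) (within x′ j x′≤2)
    where
    p : Vector ℤ (suc n)
    p = + 1 ∷ λ _ → + 0
    p≤1 : ∀ j → ι (p j) ≤± 1ℚ
    p≤1 zero    = nonNegative⁻¹ _ , nonNegative⁻¹ _
    p≤1 (suc j) = nonNegative⁻¹ _ , nonNegative⁻¹ _
    within : ∀ x′ j → x′ ≤± 2ℚ → x′ - ι (p j) ≤± ι (+ 3)
    within x′ j x′≤2 = +-≤± x′≤2 (neg-≤± (p≤1 j))
    k≤8S′ : ι (+ k) ≤ ι (+ 8) * ι (+ S)
    k≤8S′ = subst (ι (+ k) ≤_) (trans (cong ι (ℤ.pos-* 8 S)) (ι-* (+ 8) (+ S))) (ι-mono-≤ {+ k} (ℤ.+≤+ k≤8S))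
    bound : ∀ k S → 0ℚ ≤ k → 1ℚ ≤ S → k ≤ ι (+ 8) * S → ∀ y → y ≤± ι (+ 3) →
            ι (+ 1) * k * (y * y) ≤ ι (+ 672) * (S * S * (S * S))
    bound k S 0≤k 1≤S k≤8S y y≤3 = 0≤⇒≤ (0≤+ (0≤+ (0≤* 0≤k (≤⇒0≤ (≤±⇒□≤ y≤3))) (0≤* (0≤ℕ 9) (≤⇒0≤ k≤8S)))
      (0≤+ (0≤* (0≤ℕ 72) (0≤+ (0≤* 0≤S (≤⇒0≤ 1≤S)) (0≤* (0≤□ S) (≤⇒0≤ (1≤* 1≤S 1≤S)))))
           (0≤* (0≤ℕ 600) (0≤□ (S * S))))) (e k S y)
      where
      0≤S = ≤-trans (nonNegative⁻¹ 1ℚ) 1≤S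
      e : ∀ k S y → ι (+ 672) * (S * S * (S * S)) - ι (+ 1) * k * (y * y) ≡
        k * (ι (+ 3) * ι (+ 3) - y * y) + ι (+ 9) * (ι (+ 8) * S - k)
        + (ι (+ 72) * (S * (S - 1ℚ) + S * S * (S * S - 1ℚ)) + ι (+ 600) * (S * S * (S * S)))
      e = solve-∀ ℚ-ring

  -- The timelike vector is (W, D) with W the rounding of D (1 - 8 S² / k²) x: then ⟨w, w⟩ / D² is about
  -- 16 S² / k², which is what makes the descent bound give q ≤ k.
  module LargeScale {n} .{{_ : ℕ.NonZero n}} (S₀ : ℕ) (S> : cellBound n ℕ.< S₀) (k₀ : ℕ)
    (8S≤k : 8 ℕ.* S₀ ℕ.≤ k₀) (x : Vector ℚ (suc n)) (near : NearSphere (ι (+ k₀)) x) where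

    1≤S₀ : 1 ℕ.≤ S₀
    1≤S₀ = ℕ.≤-<-trans ℕ.z≤n S>
    1≤k₀ : 1 ℕ.≤ k₀
    1≤k₀ = ℕ.≤-trans 1≤S₀ (ℕ.≤-trans (ℕ.m≤m+n S₀ (7 ℕ.* S₀)) 8S≤k)

    Sᶻ kᶻ tᶻ Dᶻ Jᶻ Xᶻ : ℤ
    Sᶻ = + S₀
    kᶻ = + k₀
    tᶻ = + 10 ℤ.* + suc n
    Dᶻ = tᶻ ℤ.* (kᶻ ℤ.* kᶻ)
    Jᶻ = tᶻ ℤ.* (kᶻ ℤ.* kᶻ ℤ.- + 8 ℤ.* (Sᶻ ℤ.* Sᶻ))
    Xᶻ = tᶻ ℤ.* tᶻ ℤ.* (Sᶻ ℤ.* Sᶻ) ℤ.* (kᶻ ℤ.* kᶻ)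

    S k d t D J : ℚ
    S = ι Sᶻ
    k = ι kᶻ
    d = ι (+ suc n)
    t = ι (+ 10) * d
    D = t * (k * k)
    J = t * (k * k - ι (+ 8) * (S * S))

    t≡ : ι tᶻ ≡ t
    t≡ = ι-* (+ 10) (+ suc n)
    D≡ : ι Dᶻ ≡ D
    D≡ = trans (ι-* tᶻ (kᶻ ℤ.* kᶻ)) (cong₂ _*_ t≡ (ι-* kᶻ kᶻ))
    J≡ : ι Jᶻ ≡ J
    J≡ = trans (ι-* tᶻ (kᶻ ℤ.* kᶻ ℤ.- + 8 ℤ.* (Sᶻ ℤ.* Sᶻ))) (cong₂ _*_ t≡
      (trans (ι-- (kᶻ ℤ.* kᶻ) (+ 8 ℤ.* (Sᶻ ℤ.* Sᶻ))) (cong₂ _-_ (ι-* kᶻ kᶻ)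
        (trans (ι-* (+ 8) (Sᶻ ℤ.* Sᶻ)) (cong (ι (+ 8) *_) (ι-* Sᶻ Sᶻ))))))
    X≡ : ι Xᶻ ≡ t * t * (S * S) * (k * k)
    X≡ = trans (ι-* (tᶻ ℤ.* tᶻ ℤ.* (Sᶻ ℤ.* Sᶻ)) (kᶻ ℤ.* kᶻ)) (cong₂ _*_
      (trans (ι-* (tᶻ ℤ.* tᶻ) (Sᶻ ℤ.* Sᶻ)) (cong₂ _*_ (trans (ι-* tᶻ tᶻ) (cong₂ _*_ t≡ t≡)) (ι-* Sᶻ Sᶻ)))
      (ι-* kᶻ kᶻ))

    1≤t : 1ℚ ≤ t
    1≤t = 1≤* (1≤ι 10 (ℕ.s≤s ℕ.z≤n)) (1≤ι (suc n) (ℕ.s≤s ℕ.z≤n))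
    1≤k : 1ℚ ≤ k
    1≤k = 1≤ι k₀ 1≤k₀
    0<k : 0ℚ < k
    0<k = <-≤-trans (positive⁻¹ 1ℚ) 1≤k
    1≤S : 1ℚ ≤ S
    1≤S = 1≤ι S₀ 1≤S₀

    0≤k-8S : ℤ.0ℤ ℤ.≤ kᶻ ℤ.- + 8 ℤ.* Sᶻ
    0≤k-8S = ℤᵒ.≤⇒0≤ (subst (ℤ._≤ kᶻ) (ℤ.pos-* 8 S₀) (ℤ.+≤+ 8S≤k))

    0≤k²-64S² : ℤ.0ℤ ℤ.≤ kᶻ ℤ.* kᶻ ℤ.- + 64 ℤ.* (Sᶻ ℤ.* Sᶻ)
    0≤k²-64S² = subst (ℤ.0ℤ ℤ.≤_) (e kᶻ Sᶻ)
      (ℤᵒ.0≤* 0≤k-8S (ℤᵒ.0≤+ (ℤᵒ.0≤+ℕ {k₀}) (ℤᵒ.0≤* {+ 8} {Sᶻ} ℤᵒ.0≤+ℕ ℤᵒ.0≤+ℕ)))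
      where
      e : ∀ k S → (k ℤ.- + 8 ℤ.* S) ℤ.* (k ℤ.+ + 8 ℤ.* S) ≡ k ℤ.* k ℤ.- + 64 ℤ.* (S ℤ.* S)
      e = ℤ.solve-∀

    0≤tᶻ : ℤ.0ℤ ℤ.≤ tᶻ
    0≤tᶻ = ℤᵒ.0≤* {+ 10} {+ suc n} ℤᵒ.0≤+ℕ ℤᵒ.0≤+ℕ

    0≤J : 0ℚ ≤ J
    0≤J = subst (0ℚ ≤_) J≡ (0≤ι {Jᶻ} (ℤᵒ.0≤* 0≤tᶻ (subst (ℤ.0ℤ ℤ.≤_) (e kᶻ Sᶻ)
      (ℤᵒ.0≤+ 0≤k²-64S² (ℤᵒ.0≤* {+ 56} {Sᶻ ℤ.* Sᶻ} ℤᵒ.0≤+ℕ (ℤᵒ.0≤□ Sᶻ))))))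
      where
      e : ∀ k S → k ℤ.* k ℤ.- + 64 ℤ.* (S ℤ.* S) ℤ.+ + 56 ℤ.* (S ℤ.* S) ≡ k ℤ.* k ℤ.- + 8 ℤ.* (S ℤ.* S)
      e = ℤ.solve-∀

    W : Vector ℤ (suc n)
    W j = proj₁ (floor-bounds (J * x j))

    rounding : ∀ j → J * x j - ι (W j) ≤± 1ℚ
    rounding j = let 0≤f , f≤1 = proj₂ (floor-bounds (J * x j)) in 0≤+ (nonNegative⁻¹ 1ℚ) 0≤f , f≤1

    x≤2 : ∀ j → x j ≤± 2ℚ
    x≤2 = nearSphere-bounded x 1≤k near

    estimate : ι (W · W) - J * J ≤± t * t * (S * S) * (k * k)
    estimate = norm-estimate {d} {k} {S} {sumsq x} {ι (W · W)} 0<k (0≤ℕ (suc n)) (1≤* 1≤t (1≤* 1≤k 1≤k))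
      (1≤* 1≤S 1≤S) 0≤J near (sumsq-rounding x W 0≤J x≤2 rounding)

    WJ≡ : ι (W · W) - J * J ≡ ι (W · W ℤ.- Jᶻ ℤ.* Jᶻ)
    WJ≡ = sym (trans (ι-- (W · W) (Jᶻ ℤ.* Jᶻ)) (cong (λ a → ι (W · W) - a) (trans (ι-* Jᶻ Jᶻ) (cong₂ _*_ J≡ J≡))))

    estimate₁ : ℤ.0ℤ ℤ.≤ Xᶻ ℤ.+ (W · W ℤ.- Jᶻ ℤ.* Jᶻ)
    estimate₁ = ι-cancel-≤ {ℤ.0ℤ} {Xᶻ ℤ.+ (W · W ℤ.- Jᶻ ℤ.* Jᶻ)} (subst (0ℚ ≤_)
      (trans (cong₂ _+_ (sym X≡) WJ≡) (sym (ι-+ Xᶻ (W · W ℤ.- Jᶻ ℤ.* Jᶻ)))) (lower estimate))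
    estimate₂ : ℤ.0ℤ ℤ.≤ Xᶻ ℤ.- (W · W ℤ.- Jᶻ ℤ.* Jᶻ)
    estimate₂ = ι-cancel-≤ {ℤ.0ℤ} {Xᶻ ℤ.- (W · W ℤ.- Jᶻ ℤ.* Jᶻ)} (subst (0ℚ ≤_)
      (trans (cong₂ _-_ (sym X≡) WJ≡) (sym (ι-- Xᶻ (W · W ℤ.- Jᶻ ℤ.* Jᶻ)))) (upper estimate))

    -- D² - J² = 16 X - 64 t² S⁴, and k ≥ 8 S makes the last term at most X. Replacing J² by W · W
    -- costs at most another X, so ⟨w, w⟩ lies between 14 X and 17 X.
    Δ-lower : + 14 ℤ.* Xᶻ ℤ.≤ ⟨ (W , Dᶻ) , (W , Dᶻ) ⟩
    Δ-lower = ℤᵒ.0≤⇒≤ (ℤᵒ.0≤+ estimate₂ (ℤᵒ.0≤* (ℤᵒ.0≤* (ℤᵒ.0≤□ tᶻ) (ℤᵒ.0≤□ Sᶻ)) 0≤k²-64S²))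
      (e tᶻ Sᶻ kᶻ (W · W))
      where
      e : ∀ t S k WW → t ℤ.* (k ℤ.* k) ℤ.* (t ℤ.* (k ℤ.* k)) ℤ.- WW
          ℤ.- + 14 ℤ.* (t ℤ.* t ℤ.* (S ℤ.* S) ℤ.* (k ℤ.* k)) ≡
        t ℤ.* t ℤ.* (S ℤ.* S) ℤ.* (k ℤ.* k) ℤ.- (WW ℤ.- t ℤ.* (k ℤ.* k ℤ.- + 8 ℤ.* (S ℤ.* S)) ℤ.* (t ℤ.* (k ℤ.* k ℤ.- + 8 ℤ.* (S ℤ.* S))))
        ℤ.+ t ℤ.* t ℤ.* (S ℤ.* S) ℤ.* (k ℤ.* k ℤ.- + 64 ℤ.* (S ℤ.* S))
      e = ℤ.solve-∀

    Δ-upper : ⟨ (W , Dᶻ) , (W , Dᶻ) ⟩ ℤ.≤ + 17 ℤ.* Xᶻ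
    Δ-upper = ℤᵒ.0≤⇒≤ (ℤᵒ.0≤+ estimate₁ (ℤᵒ.0≤* {+ 64} ℤᵒ.0≤+ℕ (ℤᵒ.0≤* (ℤᵒ.0≤□ tᶻ) (ℤᵒ.0≤□ (Sᶻ ℤ.* Sᶻ)))))
      (e tᶻ Sᶻ kᶻ (W · W))
      where
      e : ∀ t S k WW → + 17 ℤ.* (t ℤ.* t ℤ.* (S ℤ.* S) ℤ.* (k ℤ.* k))
          ℤ.- (t ℤ.* (k ℤ.* k) ℤ.* (t ℤ.* (k ℤ.* k)) ℤ.- WW) ≡
        t ℤ.* t ℤ.* (S ℤ.* S) ℤ.* (k ℤ.* k) ℤ.+ (WW ℤ.- t ℤ.* (k ℤ.* k ℤ.- + 8 ℤ.* (S ℤ.* S)) ℤ.* (t ℤ.* (k ℤ.* k ℤ.- + 8 ℤ.* (S ℤ.* S))))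
        ℤ.+ + 64 ℤ.* (t ℤ.* t ℤ.* (S ℤ.* S ℤ.* (S ℤ.* S)))
      e = ℤ.solve-∀

    conclude : Approximation Sᶻ tᶻ kᶻ W → RationalApproximation S₀ k₀ x
    conclude (p , q , q≢0 , p·p≡q² , q≤k , close) = p , q , q≢0 , p·p≡q² , ℤ.drop‿+≤+ q≤k , λ x′ j x′-x _ →
      final-estimate {ι (+ q)} {k} {S} {t} {x j} {x′} {ι (W j)} {ι (p j)} {(p j / q) {{q≢0}}}
        (0<ι {+ q} (ℤ.+<+ (ℕ.>-nonZero⁻¹ q {{q≢0}}))) (ι-mono-≤ q≤k) 1≤k 1≤t (1≤* 1≤S 1≤S) x′-x (x≤2 j) (rounding j)
        (/-*-cancel (p j) q {{q≢0}})
        (subst₂ _≤_ (trans (ι-* (V j) (V j)) (cong₂ _*_ (V≡ j) (V≡ j))) bound≡ (ι-mono-≤ (close j)))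
      where
      V : Vector ℤ (suc n)
      V j = W j ℤ.* + q ℤ.- p j ℤ.* Dᶻ
      V≡ : ∀ j → ι (V j) ≡ ι (W j) * ι (+ q) - ι (p j) * D
      V≡ j = trans (ι-- (W j ℤ.* + q) (p j ℤ.* Dᶻ)) (cong₂ _-_ (ι-* (W j) (+ q))
        (trans (ι-* (p j) Dᶻ) (cong (ι (p j) *_) D≡)))
      bound≡ : ι (+ 12 ℤ.* + q ℤ.* (Sᶻ ℤ.* Sᶻ ℤ.* (tᶻ ℤ.* tᶻ) ℤ.* (kᶻ ℤ.* kᶻ ℤ.* kᶻ))) ≡
               ι (+ 12) * ι (+ q) * (S * S * (t * t) * (k * k * k))
      bound≡ = trans (ι-* (+ 12 ℤ.* + q) (Sᶻ ℤ.* Sᶻ ℤ.* (tᶻ ℤ.* tᶻ) ℤ.* (kᶻ ℤ.* kᶻ ℤ.* kᶻ))) (cong₂ _*_ (ι-* (+ 12) (+ q))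
        (trans (ι-* (Sᶻ ℤ.* Sᶻ ℤ.* (tᶻ ℤ.* tᶻ)) (kᶻ ℤ.* kᶻ ℤ.* kᶻ)) (cong₂ _*_
          (trans (ι-* (Sᶻ ℤ.* Sᶻ) (tᶻ ℤ.* tᶻ)) (cong₂ _*_ (ι-* Sᶻ Sᶻ) (trans (ι-* tᶻ tᶻ) (cong₂ _*_ t≡ t≡))))
          (trans (ι-* (kᶻ ℤ.* kᶻ) kᶻ) (cong (_* k) (ι-* kᶻ kᶻ))))))

    0<tᶻ : ℤ.0ℤ ℤ.< tᶻ
    0<tᶻ = ℤᵒ.0<* {+ 10} {+ suc n} (ℤ.+<+ (ℕ.s≤s ℕ.z≤n)) (ℤ.+<+ (ℕ.s≤s ℕ.z≤n))

    large-scale : RationalApproximation S₀ k₀ x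
    large-scale = conclude (approximation S₀ S> tᶻ kᶻ 0<tᶻ (ℤ.+<+ 1≤k₀) W Δ-lower Δ-upper)

  rational-approximation : ∀ {n} .{{_ : ℕ.NonZero n}} S → cellBound n ℕ.< S → ∀ k → 1 ℕ.≤ k →
    (x : Vector ℚ (suc n)) → NearSphere (ι (+ k)) x → RationalApproximation S k x
  rational-approximation S S> k 1≤k x near = by-scale (ℕ.≤-total k (8 ℕ.* S))
    where
    by-scale : k ℕ.≤ 8 ℕ.* S ⊎ 8 ℕ.* S ℕ.≤ k → RationalApproximation S k x
    by-scale (inj₁ k≤8S) = small-scale S k (ℕ.≤-<-trans ℕ.z≤n S>) 1≤k k≤8S x
    by-scale (inj₂ 8S≤k) = LargeScale.large-scale S S> k 8S≤k x near

open import Defs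
open import Data.Nat.Base using (ℕ; suc; _≥_)
open import Data.Product.Base using (Σ-syntax)
open import Data.Vec.Functional using (Vector)
open import Relation.Unary using (_∈_)

-- Passage from rational approximations to the reals α and N

module RealApproximation where
  open import Data.Empty using (⊥-elim)
  open import Data.Fin.Base using (zero; suc)
  open import Data.Integer.Base as ℤ using (ℤ; +_; +[1+_])
  import Data.Integer.Properties as ℤ
  open import Data.Nat.Base as ℕ using (zero)
  import Data.Nat.Properties as ℕ
  open import Data.Product.Base using (_×_; _,_; proj₁; proj₂; ∃-syntax)
  open import Data.Rational.Base as ℚ using (ℚ; 0ℚ; 1ℚ)
  import Data.Rational.Properties as ℚ
  open import Data.Sum.Base using (inj₁; inj₂)
  open import Data.Vec.Functional using (tail)
  open import Relation.Binary.PropositionalEquality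
  open import Tactic.RingSolver using (solve-∀)
  open ℝ
  open RationalLemmas
  open IntegerVectors using (_·_)
  open Dirichlet using (cellBound)
  open RationalOrder
  open RationalApproximation using (sumsq; NearSphere; RationalApproximation; rational-approximation; nearSphere-bounded; 0≤ℕ; 1≤ι)

  ∑-approx : ∀ {d} (y : Vector ℝ d) (x : Vector ℚ d) m → (∀ i → approx (y i) m ≡ x i ℚ.* x i) →
             approx (∑ y) m ≡ sumsq x
  ∑-approx {zero}  y x m e = refl
  ∑-approx {suc d} y x m e = cong₂ ℚ._+_ (e zero) (∑-approx (tail y) (tail x) m (λ i → e (suc i)))

  ∑-□ : ∀ {d} (x : Vector ℝ d) m → approx (∑ (λ i → x i * x i)) m ≡ sumsq (λ i → approx (x i) m)
  ∑-□ x m = ∑-approx (λ i → x i * x i) (λ i → approx (x i) m) m (λ i → refl)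

  ‖‖-< : ∀ {d} (x : Vector ℝ d) m {ε b} → 0ℚ ℚ.+ ε ℚ.< b →
         (∀ i → ℚ.∣ approx (x i) m ∣ ℚ.+ ε ℚ.< b) → approx ‖ x ‖ m ℚ.+ ε ℚ.< b
  ‖‖-< {zero}  x m ε<b _ = ε<b
  ‖‖-< {suc d} x m {ε} {b} ε<b x<b = ⊔-< {ℚ.∣ approx (x zero) m ∣} {approx ‖ tail x ‖ m} (x<b zero) (‖‖-< (tail x) m ε<b (λ i → x<b (suc i)))
    where
    ⊔-< : ∀ {u v} → u ℚ.+ ε ℚ.< b → v ℚ.+ ε ℚ.< b → (u ℚ.⊔ v) ℚ.+ ε ℚ.< b
    ⊔-< {u} {v} u<b v<b with ℚ.⊔-sel u v
    ... | inj₁ e = subst (λ s → s ℚ.+ ε ℚ.< b) (sym e) u<b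
    ... | inj₂ e = subst (λ s → s ℚ.+ ε ℚ.< b) (sym e) v<b

  sumsq-/ : ∀ {d} (p : Vector ℤ d) q .{{_ : ℕ.NonZero q}} →
            ι (+ q) ℚ.* ι (+ q) ℚ.* sumsq (λ i → p i ℚ./ q) ≡ ι (p · p)
  sumsq-/ {zero}  p q = ℚ.*-zeroʳ (ι (+ q) ℚ.* ι (+ q))
  sumsq-/ {suc d} p q = trans (e (ι (+ q)) (p zero ℚ./ q) (sumsq (λ i → tail p i ℚ./ q)))
    (trans (cong₂ (λ a b → a ℚ.* a ℚ.+ b) (/-*-cancel (p zero) q) (sumsq-/ (tail p) q))
      (sym (trans (ι-+ (p zero ℤ.* p zero) (tail p · tail p)) (cong (ℚ._+ ι (tail p · tail p)) (ι-* (p zero) (p zero))))))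
    where
    e : ∀ q a s → q ℚ.* q ℚ.* (a ℚ.* a ℚ.+ s) ≡ a ℚ.* q ℚ.* (a ℚ.* q) ℚ.+ q ℚ.* q ℚ.* s
    e = solve-∀ ℚ-ring

  ratPoint∈S : ∀ {n} (p : Vector ℤ (suc n)) q (q≢0 : ℕ.NonZero q) → p · p ≡ + q ℤ.* + q →
               ratPoint p q q≢0 ∈ S n
  ratPoint∈S p q q≢0 p·p≡q² ε ε>0 = 0 , λ m _ →
    subst (λ s → ℚ.∣ s ℚ.- 1ℚ ∣ ℚ.< ε) (sym (trans (∑-□ (ratPoint p q q≢0) m) s≡1)) (dist-refl {1ℚ} ε>0)
    where
    instance _ = q≢0
    s : ℚ
    s = sumsq (λ i → p i ℚ./ q)
    q>0 : 0ℚ ℚ.< ι (+ q)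
    q>0 = 0<ι {+ q} (ℤ.+<+ (ℕ.>-nonZero⁻¹ q))
    q²s≡q² : ι (+ q) ℚ.* ι (+ q) ℚ.* s ≡ ι (+ q) ℚ.* ι (+ q)
    q²s≡q² = trans (sumsq-/ p q) (trans (cong ι p·p≡q²) (ι-* (+ q) (+ q)))
    e₁ : ∀ a s → a ℚ.* s ℚ.- a ≡ a ℚ.* (s ℚ.- 1ℚ)
    e₁ = solve-∀ ℚ-ring
    e₂ : ∀ a s → a ℚ.- a ℚ.* s ≡ a ℚ.* (1ℚ ℚ.- s)
    e₂ = solve-∀ ℚ-ring
    s≡1 : s ≡ 1ℚ
    s≡1 = ℚ.≤-antisym
      (0≤⇒≤ (*-cancel-0≤ (*-pos q>0 q>0) (subst (0ℚ ℚ.≤_) (e₂ (ι (+ q) ℚ.* ι (+ q)) s)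
        (≤⇒0≤ (ℚ.≤-reflexive q²s≡q²)))) refl)
      (0≤⇒≤ (*-cancel-0≤ (*-pos q>0 q>0) (subst (0ℚ ℚ.≤_) (e₁ (ι (+ q) ℚ.* ι (+ q)) s)
        (≤⇒0≤ (ℚ.≤-reflexive (sym q²s≡q²))))) refl)

  -- A substitute for the floor of N, which is not computable from a Cauchy sequence; the slack
  -- factor 4 only enlarges the constant.
  Scale : ℝ → Set
  Scale N = ∃[ k ] 1 ℕ.≤ k × ∃[ M ] ∀ m → M ℕ.≤ m → ι (+ k) ℚ.≤ approx N m × approx N m ℚ.≤ ι (+ 4) ℚ.* ι (+ k)

  integer-scale : ∀ N → 1ℝ < N → Scale N
  integer-scale N (ε , ε>0 , M₂ , 1+ε<N) = by-floor (proj₁ r-floor) (proj₂ r-floor)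
    where
    M₁ = proj₁ (cauchy N 1ℚ (ℚ.positive⁻¹ 1ℚ))
    M = M₁ ℕ.⊔ M₂
    r = approx N M
    r-floor = floor-bounds r
    N>1 : ∀ m → M ℕ.≤ m → 1ℚ ℚ.< approx N m
    N>1 m M≤m = ℚ.<-trans (subst (ℚ._< 1ℚ ℚ.+ ε) (ℚ.+-identityʳ 1ℚ) (ℚ.+-monoʳ-< 1ℚ ε>0))
      (1+ε<N m (ℕ.m⊔n≤o⇒n≤o M₁ M₂ M≤m))
    N-r : ∀ m → M ℕ.≤ m → ℚ.∣ approx N m ℚ.- r ∣ ℚ.< 1ℚ
    N-r m M≤m = proj₂ (cauchy N 1ℚ (ℚ.positive⁻¹ 1ℚ)) m M (ℕ.m⊔n≤o⇒m≤o M₁ M₂ M≤m) (ℕ.m≤m⊔n M₁ M₂)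
    by-floor : ∀ z → 0ℚ ℚ.≤ r ℚ.- ι z × 0ℚ ℚ.≤ 1ℚ ℚ.- (r ℚ.- ι z) → Scale N
    by-floor z@(+ 0) (_ , r≤z+1) = ⊥-elim (<⇒≱ (N>1 M ℕ.≤-refl) (0≤⇒≤ r≤z+1 (e r)))
      where
      e : ∀ r → 1ℚ ℚ.- r ≡ 1ℚ ℚ.- (r ℚ.- 0ℚ)
      e = solve-∀ ℚ-ring
    by-floor (ℤ.-[1+ j ]) (_ , r≤z+1) = ⊥-elim (<⇒≱ (N>1 M ℕ.≤-refl)
      (0≤⇒≤ (0≤+ r≤z+1 (≤⇒0≤ (ι-mono-≤ {ℤ.-[1+ j ]} {+ 0} ℤ.-≤+))) (e r (ι (ℤ.-[1+ j ])))))
      where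
      e : ∀ r z → 1ℚ ℚ.- r ≡ 1ℚ ℚ.- (r ℚ.- z) ℚ.+ (0ℚ ℚ.- z)
      e = solve-∀ ℚ-ring
    -- Floor 1 is kept as k = 1, since N > 1 gives the lower bound; above, N < r + 1 ≤ 3.
    by-floor (+[1+ 0 ]) (_ , r≤z+1) = 1 , ℕ.≤-refl , M , λ m M≤m →
      ℚ.<⇒≤ (N>1 m M≤m) ,
      0≤⇒≤ (0≤+ (0≤+ (≤⇒0≤ (ℚ.<⇒≤ (dist⇒< (approx N m) r (N-r m M≤m)))) r≤z+1) (0≤ℕ 1)) (e (approx N m) r)
      where
      e : ∀ N r → ι (+ 4) ℚ.* ι (+ 1) ℚ.- N ≡ (r ℚ.+ 1ℚ) ℚ.- N ℚ.+ (1ℚ ℚ.- (r ℚ.- ι (+ 1))) ℚ.+ ι (+ 1)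
      e = solve-∀ ℚ-ring
    -- The floor z of r is lowered by one, since later approximations of N may fall below r, though
    -- by less than 1. With k = z - 1 they stay above r - 1 ≥ k and below r + 1 ≤ k + 3 ≤ 4 k.
    by-floor (+[1+ suc j ]) (z≤r , r≤z+1) = suc j , ℕ.s≤s ℕ.z≤n , M , λ m M≤m →
      0≤⇒≤ (0≤+ (≤⇒0≤ (ℚ.<⇒≤ (dist⇒<′ (approx N m) r (N-r m M≤m)))) (subst (λ z → 0ℚ ℚ.≤ r ℚ.- z) z≡ z≤r))
        (e₁ (approx N m) r (ι (+ suc j))) ,
      0≤⇒≤ (0≤+ (0≤+ (≤⇒0≤ (ℚ.<⇒≤ (dist⇒< (approx N m) r (N-r m M≤m))))
                     (subst (λ z → 0ℚ ℚ.≤ 1ℚ ℚ.- (r ℚ.- z)) z≡ r≤z+1))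
                (0≤* (0≤ℕ 3) (≤⇒0≤ (1≤ι (suc j) (ℕ.s≤s ℕ.z≤n))))) (e₂ (approx N m) r (ι (+ suc j)))
      where
      z≡ : ι (+[1+ suc j ]) ≡ 1ℚ ℚ.+ ι (+ suc j)
      z≡ = ι-+ ℤ.1ℤ (+ suc j)
      e₁ : ∀ N r k → N ℚ.- k ≡ N ℚ.+ 1ℚ ℚ.- r ℚ.+ (r ℚ.- (1ℚ ℚ.+ k))
      e₁ = solve-∀ ℚ-ring
      e₂ : ∀ N r k → ι (+ 4) ℚ.* k ℚ.- N ≡ (r ℚ.+ 1ℚ) ℚ.- N ℚ.+ (1ℚ ℚ.- (r ℚ.- (1ℚ ℚ.+ k))) ℚ.+ ι (+ 3) ℚ.* (k ℚ.- 1ℚ)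
      e₂ = solve-∀ ℚ-ring

  uniformly-cauchy : ∀ {d} (x : Vector ℝ d) ε → 0ℚ ℚ.< ε →
    ∃[ M ] ∀ i m n → M ℕ.≤ m → M ℕ.≤ n → ℚ.∣ approx (x i) m ℚ.- approx (x i) n ∣ ℚ.< ε
  uniformly-cauchy {zero}  x ε ε>0 = 0 , λ ()
  uniformly-cauchy {suc d} x ε ε>0 =
    let M₁ , c₁ = cauchy (x zero) ε ε>0
        M₂ , c₂ = uniformly-cauchy (tail x) ε ε>0
    in M₁ ℕ.⊔ M₂ , λ where
      zero    m n M≤m M≤n → c₁ m n (ℕ.m⊔n≤o⇒m≤o M₁ M₂ M≤m) (ℕ.m⊔n≤o⇒m≤o M₁ M₂ M≤n)
      (suc i) m n M≤m M≤n → c₂ i m n (ℕ.m⊔n≤o⇒n≤o M₁ M₂ M≤m) (ℕ.m⊔n≤o⇒n≤o M₁ M₂ M≤n)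

  ∣∣<recip⇒ : ∀ {a b} → 0ℚ ℚ.< b → ℚ.∣ a ∣ ℚ.< recip b → b ℚ.* a ≤± 1ℚ
  ∣∣<recip⇒ {a} {b} b>0 a< =
    subst (λ s → 0ℚ ℚ.≤ s ℚ.+ b ℚ.* a) (recip-* b>0) (subst (0ℚ ℚ.≤_) (e₁ a b (recip b)) (0≤* (ℚ.<⇒≤ b>0) (lower (∣∣<⇒≤± a<)))) ,
    subst (λ s → 0ℚ ℚ.≤ s ℚ.- b ℚ.* a) (recip-* b>0) (subst (0ℚ ℚ.≤_) (e₂ a b (recip b)) (0≤* (ℚ.<⇒≤ b>0) (upper (∣∣<⇒≤± a<))))
    where
    e₁ : ∀ a b r → b ℚ.* (r ℚ.+ a) ≡ b ℚ.* r ℚ.+ b ℚ.* a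
    e₁ = solve-∀ ℚ-ring
    e₂ : ∀ a b r → b ℚ.* (r ℚ.- a) ≡ b ℚ.* r ℚ.- b ℚ.* a
    e₂ = solve-∀ ℚ-ring

  root-□≤ : ∀ m {p} → 0ℚ ℚ.≤ p → rootApprox m p ℚ.* rootApprox m p ℚ.≤ p
  root-□≤ m {p} 0≤p = subst (rootApprox m p ℚ.* rootApprox m p ℚ.≤_) (ℚ.p≥q⇒p⊔q≡p 0≤p) (rootApprox-lower m p)

  -- A rational stand-in for a number above the square root of 8 E + 8: it exceeds 1, so its square
  -- is at least itself and hence greater than 8 E + 8.
  constant : ℚ → ℚ
  constant E = ι (+ 8) ℚ.* E ℚ.+ ι (+ 9)

  -- Here z is the error, and g₁, g₂ approximate the roots of q and N. The summand ε = 1 / k is the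
  -- gap that a strict inequality of reals requires; it is affordable because q k ε² = q / k ≤ 1.
  -- Then (z + ε)² g₁² g₂² ≤ 4 q k (z + ε)² ≤ 8 q k (z² + ε²) ≤ 8 E + 8.
  bound-transfer : ∀ {z g₁ g₂ q k E} → 0ℚ ℚ.≤ z → 0ℚ ℚ.≤ q → q ℚ.≤ k → 0ℚ ℚ.< k → 0ℚ ℚ.≤ E →
    q ℚ.* k ℚ.* (z ℚ.* z) ℚ.≤ E → g₁ ℚ.* g₁ ℚ.≤ q → g₂ ℚ.* g₂ ℚ.≤ ι (+ 4) ℚ.* k → 0ℚ ℚ.< g₁ ℚ.* g₂ →
    z ℚ.+ recip k ℚ.< constant E ℚ.* recip (g₁ ℚ.* g₂)
  bound-transfer {z} {g₁} {g₂} {q} {k} {E} 0≤z 0≤q q≤k 0<k 0≤E qkz²≤E g₁²≤q g₂²≤4k g>0 =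
    subst (ℚ._< c ℚ.* recip g) (trans (e₁ (z ℚ.+ ε) g (recip g)) (trans (cong ((z ℚ.+ ε) ℚ.*_) (recip-* g>0)) (ℚ.*-identityʳ (z ℚ.+ ε))))
      (ℚ.*-monoˡ-<-pos (recip g) {{ℚ.positive (recip-pos g>0)}} [z+ε]g<c)
    where
    g = g₁ ℚ.* g₂
    ε = recip k
    c = constant E
    e₁ : ∀ a g r → a ℚ.* g ℚ.* r ≡ a ℚ.* (g ℚ.* r)
    e₁ = solve-∀ ℚ-ring
    c≥0 : 0ℚ ℚ.≤ c
    c≥0 = 0≤+ (0≤* (0≤ℕ 8) 0≤E) (0≤ℕ 9)
    g²≤4qk : g₁ ℚ.* g₁ ℚ.* (g₂ ℚ.* g₂) ℚ.≤ q ℚ.* (ι (+ 4) ℚ.* k)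
    g²≤4qk = *-mono-≤ (0≤□ g₁) (0≤* (0≤ℕ 4) (ℚ.<⇒≤ 0<k)) g₁²≤q g₂²≤4k
    qkε²≤1 : q ℚ.* k ℚ.* (ε ℚ.* ε) ℚ.≤ 1ℚ
    qkε²≤1 = subst (q ℚ.* k ℚ.* (ε ℚ.* ε) ℚ.≤_) (cong₂ ℚ._*_ (recip-* 0<k) (recip-* 0<k))
      (0≤⇒≤ (0≤* (≤⇒0≤ q≤k) (0≤* (ℚ.<⇒≤ 0<k) (0≤□ ε))) (e q k ε))
      where
      e : ∀ q k ε → k ℚ.* ε ℚ.* (k ℚ.* ε) ℚ.- q ℚ.* k ℚ.* (ε ℚ.* ε) ≡ (k ℚ.- q) ℚ.* (k ℚ.* (ε ℚ.* ε))
      e = solve-∀ ℚ-ring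
    □≤ : (z ℚ.+ ε) ℚ.* g ℚ.* ((z ℚ.+ ε) ℚ.* g) ℚ.≤ ι (+ 8) ℚ.* E ℚ.+ ι (+ 8)
    □≤ = 0≤⇒≤ (0≤+ (0≤+ (0≤* (0≤□ (z ℚ.+ ε)) (≤⇒0≤ g²≤4qk))
                        (0≤* (0≤* (0≤ℕ 4) (0≤* 0≤q (ℚ.<⇒≤ 0<k))) (0≤□ (z ℚ.- ε))))
                   (0≤+ (0≤* (0≤ℕ 8) (≤⇒0≤ qkz²≤E)) (0≤* (0≤ℕ 8) (≤⇒0≤ qkε²≤1)))) (e z ε g₁ g₂ q k E)
      where
      e : ∀ z ε g₁ g₂ q k E → ι (+ 8) ℚ.* E ℚ.+ ι (+ 8) ℚ.- (z ℚ.+ ε) ℚ.* (g₁ ℚ.* g₂) ℚ.* ((z ℚ.+ ε) ℚ.* (g₁ ℚ.* g₂)) ≡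
        (z ℚ.+ ε) ℚ.* (z ℚ.+ ε) ℚ.* (q ℚ.* (ι (+ 4) ℚ.* k) ℚ.- g₁ ℚ.* g₁ ℚ.* (g₂ ℚ.* g₂))
        ℚ.+ ι (+ 4) ℚ.* (q ℚ.* k) ℚ.* ((z ℚ.- ε) ℚ.* (z ℚ.- ε))
        ℚ.+ (ι (+ 8) ℚ.* (E ℚ.- q ℚ.* k ℚ.* (z ℚ.* z)) ℚ.+ ι (+ 8) ℚ.* (1ℚ ℚ.- q ℚ.* k ℚ.* (ε ℚ.* ε)))
      e = solve-∀ ℚ-ring
    8E+8<c² : ι (+ 8) ℚ.* E ℚ.+ ι (+ 8) ℚ.< c ℚ.* c
    8E+8<c² = ℚ.<-≤-trans (ℚ.+-monoʳ-< (ι (+ 8) ℚ.* E) (ι-mono-< {+ 8} {+ 9} (ℤ.+<+ ℕ.≤-refl)))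
      (0≤⇒≤ (0≤* c≥0 (0≤+ (0≤* (0≤ℕ 8) 0≤E) (0≤ℕ 8))) (e E))
      where
      e : ∀ E → (ι (+ 8) ℚ.* E ℚ.+ ι (+ 9)) ℚ.* (ι (+ 8) ℚ.* E ℚ.+ ι (+ 9)) ℚ.- (ι (+ 8) ℚ.* E ℚ.+ ι (+ 9)) ≡
        (ι (+ 8) ℚ.* E ℚ.+ ι (+ 9)) ℚ.* (ι (+ 8) ℚ.* E ℚ.+ ι (+ 8))
      e = solve-∀ ℚ-ring
    [z+ε]g<c : (z ℚ.+ ε) ℚ.* g ℚ.< c
    [z+ε]g<c = square-cancel-< c≥0 (ℚ.≤-<-trans □≤ 8E+8<c²)

  module _ (n : ℕ) {{_ : ℕ.NonZero n}} where
    Sⁿ : ℕ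
    Sⁿ = suc (cellBound n)

    Eⁿ : ℚ
    Eⁿ = ι (+ 672) ℚ.* (ι (+ Sⁿ) ℚ.* ι (+ Sⁿ) ℚ.* (ι (+ Sⁿ) ℚ.* ι (+ Sⁿ)))

    0≤Eⁿ : 0ℚ ℚ.≤ Eⁿ
    0≤Eⁿ = 0≤* (0≤ℕ 672) (0≤□ (ι (+ Sⁿ) ℚ.* ι (+ Sⁿ)))

    Cⁿ : ℝ
    Cⁿ = ofℚ (constant Eⁿ)

    module _ (α : Vector ℝ (suc n)) (α∈S : α ∈ S n) (N : ℝ) (N>1 : 1ℝ < N) where
      Goal : Set
      Goal = Σ[ p ∈ Vector ℤ (suc n) ] Σ[ q ∈ ℕ ] Σ[ q≢0 ∈ ℕ.NonZero q ]
        ratPoint p q q≢0 ∈ S n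
        × ofℕ q ≤ N
        × ‖ α ⊖ ratPoint p q q≢0 ‖ < Cⁿ / (√ ofℕ q * √ N) [ √q√N-positive q q≢0 N N>1 ]

      at-scale : Scale N → Goal
      at-scale (k , 1≤k , Mᴺ , N-bounds) = from-rational (rational-approximation Sⁿ ℕ.≤-refl k 1≤k x (near M ℕ.≤-refl))
        where
        kℚ : ℚ
        kℚ = ι (+ k)
        0<k : 0ℚ ℚ.< kℚ
        0<k = 0<ι {+ k} (ℤ.+<+ 1≤k)
        2k²>0 : 0ℚ ℚ.< ι (+ 2) ℚ.* (kℚ ℚ.* kℚ)
        2k²>0 = *-pos (ℚ.positive⁻¹ (ι (+ 2))) (*-pos 0<k 0<k)
        sphere = α∈S (recip (ι (+ 2) ℚ.* (kℚ ℚ.* kℚ))) (recip-pos 2k²>0)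
        cauchyα = uniformly-cauchy α (recip kℚ) (recip-pos 0<k)
        M₁ = proj₁ sphere
        M₂ = proj₁ cauchyα
        -- Freezing α at this index moves each coordinate by at most 1 / k, which is no larger than
        -- the target order 1 / √(q k), as q ≤ k.
        M = M₁ ℕ.⊔ M₂
        x : Vector ℚ (suc n)
        x i = approx (α i) M
        near : ∀ m → M ℕ.≤ m → NearSphere kℚ (λ i → approx (α i) m)
        near m M≤m = ∣∣<recip⇒ 2k²>0 (subst (λ s → ℚ.∣ s ℚ.- 1ℚ ∣ ℚ.< recip (ι (+ 2) ℚ.* (kℚ ℚ.* kℚ))) (∑-□ α m)
          (proj₂ sphere m (ℕ.m⊔n≤o⇒m≤o M₁ M₂ M≤m)))
        bounded-α : ∀ m → M ℕ.≤ m → ∀ i → approx (α i) m ≤± ι (+ 2)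
        bounded-α m M≤m = nearSphere-bounded (λ i → approx (α i) m) (1≤ι k 1≤k) (near m M≤m)
        close-α : ∀ m → M ℕ.≤ m → ∀ i → kℚ ℚ.* (approx (α i) m ℚ.- x i) ≤± 1ℚ
        close-α m M≤m i = ∣∣<recip⇒ 0<k (proj₂ cauchyα i m M (ℕ.m⊔n≤o⇒n≤o M₁ M₂ M≤m) (ℕ.m≤n⊔m M₁ M₂))

        from-rational : RationalApproximation Sⁿ k x → Goal
        from-rational (p , q , q≢0 , p·p≡q² , q≤k , bound) = p , q , q≢0 , ratPoint∈S p q q≢0 p·p≡q² , q≤N ,
          strict (√q√N-positive q q≢0 N N>1)
          where
          instance _ = q≢0
          qℚ≤k : ι (+ q) ℚ.≤ kℚ
          qℚ≤k = ι-mono-≤ {+ q} {+ k} (ℤ.+≤+ q≤k)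
          q≤N : ofℕ q ≤ N
          q≤N ε ε>0 = Mᴺ , λ m Mᴺ≤m → ℚ.≤-<-trans (ℚ.≤-trans qℚ≤k (proj₁ (N-bounds m Mᴺ≤m)))
            (subst (ℚ._< approx N m ℚ.+ ε) (ℚ.+-identityʳ (approx N m)) (ℚ.+-monoʳ-< (approx N m) ε>0))
          strict : ∀ pos → ‖ α ⊖ ratPoint p q q≢0 ‖ < Cⁿ / (√ ofℕ q * √ N) [ pos ]
          -- The gap 1 / k does not depend on m. The bound δ serves to make the approximation of √q
          -- √N positive from index `K` on, so that its reciprocal is the true one.
          strict (δ , δ>0 , K , δ<g) = recip kℚ , recip-pos 0<k , K ℕ.⊔ (M ℕ.⊔ Mᴺ) , λ m le →
            let K≤m = ℕ.m⊔n≤o⇒m≤o K (M ℕ.⊔ Mᴺ) le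
                M≤m = ℕ.m⊔n≤o⇒m≤o M Mᴺ (ℕ.m⊔n≤o⇒n≤o K (M ℕ.⊔ Mᴺ) le)
                Mᴺ≤m = ℕ.m⊔n≤o⇒n≤o M Mᴺ (ℕ.m⊔n≤o⇒n≤o K (M ℕ.⊔ Mᴺ) le)
                transfer : ∀ {z} → 0ℚ ℚ.≤ z → ι (+ q) ℚ.* kℚ ℚ.* (z ℚ.* z) ℚ.≤ Eⁿ →
                  z ℚ.+ recip kℚ ℚ.< constant Eⁿ ℚ.* recip (approx (√ ofℕ q * √ N) m)
                transfer {z} 0≤z qkz²≤E = bound-transfer {z} {approx (√ ofℕ q) m} {approx (√ N) m} {ι (+ q)} {kℚ} {Eⁿ} 0≤z (0≤ℕ q) qℚ≤k 0<k 0≤Eⁿ qkz²≤E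
                  (root-□≤ m (0≤ℕ q))
                  (ℚ.≤-trans (root-□≤ m (ℚ.≤-trans (ℚ.<⇒≤ 0<k) (proj₁ (N-bounds m Mᴺ≤m)))) (proj₂ (N-bounds m Mᴺ≤m)))
                  (ℚ.<-trans (subst (0ℚ ℚ.<_) (sym (ℚ.+-identityˡ δ)) δ>0) (δ<g m K≤m))
            in ‖‖-< (α ⊖ ratPoint p q q≢0) m
              (transfer ℚ.≤-refl (subst (ℚ._≤ Eⁿ) (sym (ℚ.*-zeroʳ (ι (+ q) ℚ.* kℚ))) 0≤Eⁿ))
              λ i → transfer (ℚ.0≤∣p∣ (approx ((α ⊖ ratPoint p q q≢0) i) m))
                (subst (λ s → ι (+ q) ℚ.* kℚ ℚ.* s ℚ.≤ Eⁿ) (sym (∣a∣□ (approx (α i) m ℚ.- p i ℚ./ q)))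
                  (bound (approx (α i) m) i (close-α m M≤m i) (bounded-α m M≤m i)))

      uniformly-dirichlet : Goal
      uniformly-dirichlet = at-scale (integer-scale N N>1)

theorem4p1 : ∀ (n : ℕ) → n ≥ 1 →
    Σ[ C ∈ ℝ ] ∀ (α : Vector ℝ (suc n)) → α ∈ S n → α ∈ UniformlyDirichlet½½ C (S n)
theorem4p1 n n≥1 = Cⁿ n , uniformly-dirichlet n
  where
  open RealApproximation
  open import Data.Product.Base using (_,_)
  import Data.Nat.Base as ℕ
  instance _ = ℕ.>-nonZero n≥1
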